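{- Let $T$ be a tree of order at least $6$. Then the following four statements are equivalent: (1) $T$ is in Class $3$, i.e. $\mathrm{sd}_{\gamma_t}(T)=3$; (2) $T\in\mathcal{T}$; (3) $T\in\mathcal{O}$; (4) there is a uniquely determined subset $F\subseteq E(T)$ such that (a) every pendant edge of $T$ belongs to $F$; (b) $d_T(e,F\setminus\{e\})=3$ for every $e\in F$; (c) for any two distinct $e,f\in F$ there is a unique sequence $(e_0,e_1,\ldots,e_k)$ of elements of $F$ with $e_0=e$, $e_k=f$ and $d_T(e_{i-1},e_i)=3$ for all $i\in\{1,\ldots,k\}$.
   Context: A total dominating set (TD-set) of a graph $G$ is a set $S\subseteq V(G)$ such that every vertex of $G$ has a neighbor in $S$; $\gamma_t(G)$ is the minimum size of a TD-set. The total domination subdivision number $\mathrm{sd}_{\gamma_t}(G)$ is the minimum number of edges that must be subdivided (each edge subdivided at most once, i.e. replaced by a path of length 2 through a new vertex) in order to increase $\gamma_t$. For trees this number is $1$, $2$ or $3$, and a tree is said to be in Class $k$ if its total domination subdivision number is $k$. A leaf is a vertex of degree 1, a support vertex is a neighbor of a leaf, and a pendant edge is an edge joining a leaf to its support vertex. For vertex sets $X,Y$, $d_T(X,Y)=\min\{d_T(x,y):x\in X,y\in Y\}$; the distance between edges $e_1=u_1v_1$ and $e_2=u_2v_2$ is $d_T(\{u_1,v_1\},\{u_2,v_2\})$, and for a set $F$ of edges $d_T(e,F)=\min_{f\in F}d_T(e,f)$. Family $\mathcal{T}$ (labeled trees, each vertex has a status in $\{A,B,C\}$): it contains the path $P_6$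 whose two leaves have status $C$, whose two support vertices have status $B$, and whose two central vertices have status $A$; and it is closed under: Operation $\mathcal{T}_1$: for a vertex $y$ of status $A$, add a new path $xwv$ and the edge $xy$, with statuses $x\colon A$, $w\colon B$, $v\colon C$; Operation $\mathcal{T}_2$: for a vertex $y$ of status $B$ or $C$, add a new path $xwvu$ and the edge $xy$, with statuses $x\colon A$, $w\colon A$, $v\colon B$, $u\colon C$. Family $\mathcal{O}$ (labeled trees, each vertex has status $A$ or $B$): it contains the path $P_6$ whose two central vertices have status $A$ and whose other four vertices have status $B$; and it is closed under: Operation $\mathcal{O}_1$: for a path $xyz$ in the current tree with $x,y$ of status $B$ and $z$ of status $A$, add a new path $abc$ and the edge $za$, with statuses $a\colon A$, $b\colon B$, $c\colon B$ (this identifies a B-B-A path of the tree with a B-B-A path of a labeled $P_6$); Operation $\mathcal{O}_2$: for an edge $xy$ of the current tree with both $x,y$ of status $B$, add a new path $abcd$ and the edge $dx$, with statuses $a\colon B$, $b\colon B$, $c\colon A$, $d\colon A$ (this identifies a B-B edge of the tree with a B-B edge of a labeled $P_6$). For an unlabeled tree $T$, "$T\in\mathcal{T}$" (resp. "$T\in\mathcal{O}$") means $T$ is the underlying tree (labels removed) of some labeled tree in $\mathcal{T}$ (resp. $\mathcal{O}$).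
   Formalization: In (4)(c) the terms of the sequence (e_0,...,e_k) are required to be pairwise distinct; with repetitions allowed, e,f,e,f would be a second sequence from e to f whenever d(e,f)=3, so (4) would fail even for P_6, which is in Class 3. -}

module Defs where

open import Data.Bool using (Bool; true; false; T; not; _∧_; _∨_)
open import Data.Bool.ListAction using (any; or)
open import Data.Bool.Properties using (∨-comm)
open import Data.Fin using (Fin; toℕ; splitAt; _<_; _≟_)
open import Data.Fin.Patterns using (0F; 3F)
open import Data.Fin.Subset using (Subset; _∈_; ∣_∣)
open import Data.List as List using (List; head; last; length)
open import Data.List.Properties using (map-cong)
open import Data.List.Relation.Unary.All using (All)
open import Data.List.Relation.Unary.Linked using (Linked)
open import Data.List.Relation.Unary.Unique.Propositional using (Unique)
open import Data.Maybe using (just)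
open import Data.Nat as ℕ using (ℕ; zero; suc; _+_; _≤_; _≡ᵇ_)
open import Data.Product using (∃; ∃!; ∃-syntax; _×_)
open import Data.Sum using (_⊎_; inj₁; inj₂)
open import Data.Vec as Vec using (Vec; []; _∷_; _++_; tabulate)
open import Function using (_↔_; _∘_; Inverse)
open import Level using (0ℓ)
open import Relation.Binary using (Rel)
open import Relation.Binary.PropositionalEquality
  using (_≡_; _≢_; _≗_; refl; cong; cong₂)
open import Relation.Nullary using (¬_)
open import Relation.Nullary.Decidable using (does)
open import Relation.Unary using (Pred; _∖_; ｛_｝)

private
  variable
    n m : ℕ

record IsMinimum (P : Pred ℕ 0ℓ) (k : ℕ) : Set where
  field
    attained : P k
    minimal  : ∀ {j} → P j → k ≤ j

record IsWalk {A : Set} (R : Rel A 0ℓ) (x y : A) (xs : List A) : Set where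
  field
    starts : head xs ≡ just x
    ends   : last xs ≡ just y
    linked : Linked R xs

record Graph (n : ℕ) : Set where
  field
    adj    : Fin n → Fin n → Bool
    sym    : ∀ u v → adj u v ≡ adj v u
    irrefl : ∀ v → adj v v ≡ false

open Graph public using (adj)

Adj : Graph n → Rel (Fin n) 0ℓ
Adj G u v = T (adj G u v)

record _≅_ (G : Graph n) (H : Graph m) : Set where
  field
    bijection : Fin n ↔ Fin m
    preserves : ∀ u v →
      adj G u v ≡ adj H (Inverse.to bijection u) (Inverse.to bijection v)

record IsTree (G : Graph n) : Set where
  field
    nonempty  : 1 ≤ n
    connected : ∀ u v → ∃ (IsWalk (Adj G) u v)
    acyclic   : ∀ {u v xs} → IsWalk (Adj G) u v xs → Unique xs →
                3 ≤ length xs → ¬ Adj G v u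

degree : Graph n → Fin n → ℕ
degree G v = ∣ tabulate (adj G v) ∣

Leaf : Graph n → Pred (Fin n) 0ℓ
Leaf G v = degree G v ≡ 1

Support : Graph n → Pred (Fin n) 0ℓ
Support G v = ∃[ u ] Leaf G u × Adj G v u

-- Storing the smaller endpoint first gives each edge exactly one
-- representative up to _≡_ (both proof fields are propositions).
record Edge (G : Graph n) : Set where
  field
    src tgt  : Fin n
    ordered  : src < tgt
    adjacent : Adj G src tgt

open Edge public using (src; tgt)

EndOf : {G : Graph n} → Edge G → Pred (Fin n) 0ℓ
EndOf e v = v ≡ src e ⊎ v ≡ tgt e

Pendant : (G : Graph n) → Pred (Edge G) 0ℓ
Pendant G e = (Leaf G (src e) × Support G (tgt e))
            ⊎ (Leaf G (tgt e) × Support G (src e))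

-- IsDist G u v k says that d(u,v) = k; likewise for the other distances.
IsDist : (G : Graph n) → Fin n → Fin n → Pred ℕ 0ℓ
IsDist G u v = IsMinimum λ k →
  ∃[ xs ] IsWalk (Adj G) u v xs × length xs ≡ suc k

IsSetDist : (G : Graph n) → (X Y : Pred (Fin n) 0ℓ) → Pred ℕ 0ℓ
IsSetDist G X Y = IsMinimum λ k →
  ∃[ x ] ∃[ y ] X x × Y y × IsDist G x y k

IsEdgeDist : (G : Graph n) → (e f : Edge G) → Pred ℕ 0ℓ
IsEdgeDist G e f = IsSetDist G (EndOf e) (EndOf f)

IsEdgeSetDist : (G : Graph n) → Edge G → Pred (Edge G) 0ℓ → Pred ℕ 0ℓ
IsEdgeSetDist G e P = IsMinimum λ k → ∃[ f ] P f × IsEdgeDist G e f k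

TotalDominating : Graph n → Pred (Subset n) 0ℓ
TotalDominating G S = ∀ v → ∃[ u ] u ∈ S × Adj G v u

Isγₜ : Graph n → Pred ℕ 0ℓ
Isγₜ G = IsMinimum λ k → ∃[ S ] TotalDominating G S × ∣ S ∣ ≡ k

module _ (_~_ : (a b : Fin n ⊎ Fin m) → Bool)
         (~-sym : ∀ a b → (a ~ b) ≡ (b ~ a))
         (~-irrefl : ∀ a → (a ~ a) ≡ false) where

  onSum : Graph (n + m)
  onSum = record
    { adj    = λ i j → splitAt n i ~ splitAt n j
    ; sym    = λ i j → ~-sym (splitAt n i) (splitAt n j)
    ; irrefl = λ i → ~-irrefl (splitAt n i)
    }

_==_ : Fin n → Fin n → Bool
u == v = does (u ≟ v)

-- Subdividing every edge of D (meant to be duplicate-free), the edge at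
-- position i of D being replaced by a path through the new vertex inj₂ i.
module _ (G : Graph n) (D : List (Edge G)) where

  joins : Fin n → Fin n → Edge G → Bool
  joins u v e = (src e == u ∧ tgt e == v) ∨ (src e == v ∧ tgt e == u)

  isEnd : Fin n → Edge G → Bool
  isEnd u e = src e == u ∨ tgt e == u

  subdivideAdj : (a b : Fin n ⊎ Fin (length D)) → Bool
  subdivideAdj (inj₁ u) (inj₁ v) = adj G u v ∧ not (any (joins u v) D)
  subdivideAdj (inj₁ u) (inj₂ i) = isEnd u (List.lookup D i)
  subdivideAdj (inj₂ i) (inj₁ u) = isEnd u (List.lookup D i)
  subdivideAdj (inj₂ _) (inj₂ _) = false

  subdivideAdj-sym : ∀ a b → subdivideAdj a b ≡ subdivideAdj b a
  subdivideAdj-sym (inj₁ u) (inj₁ v) = cong₂ _∧_ (Graph.sym G u v)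
    (cong (not ∘ or) (map-cong (λ e → ∨-comm (src e == u ∧ tgt e == v) _) D))
  subdivideAdj-sym (inj₁ _) (inj₂ _) = refl
  subdivideAdj-sym (inj₂ _) (inj₁ _) = refl
  subdivideAdj-sym (inj₂ _) (inj₂ _) = refl

  subdivideAdj-irrefl : ∀ a → subdivideAdj a a ≡ false
  subdivideAdj-irrefl (inj₁ v) = cong (_∧ not (any (joins v v) D)) (Graph.irrefl G v)
  subdivideAdj-irrefl (inj₂ _) = refl

  subdivide : Graph (n + length D)
  subdivide = onSum subdivideAdj subdivideAdj-sym subdivideAdj-irrefl

Increasesγₜ : (G : Graph n) → Pred (List (Edge G)) 0ℓ
Increasesγₜ G D =
  ∃[ a ] ∃[ b ] Isγₜ G a × Isγₜ (subdivide G D) b × a ℕ.< b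

IsSdγₜ : Graph n → Pred ℕ 0ℓ
IsSdγₜ G = IsMinimum λ k →
  ∃[ D ] Unique D × length D ≡ k × Increasesγₜ G D

InClass : ℕ → Graph n → Set
InClass k G = IsSdγₜ G k

path : ∀ k → Graph k
path k = record
  { adj    = λ i j → follows i j ∨ follows j i
  ; sym    = λ i j → ∨-comm (follows i j) (follows j i)
  ; irrefl = λ i → cong₂ _∨_ (suc≢ᵇ (toℕ i)) (suc≢ᵇ (toℕ i))
  }
  where
  follows : Fin k → Fin k → Bool
  follows i j = suc (toℕ i) ≡ᵇ toℕ j

  suc≢ᵇ : ∀ i → (suc i ≡ᵇ i) ≡ false
  suc≢ᵇ zero    = refl
  suc≢ᵇ (suc i) = suc≢ᵇ i

-- Disjoint union of G and H plus the edge yx.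
module _ (G : Graph n) (y : Fin n) (H : Graph m) (x : Fin m) where

  attachAdj : (a b : Fin n ⊎ Fin m) → Bool
  attachAdj (inj₁ u) (inj₁ v) = adj G u v
  attachAdj (inj₁ u) (inj₂ w) = u == y ∧ w == x
  attachAdj (inj₂ w) (inj₁ u) = u == y ∧ w == x
  attachAdj (inj₂ w) (inj₂ z) = adj H w z

  attachAdj-sym : ∀ a b → attachAdj a b ≡ attachAdj b a
  attachAdj-sym (inj₁ u) (inj₁ v) = Graph.sym G u v
  attachAdj-sym (inj₁ _) (inj₂ _) = refl
  attachAdj-sym (inj₂ _) (inj₁ _) = refl
  attachAdj-sym (inj₂ w) (inj₂ z) = Graph.sym H w z

  attachAdj-irrefl : ∀ a → attachAdj a a ≡ false
  attachAdj-irrefl (inj₁ v) = Graph.irrefl G v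
  attachAdj-irrefl (inj₂ w) = Graph.irrefl H w

  attach : Graph (n + m)
  attach = onSum attachAdj attachAdj-sym attachAdj-irrefl

data Status : Set where
  A B C : Status

data Labelled𝓣 : Graph n → Vec Status n → Set where
  p₆  : Labelled𝓣 (path 6) (C ∷ B ∷ A ∷ A ∷ B ∷ C ∷ [])
  op₁ : {G : Graph n} {ℓ : Vec Status n} → Labelled𝓣 G ℓ →
        ∀ y → Vec.lookup ℓ y ≡ A →
        Labelled𝓣 (attach G y (path 3) 0F) (ℓ ++ A ∷ B ∷ C ∷ [])
  op₂ : {G : Graph n} {ℓ : Vec Status n} → Labelled𝓣 G ℓ →
        ∀ y → Vec.lookup ℓ y ≡ B ⊎ Vec.lookup ℓ y ≡ C →
        Labelled𝓣 (attach G y (path 4) 0F) (ℓ ++ A ∷ A ∷ B ∷ C ∷ [])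

data Status′ : Set where
  A B : Status′

data Labelled𝓞 : Graph n → Vec Status′ n → Set where
  p₆  : Labelled𝓞 (path 6) (B ∷ B ∷ A ∷ A ∷ B ∷ B ∷ [])
  op₁ : {G : Graph n} {ℓ : Vec Status′ n} → Labelled𝓞 G ℓ →
        ∀ x y z → Adj G x y → Adj G y z →
        Vec.lookup ℓ x ≡ B → Vec.lookup ℓ y ≡ B → Vec.lookup ℓ z ≡ A →
        Labelled𝓞 (attach G z (path 3) 0F) (ℓ ++ A ∷ B ∷ B ∷ [])
  op₂ : {G : Graph n} {ℓ : Vec Status′ n} → Labelled𝓞 G ℓ →
        ∀ x y → Adj G x y →
        Vec.lookup ℓ x ≡ B → Vec.lookup ℓ y ≡ B →
        Labelled𝓞 (attach G x (path 4) 3F) (ℓ ++ B ∷ B ∷ A ∷ A ∷ [])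

In𝓣 : Graph n → Set
In𝓣 G = ∃[ m ] ∃[ H ] ∃[ ℓ ] Labelled𝓣 {m} H ℓ × G ≅ H

In𝓞 : Graph n → Set
In𝓞 G = ∃[ m ] ∃[ H ] ∃[ ℓ ] Labelled𝓞 {m} H ℓ × G ≅ H

EdgeSet : Graph n → Set
EdgeSet G = Edge G → Bool

record IsLinkingSet (G : Graph n) (F : EdgeSet G) : Set where
  field
    pendant⊆F : ∀ e → Pendant G e → T (F e)
    distance3 : ∀ e → T (F e) → IsEdgeSetDist G e ((T ∘ F) ∖ ｛ e ｝) 3
    -- Repetitions must be excluded: otherwise e,f,e,f would be a second
    -- sequence whenever e,f is one.
    sequence  : ∀ e f → T (F e) → T (F f) → e ≢ f →
      ∃! _≡_ λ es → IsWalk (λ e₁ e₂ → IsEdgeDist G e₁ e₂ 3) e f es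
                  × All (T ∘ F) es × Unique es

HasUniqueLinkingSet : Graph n → Set
HasUniqueLinkingSet G = ∃! _≗_ (IsLinkingSet G)

{-# OPTIONS --safe #-}
-- All four conditions say that G has an efficient set S: every vertex has exactly one neighbour in S, and every
-- vertex outside S has a neighbour outside S. In the labelled trees S consists of the vertices of status B or C
-- (in 𝓞, status B), and the linking set F is the perfect matching that S induces. Such an S is unique in a tree.
--
-- S is an open packing, so γₜ = |S|. Subdividing suitable three edges around a vertex of degree two outside S makes
-- room for a larger open packing, while for at most two edges S can be pushed away from them without growing.
-- Conversely, root G at a leaf and compute its greedy open packing upwards from the leaves: wherever the packing
-- fails to be efficient, one or two edges can be subdivided so that it can be enlarged.
--
-- Given S, the families grow inside G along paths hanging from a subtree closed under parents. The linking sequences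
-- are the paths of the tree obtained by contracting the cells N[b] ∪ N[c] of the edges bc of F.
module Submission where

-- The value of `γₜ` is never computed: open packings bound it from below and total dominating sets
-- from above. An increase is certified by a dominating set before and a larger packing after the
-- subdivision, a non-increase by a packing before and a dominating set of no larger size after it.
--
-- The gap between two and three edges is one of nesting. Pushing `S` away from the root works if no
-- subdivided edge lies below another. For two edges a suitable root is always an end of one of
-- them; for three consecutive edges of a path no root will do, and such edges are the ones
-- subdivided to obtain an increase.
--
-- In the converse direction the greedy packing is maximum because the parents of its members
-- dominate. Only the root lacks a parent, and a leaf as root confines that defect to a single edge.
-- Wherever a vertex is missed by the packing, at most one packed vertex stands in the way of a new
-- one. Cutting it off costs one edge, making room costs another, whence the bound two.

open import Defs
open import Data.Bool as Bool using (Bool; true; false; T; _∧_)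
open import Data.Bool.Properties using (T?; T-∧; T-∨; T-irrelevant; T-≡; T-not-≡)
open import Data.Bool.ListAction using (any)
open import Data.Empty using (⊥; ⊥-elim)
open import Data.Fin as Fin using (Fin; zero; suc; splitAt; join; _≟_)
open import Data.Fin.Patterns using (0F; 1F; 2F; 3F; 4F; 5F)
open import Data.Fin.Properties as Fin using (any?; all?; +↔⊎; splitAt-join; join-splitAt; injective⇒≤)
open import Data.Fin.Subset as Subset using (Subset; ∣_∣)
open import Data.Fin.Subset.Properties using (anySubset?; _∈?_; ∈⊤)
open import Data.List as List using (List; []; _∷_; length; map; filter; allFin)
open import Data.List.Membership.Propositional using (_∈_; _∉_)
open import Data.List.Membership.Propositional.Properties
  using (∈-map⁺; ∈-filter⁺; ∈-filter⁻; ∈-allFin; ∈-++⁺ˡ; ∈-++⁺ʳ; ∈-++⁻; ∈-∃++; ∈-lookup; ∈-map⁻)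
open import Data.List.Properties using (length-++; length-map)
open import Data.List.Relation.Unary.All as All using (All; []; _∷_)
open import Data.List.Relation.Unary.AllPairs as AllPairs using (AllPairs; []; _∷_)
open import Data.List.Relation.Unary.AllPairs.Properties as AllPairs using ()
open import Data.List.Relation.Unary.Any as Any using (Any; here; there)
open import Data.List.Relation.Unary.Any.Properties using (any⁺; any⁻; lookup-index)
open import Data.List.Relation.Unary.Linked using (Linked; []; [-]; _∷_)
open import Data.List.Relation.Unary.Unique.Propositional using (Unique)
open import Data.List.Relation.Unary.Unique.Propositional.Properties as Unique using (allFin⁺; filter⁺)
open import Data.Maybe using (just)
open import Data.Nat as ℕ using (ℕ; zero; suc; _+_; _∸_; _≤_; _<_; z≤n; s≤s)
open import Data.Nat.Properties as ℕ
  using (≤-refl; ≤-trans; ≤-reflexive; ≤-antisym; <⇒≤; <-irrefl; <-≤-trans; ≤-<-trans)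
open import Data.Product using (Σ; ∃; ∃!; ∃-syntax; _×_; _,_; proj₁; proj₂)
open import Data.Sum as Sum using (_⊎_; inj₁; inj₂; [_,_]; [_,_]′)
open import Data.Unit using (⊤; tt)
open import Data.Vec as Vec using (Vec; []; _∷_; lookup; tabulate) renaming (_++_ to _++ᵛ_)
open import Data.Vec.Properties using (lookup-splitAt; lookup∘tabulate; lookup⇒[]=; []=⇒lookup)
open import Function using (_∘_; id; _↔_; Inverse)
open import Function.Bundles using (_⇔_; mk⇔; module Equivalence; mk↔ₛ′)
open import Induction.WellFounded using (Acc; acc)
open import Level using (0ℓ)
open import Relation.Binary using (Rel; Symmetric; DecidableEquality; tri<; tri≈; tri>)
open import Relation.Binary.Construct.Closure.ReflexiveTransitive as Star using (Star; ε; _◅_; _◅◅_)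
open import Relation.Binary.PropositionalEquality hiding ([_])
open import Relation.Nullary using (¬_; Dec; yes; no; contradiction)
open import Relation.Nullary.Decidable
  using (does; map′; ¬?; _×-dec_; _⊎-dec_; _→-dec_; toWitness; decidable-stable; dec-true)
open import Relation.Unary using (Pred; Decidable)

-- Walks

data Path {A : Set} (R : Rel A 0ℓ) : A → A → List A → Set where
  [-] : ∀ {x} → Path R x x (x ∷ [])
  _∷_ : ∀ {x y z xs} → R x y → Path R y z xs → Path R x z (x ∷ xs)

module _ {A : Set} {R : Rel A 0ℓ} where

  path-head∈ : ∀ {x y xs} → Path R x y xs → x ∈ xs
  path-head∈ [-]     = here refl
  path-head∈ (_ ∷ _) = here refl

  path⇒walk : ∀ {x y xs} → Path R x y xs → IsWalk R x y xs
  path⇒walk [-] = record { starts = refl ; ends = refl ; linked = [-] }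
  path⇒walk (r ∷ [-]) = record { starts = refl ; ends = refl ; linked = r ∷ [-] }
  path⇒walk (r ∷ p@(_ ∷ _)) = record { starts = refl ; ends = ends ; linked = r ∷ linked }
    where open IsWalk (path⇒walk p)

  walk⇒path : ∀ {x y xs} → IsWalk R x y xs → Path R x y xs
  walk⇒path w = go (IsWalk.starts w) (IsWalk.ends w) (IsWalk.linked w)
    where
    go : ∀ {x y xs} → List.head xs ≡ just x → List.last xs ≡ just y → Linked R xs → Path R x y xs
    go refl refl [-]       = [-]
    go refl e    (r ∷ rs) = r ∷ go refl e rs

  path⇒star : ∀ {x y xs} → Path R x y xs → Star R x y
  path⇒star [-]     = ε
  path⇒star (r ∷ p) = r ◅ path⇒star p

  path-last∈ : ∀ {x y xs} → Path R x y xs → y ∈ xs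
  path-last∈ [-]     = here refl
  path-last∈ (_ ∷ p) = there (path-last∈ p)

  path-All : ∀ {P : Pred A 0ℓ} → (∀ {x y} → R x y → P y) →
             ∀ {x y xs} → P x → Path R x y xs → All P xs
  path-All f px [-]     = px ∷ []
  path-All f px (r ∷ p) = px ∷ path-All f (f r) p

  path-suffix : ∀ {x y z xs} → Path R y z xs → Unique xs → x ∈ xs →
                ∃[ ys ] Path R x z ys × Unique ys
  path-suffix [-]       u         (here refl) = _ , [-] , u
  path-suffix (r ∷ p)   u         (here refl) = _ , r ∷ p , u
  path-suffix (r ∷ p)   (_ ∷ u)   (there x∈)  = path-suffix p u x∈

  eraseLoops : DecidableEquality A → ∀ {x y} → Star R x y → ∃[ xs ] Path R x y xs × Unique xs
  eraseLoops _≟_ ε = _ , [-] , [] ∷ []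
  eraseLoops _≟_ (_◅_ {x} r rs) with eraseLoops _≟_ rs
  ... | ys , p , u with Any.any? (x ≟_) ys
  ...   | yes x∈ = path-suffix p u x∈
  ...   | no  x∉ = _ , r ∷ p , All.tabulate (λ y∈ x≡y → x∉ (subst (_∈ ys) (sym x≡y) y∈)) ∷ u

  crossing : ∀ {P : Pred A 0ℓ} → Decidable P → ∀ {x y} → Star R x y → P x → ¬ P y →
             ∃[ u ] ∃[ v ] R u v × P u × ¬ P v
  crossing P? ε px ¬py = contradiction px ¬py
  crossing P? (_◅_ {j = y} r rs) px ¬pz with P? y
  ... | yes py = crossing P? rs py ¬pz
  ... | no ¬py = _ , _ , r , px , ¬py

path-map : ∀ {A : Set} {R Q : Rel A 0ℓ} → (∀ {x y} → R x y → Q x y) →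
           ∀ {x y xs} → Path R x y xs → Path Q x y xs
path-map f [-]     = [-]
path-map f (r ∷ p) = f r ∷ path-map f p

SameEnds : {A : Set} → (x y u v : A) → Set
SameEnds x y u v = (u ≡ x × v ≡ y) ⊎ (u ≡ y × v ≡ x)

sameEnds-flip : ∀ {A : Set} {x y u v : A} → SameEnds x y u v → SameEnds x y v u
sameEnds-flip (inj₁ (p , q)) = inj₂ (q , p)
sameEnds-flip (inj₂ (p , q)) = inj₁ (q , p)

Without : {A : Set} → Rel A 0ℓ → A → A → Rel A 0ℓ
Without R x y u v = R u v × ¬ SameEnds x y u v

-- Every edge is a bridge. In this form cycles can be closed by arbitrary walks, not just simple
-- ones, and it applies to `G` and to its contraction alike. The guard `x ≢ y` excludes loops, for
-- which `ε` would be a return walk.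
Acyclic : {A : Set} → Rel A 0ℓ → Set
Acyclic R = ∀ {x y} → x ≢ y → R x y → ¬ Star (Without R x y) y x

path-avoids : ∀ {A : Set} {R : Rel A 0ℓ} {a b x z xs} → a ∉ xs → Path R x z xs → Star (Without R a b) x z
path-avoids a∉ [-] = ε
path-avoids a∉ (r ∷ p) =
  (r , λ { (inj₁ (refl , _)) → a∉ (here refl) ; (inj₂ (_ , refl)) → a∉ (there (path-head∈ p)) })
  ◅ path-avoids (a∉ ∘ there) p

-- If the paths leave `x` along different edges `xu` and `xv`, then going from `u` to `z` along one,
-- back to `v` along the other and on to `x` bypasses the edge `xu`.
unique-path : ∀ {A : Set} {R : Rel A 0ℓ} → DecidableEquality A → Symmetric R → Acyclic R →
              ∀ {x z xs ys} → Path R x z xs → Unique xs → Path R x z ys → Unique ys → xs ≡ ys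
unique-path _≟_ R-sym acyclic [-] _ [-] _ = refl
unique-path _≟_ R-sym acyclic [-] _ (_ ∷ q) (x∉ ∷ _) = contradiction refl (All.lookup x∉ (path-last∈ q))
unique-path _≟_ R-sym acyclic (_ ∷ p) (x∉ ∷ _) [-] _ = contradiction refl (All.lookup x∉ (path-last∈ p))
unique-path {R = R} _≟_ R-sym acyclic {x} (_∷_ {y = u} r p) (x∉p ∷ up) (_∷_ {y = v} s q) (x∉q ∷ uq)
  with u ≟ v
... | yes refl = cong (x ∷_) (unique-path _≟_ R-sym acyclic p up q uq)
... | no u≢v = contradiction
  (path-avoids {b = u} x∉ₚ p ◅◅
    Star.reverse without-sym (path-avoids (λ x∈ → All.lookup x∉q x∈ refl) q) ◅◅ ((R-sym s , last≢) ◅ ε))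
  (acyclic x≢u r)
  where
  x∉ₚ : x ∉ _
  x∉ₚ x∈ = All.lookup x∉p x∈ refl
  x≢u : x ≢ u
  x≢u refl = x∉ₚ (path-head∈ p)
  without-sym : ∀ {a b} → Without R x u a b → Without R x u b a
  without-sym (r , ≢) = R-sym r , ≢ ∘ sameEnds-flip
  last≢ : ¬ SameEnds x u v x
  last≢ (inj₁ (_ , x≡u)) = x≢u x≡u
  last≢ (inj₂ (v≡u , _)) = u≢v (sym v≡u)

-- Rooted trees

least : ∀ {P : Pred ℕ 0ℓ} → Decidable P → ∃ P → ∃ (IsMinimum P)
least {P} P? (k , pk) = go k 0 (λ ()) (subst P (sym (ℕ.+-identityʳ k)) pk)
  where
  go : ∀ k i → (∀ {j} → j < i → ¬ P j) → P (k + i) → ∃ (IsMinimum P)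
  go zero i below p = i , record { attained = p ; minimal = λ {j} pj → ℕ.≮⇒≥ λ j<i → below j<i pj }
  go (suc k) i below p with P? i
  ... | yes pi = i , record { attained = pi ; minimal = λ {j} pj → ℕ.≮⇒≥ λ j<i → below j<i pj }
  ... | no ¬pi = go k (suc i) below′ (subst P (sym (ℕ.+-suc k i)) p)
    where
    below′ : ∀ {j} → j < suc i → ¬ P j
    below′ j< pj with ℕ.m≤n⇒m<n∨m≡n (ℕ.≤-pred j<)
    ... | inj₁ j<i  = below j<i pj
    ... | inj₂ refl = ¬pi pj

upperBound : ∀ {n} (f : Fin n → ℕ) → ∃[ N ] ∀ i → f i ≤ N
upperBound {zero}  f = 0 , λ ()
upperBound {suc n} f with upperBound (f ∘ suc)
... | N , f≤ = f zero ℕ.⊔ N , λ where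
  zero    → ℕ.m≤m⊔n (f zero) N
  (suc i) → ≤-trans (f≤ i) (ℕ.m≤n⊔m (f zero) N)

module _ {n} (G : Graph n) where

  adj? : ∀ u v → Dec (Adj G u v)
  adj? u v = T? (adj G u v)

  Adj-sym : Symmetric (Adj G)
  Adj-sym {u} {v} = subst T (Graph.sym G u v)

  Adj-irrefl : ∀ {v} → ¬ Adj G v v
  Adj-irrefl {v} = subst T (Graph.irrefl G v)

  Adj⇒≢ : ∀ {u v} → Adj G u v → u ≢ v
  Adj⇒≢ a refl = Adj-irrefl a

  -- Walks with exactly `k` edges, in a form decidable by recursion on `k`; `IsDist` quantifies over
  -- vertex lists instead.
  Reach : ℕ → Fin n → Fin n → Set
  Reach zero    u v = u ≡ v
  Reach (suc k) u v = ∃[ w ] Adj G u w × Reach k w v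

  reach? : ∀ k u v → Dec (Reach k u v)
  reach? zero    u v = u ≟ v
  reach? (suc k) u v = any? λ w → adj? u w ×-dec reach? k w v

  path⇒reach : ∀ {k u v xs} → Path (Adj G) u v xs → length xs ≡ suc k → Reach k u v
  path⇒reach {zero}  [-]              refl = refl
  path⇒reach {zero}  (_ ∷ [-])        ()
  path⇒reach {zero}  (_ ∷ _ ∷ _)      ()
  path⇒reach {suc k} (a ∷ p)          e    = _ , a , path⇒reach p (ℕ.suc-injective e)

  reach⇒path : ∀ k {u v} → Reach k u v → ∃[ xs ] Path (Adj G) u v xs × length xs ≡ suc k
  reach⇒path zero    refl = _ , [-] , refl
  reach⇒path (suc k) (w , a , r) with reach⇒path k r
  ... | xs , p , e = _ , a ∷ p , cong suc e

  star⇒reach : ∀ {u v} → Star (Adj G) u v → ∃[ k ] Reach k u v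
  star⇒reach ε = 0 , refl
  star⇒reach (a ◅ as) with star⇒reach as
  ... | k , r = suc k , _ , a , r

module _ {n} {G : Graph n} (tree : IsTree G) where
  open IsTree tree

  linked-star : ∀ u v → Star (Adj G) u v
  linked-star u v = path⇒star (walk⇒path (proj₂ (connected u v)))

  Adj-acyclic : Acyclic (Adj G)
  Adj-acyclic {x} {y} x≢y xy s with eraseLoops _≟_ s
  ... | _ , [-] , _ = x≢y refl
  ... | _ , (_ , ≢xy) ∷ [-] , _ = ≢xy (inj₂ (refl , refl))
  ... | _ , p@(_ ∷ _ ∷ p″) , u =
    acyclic (path⇒walk (path-map proj₁ p)) u (s≤s (s≤s (length≥1 p″))) xy
    where
    length≥1 : ∀ {A : Set} {R : Rel A 0ℓ} {x y xs} → Path R x y xs → 1 ≤ length xs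
    length≥1 [-]     = s≤s z≤n
    length≥1 (_ ∷ _) = s≤s z≤n

-- The layering by distance from `r`, with two consequences of acyclicity: neighbours lie on
-- consecutive levels, and only one neighbour lies on the level above.
record Rooted {n} (G : Graph n) (r : Fin n) : Set where
  field
    depth         : Fin n → ℕ
    depth-reach   : ∀ v → Reach G (depth v) v r
    depth-minimal : ∀ {v k} → Reach G k v r → depth v ≤ k
    depth-step    : ∀ {u v} → Adj G u v → depth v ≡ suc (depth u) ⊎ depth u ≡ suc (depth v)

  -- v is a child of u
  Child : Fin n → Fin n → Set
  Child u v = Adj G u v × depth v ≡ suc (depth u)

  field
    parent-unique : ∀ {u u′ v} → Child u v → Child u′ v → u ≡ u′

  child? : ∀ u v → Dec (Child u v)
  child? u v = adj? G u v ×-dec (depth v ℕ.≟ suc (depth u))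

  depth-root : depth r ≡ 0
  depth-root = ℕ.n≤0⇒n≡0 (depth-minimal {r} {0} refl)

  ¬child-root : ∀ {u} → ¬ Child u r
  ¬child-root (_ , e) with trans (sym depth-root) e
  ... | ()

  ¬child-sym : ∀ {u v} → Child u v → ¬ Child v u
  ¬child-sym (_ , e) (_ , e′) = ℕ.1+n≰n (≤-trans (ℕ.n≤1+n _) (≤-reflexive (sym (trans e (cong suc e′)))))

  parent : ∀ v → v ≡ r ⊎ ∃[ u ] Child u v
  parent v = go (depth v) refl (depth-reach v)
    where
    go : ∀ k → depth v ≡ k → Reach G k v r → v ≡ r ⊎ ∃[ u ] Child u v
    go zero    eq v≡r = inj₁ v≡r
    go (suc k) eq (w , vw , reach) with depth-step vw
    ... | inj₂ e = inj₂ (w , Adj-sym G vw , e)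
    ... | inj₁ e = contradiction (depth-minimal reach)
      (ℕ.<⇒≱ (≤-trans (s≤s (ℕ.n≤1+n _)) (≤-reflexive (sym (trans e (cong suc eq))))))

  neighbour : ∀ {u v} → Adj G u v → Child u v ⊎ Child v u
  neighbour uv = Sum.map (uv ,_) (Adj-sym G uv ,_) (depth-step uv)

  -- Depths are bounded because there are finitely many vertices. This is the induction from the
  -- leaves towards the root.
  child-wf : ∀ v → Acc (λ x y → Child y x) v
  child-wf v = go (proj₁ bound ∸ depth v) v ≤-refl
    where
    bound = upperBound depth
    go : ∀ k v → proj₁ bound ∸ depth v ≤ k → Acc (λ x y → Child y x) v
    go zero v le = acc λ {c} (_ , e) → contradiction (proj₂ bound c)
      (ℕ.<⇒≱ (≤-trans (s≤s (ℕ.m∸n≡0⇒m≤n (ℕ.n≤0⇒n≡0 le))) (≤-reflexive (sym e))))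
    go (suc k) v le = acc λ {c} (_ , e) → go k c
      (≤-trans (≤-reflexive (trans (cong (proj₁ bound ∸_) e) (sym (ℕ.pred[m∸n]≡m∸[1+n] _ (depth v)))))
        (ℕ.pred-mono-≤ le))

  parent-wf : ∀ v → Acc Child v
  parent-wf v = go (depth v) v ≤-refl
    where
    go : ∀ k v → depth v ≤ k → Acc Child v
    go zero    v le = acc λ (_ , e) → contradiction (trans (sym e) (ℕ.n≤0⇒n≡0 le)) λ ()
    go (suc k) v le = acc λ {u} (_ , e) → go k u (ℕ.≤-pred (≤-trans (≤-reflexive (sym e)) le))

  -- Built at the lower end, so that `parent-unique` inverts the last step.
  data Below (a : Fin n) : Fin n → Set where
    self : Below a a
    step : ∀ {u v} → Child u v → Below a u → Below a v

  below? : ∀ a v → Dec (Below a v)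
  below? a v = go v (parent-wf v)
    where
    go : ∀ v → Acc Child v → Dec (Below a v)
    go v (acc rs) with a ≟ v | parent v
    ... | yes refl | _ = yes self
    ... | no a≢v | inj₁ refl = no λ { self → a≢v refl ; (step c _) → ¬child-root c }
    ... | no a≢v | inj₂ (u , uv) with go u (rs uv)
    ...   | yes b = yes (step uv b)
    ...   | no ¬b = no λ { self → a≢v refl ; (step c b) → ¬b (subst (Below a) (parent-unique c uv) b) }

  below-depth : ∀ {a v} → Below a v → depth a ≤ depth v
  below-depth self = ≤-refl
  below-depth (step (_ , e) b) = ≤-trans (below-depth b) (≤-trans (ℕ.n≤1+n _) (≤-reflexive (sym e)))

  ¬below-parent : ∀ {u v} → Child u v → ¬ Below v u
  ¬below-parent (_ , e) b = ℕ.1+n≰n (≤-trans (≤-reflexive (sym e)) (below-depth b))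

  below-parent : ∀ {a u v} → Child u v → Below a v → a ≡ v ⊎ Below a u
  below-parent uv self        = inj₁ refl
  below-parent uv (step c b) = inj₂ (subst (Below _) (parent-unique c uv) b)

  below-reach : ∀ {a v} → Below a v → ∃[ k ] Reach G k v a × depth v ≡ k + depth a
  below-reach self = 0 , refl , refl
  below-reach (step (uv , e) b) with below-reach b
  ... | k , reach , e′ = suc k , (_ , Adj-sym G uv , reach) , trans e (cong suc e′)

  Childless : Pred (Fin n) 0ℓ
  Childless v = ∀ c → ¬ Child v c

  childless⊎child : ∀ v → Childless v ⊎ ∃ (Child v)
  childless⊎child v with any? (child? v)
  ... | yes c = inj₂ c
  ... | no ¬c = inj₁ λ c vc → ¬c (c , vc)

  below-trans-child : ∀ {a c w} → Child a c → Below c w → Below a w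
  below-trans-child ac self       = step ac self
  below-trans-child ac (step c b) = step c (below-trans-child ac b)

  childless-below : ∀ a → ∃[ w ] Below a w × Childless w
  childless-below a = go a (child-wf a)
    where
    go : ∀ a → Acc _ a → ∃[ w ] Below a w × Childless w
    go a (acc rs) with childless⊎child a
    ... | inj₁ none = a , self , none
    ... | inj₂ (c , ac) with go c (rs ac)
    ...   | w , b , none = w , below-trans-child ac b , none

module _ {n} {G : Graph n} (tree : IsTree G) where

  abstract
    distance : ∀ u v → ∃ (IsMinimum λ k → Reach G k u v)
    distance u v = least (λ k → reach? G k u v) (star⇒reach G (linked-star tree u v))

  module _ (r : Fin n) (depth : Fin n → ℕ) (reach : ∀ v → Reach G (depth v) v r)
           (minimal : ∀ {v k} → Reach G k v r → depth v ≤ k) where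

    Away : Fin n → Rel (Fin n) 0ℓ
    Away v x y = Adj G x y × x ≢ v × y ≢ v

    -- The depth drops at every step of a shortest walk to the root, so a walk that starts at
    -- another vertex no deeper than `v` never meets `v`.
    ascend : ∀ k {v u} → Reach G k u r → depth u ≡ k → depth u ≤ depth v → u ≢ v → Star (Away v) u r
    ascend zero    refl         _  _  _ = ε
    ascend (suc k) {v} {u} (w , uw , wr) eq le u≢v =
      (uw , u≢v , λ { refl → ℕ.<⇒≱ w<u le }) ◅
      ascend k wr w≡k (≤-trans (<⇒≤ w<u) le) λ { refl → ℕ.<⇒≱ w<u le }
      where
      w≡k : depth w ≡ k
      w≡k = ≤-antisym (minimal wr)
              (ℕ.≤-pred (subst (_≤ suc (depth w)) eq (minimal {k = suc (depth w)} (w , uw , reach w))))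
      w<u : depth w < depth u
      w<u = ≤-reflexive (trans (cong suc w≡k) (sym eq))

    -- Two such neighbours would both reach the root without passing `v`, which closes a cycle
    -- through `v`.
    lower-unique : ∀ {u u′ v} → Adj G v u → Adj G v u′ → depth u ≤ depth v → depth u′ ≤ depth v → u ≡ u′
    lower-unique {u} {u′} {v} vu vu′ le le′ = decidable-stable (u ≟ u′) λ u≢u′ →
      Adj-acyclic tree (Adj⇒≢ G vu) vu
        (Star.map weaken (up vu le) ◅◅ Star.reverse (λ { (a , ≢) → Adj-sym G a , ≢ ∘ sameEnds-flip })
                                         (Star.map weaken (up vu′ le′))
          ◅◅ (Adj-sym G vu′ , λ { (inj₁ (refl , _)) → Adj-irrefl G vu′ ; (inj₂ (e , _)) → u≢u′ (sym e) }) ◅ ε)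
      where
      weaken : ∀ {x y} → Away v x y → Without (Adj G) v u x y
      weaken (a , x≢ , y≢) = a , λ { (inj₁ (e , _)) → x≢ e ; (inj₂ (_ , e)) → y≢ e }
      up : ∀ {u} → Adj G v u → depth u ≤ depth v → Star (Away v) u r
      up {u} vu le = ascend _ (reach u) refl le (Adj⇒≢ G vu ∘ sym)

    one-parent : ∀ {u u′ v} → Adj G u v × depth v ≡ suc (depth u) →
             Adj G u′ v × depth v ≡ suc (depth u′) → u ≡ u′
    one-parent (a , e) (a′ , e′) = lower-unique (Adj-sym G a) (Adj-sym G a′) (lower e) (lower e′)
      where
      lower : ∀ {m k} → k ≡ suc m → m ≤ k
      lower refl = ℕ.n≤1+n _

    -- Otherwise `u` and the next vertex on a shortest walk from `v` to the root are both neighbours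
    -- of `v` no deeper than `v`, hence equal, although their depths differ.
    no-level : ∀ k {u v} → Reach G k v r → depth v ≡ k → Adj G u v → depth u ≢ depth v
    no-level zero {u} refl eq uv eq′ with depth u | trans eq′ eq | reach u
    ... | zero | _ | refl = Adj-irrefl G uv
    no-level (suc k) {u} {v} (w , vw , wr) eq uv eq′ = ℕ.<-irrefl refl
      (subst₂ _<_ (cong depth (lower-unique vw (Adj-sym G uv) (<⇒≤ w<v) (≤-reflexive eq′))) (sym eq′) w<v)
      where
      w<v : depth w < depth v
      w<v = ≤-trans (s≤s (minimal wr)) (≤-reflexive (sym eq))

    depth-near : ∀ {u v} → Adj G u v → depth u ≤ suc (depth v)
    depth-near {v = v} uv = minimal {k = suc (depth v)} (v , uv , reach v)

    depth-levels : ∀ {u v} → Adj G u v → depth v ≡ suc (depth u) ⊎ depth u ≡ suc (depth v)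
    depth-levels {u} {v} uv with ℕ.<-cmp (depth u) (depth v)
    ... | tri< lt _ _ = inj₁ (≤-antisym (depth-near (Adj-sym G uv)) lt)
    ... | tri≈ _ e _ = contradiction e (no-level _ (reach v) refl uv)
    ... | tri> _ _ gt = inj₂ (≤-antisym (depth-near uv) gt)

  rooted : ∀ r → Rooted G r
  rooted r = record
    { depth         = λ v → proj₁ (distance v r)
    ; depth-reach   = reach
    ; depth-minimal = minimal
    ; depth-step    = depth-levels r _ reach minimal
    ; parent-unique = one-parent r _ reach minimal
    }
    where
    reach : ∀ v → Reach G (proj₁ (distance v r)) v r
    reach v = IsMinimum.attained (proj₂ (distance v r))
    minimal : ∀ {v k} → Reach G k v r → proj₁ (distance v r) ≤ k
    minimal {v} = IsMinimum.minimal (proj₂ (distance v r))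

-- Efficient sets

-- The sets B ∪ C of the family 𝓣: every vertex has exactly one neighbour in S, and vertices outside S
-- (status A) also have a neighbour outside S; in a tree the latter says that all leaves are in S.
record Efficient {V : Set} (_~_ : V → V → Bool) (S : V → Bool) : Set where
  field
    mate        : V → V
    mate-adj    : ∀ v → T (v ~ mate v)
    mate∈       : ∀ v → T (S (mate v))
    mate-unique : ∀ {v u} → T (v ~ u) → T (S u) → u ≡ mate v
    outside     : ∀ {v} → ¬ T (S v) → ∃[ u ] T (v ~ u) × ¬ T (S u)

T⇔⇒≡ : ∀ {a b} → (T a → T b) → (T b → T a) → a ≡ b
T⇔⇒≡ {false} {false} f g = refl
T⇔⇒≡ {false} {true}  f g = ⊥-elim (g tt)
T⇔⇒≡ {true}  {false} f g = ⊥-elim (f tt)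
T⇔⇒≡ {true}  {true}  f g = refl

module _ {n} (G : Graph n) {S : Fin n → Bool} (eff : Efficient (adj G) S) where
  open Efficient eff

  mate-mate : ∀ {v} → T (S v) → mate (mate v) ≡ v
  mate-mate Sv = sym (mate-unique (Adj-sym G (mate-adj _)) Sv)

  mate-shared : ∀ {v x y} → Adj G v x → Adj G v y → T (S x) → T (S y) → x ≡ y
  mate-shared vx vy Sx Sy = trans (mate-unique vx Sx) (sym (mate-unique vy Sy))

  two-neighbours : ∀ {v} → ¬ T (S v) → ∃[ x ] ∃[ y ] Adj G v x × Adj G v y × x ≢ y
  two-neighbours {v} ¬Sv with outside ¬Sv
  ... | u , vu , ¬Su = mate v , u , mate-adj v , vu , λ { refl → ¬Su (mate∈ v) }

  module _ {r : Fin n} (R : Rooted G r) where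
    open Rooted R

    outside-child : ∀ {v} → ¬ T (S v) → ∃ (Child v)
    outside-child {v} ¬Sv with two-neighbours ¬Sv
    ... | x , y , vx , vy , x≢y with neighbour vx | neighbour vy
    ...   | inj₁ c | _      = x , c
    ...   | inj₂ _ | inj₁ c = y , c
    ...   | inj₂ c | inj₂ d = contradiction (parent-unique c d) x≢y

-- Suppose `v` is in `S` but not in `S′`. Then `v` has a child `c`, and the mate of `c` in `S′` is
-- not `v`, so it is a child of `c`. By assumption that grandchild is in `S` too, and `c` has two
-- neighbours in `S`.
efficient-⊆ : ∀ {n} {G : Graph n} {S S′ : Fin n → Bool} {r} (R : Rooted G r) → let open Rooted R in
  Efficient (adj G) S → Efficient (adj G) S′ → ∀ v →
  (∀ {c x} → Child v c → Child c x → S x ≡ S′ x) → T (S v) → T (S′ v)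
efficient-⊆ {G = G} {S} {S′} R eff eff′ v same Sv = decidable-stable (T? (S′ v)) λ ¬S′v → impossible ¬S′v
  where
  open Rooted R
  module E = Efficient eff
  module E′ = Efficient eff′
  impossible : ¬ ¬ T (S′ v)
  impossible ¬S′v with outside-child G eff′ R ¬S′v
  ... | c , vc with neighbour (E′.mate-adj c)
  ...   | inj₂ d = ¬S′v (subst (T ∘ S′) (parent-unique d vc) (E′.mate∈ c))
  ...   | inj₁ d = ¬child-sym vc (subst (Child c)
          (mate-shared G eff (E′.mate-adj c) (Adj-sym G (proj₁ vc)) (subst T (sym (same vc d)) (E′.mate∈ c)) Sv) d)

efficient-unique : ∀ {n} {G : Graph n} → IsTree G → ∀ {S S′} →
  Efficient (adj G) S → Efficient (adj G) S′ → S ≗ S′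
efficient-unique {G = G} tree {S} {S′} eff eff′ v₀ = go v₀ (child-wf v₀)
  where
  R = rooted tree v₀
  open Rooted R
  go : ∀ v → Acc (λ x y → Child y x) v → S v ≡ S′ v
  go v (acc rs) = T⇔⇒≡ (efficient-⊆ R eff eff′ v same) (efficient-⊆ R eff′ eff v λ vc cx → sym (same vc cx))
    where
    same : ∀ {c x} → Child v c → Child c x → S x ≡ S′ x
    same {x = x} vc cx with rs vc
    ... | acc rs′ = go x (rs′ cx)

-- Serves isomorphisms of graphs as well as the splitting of `Fin (n + m)`, since `attach` is
-- described on a sum of vertex sets.
efficient-transport : ∀ {V W : Set} {_~_ : V → V → Bool} {_≈_ : W → W → Bool} {S : V → Bool} {S′ : W → Bool}
  (f : V ↔ W) → (∀ u v → (u ~ v) ≡ (Inverse.to f u ≈ Inverse.to f v)) →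
  (∀ v → S v ≡ S′ (Inverse.to f v)) → Efficient _≈_ S′ → Efficient _~_ S
efficient-transport {V} {W} {_~_} {_≈_} {S} {S′} f pres S≡ eff = record
  { mate        = λ v → from (mate (to v))
  ; mate-adj    = λ v → adj← (mate-adj (to v))
  ; mate∈       = λ v → S← (mate∈ (to v))
  ; mate-unique = λ {v} {u} vu Su → trans (sym (strictlyInverseʳ u))
      (cong from (mate-unique (subst T (pres v u) vu) (subst T (S≡ u) Su)))
  ; outside     = λ {v} ¬Sv → let u , a , ¬Su = outside (¬Sv ∘ subst T (sym (S≡ v))) in
      from u , adj← a , λ s → ¬Su (subst (T ∘ S′) (strictlyInverseˡ u) (subst T (S≡ (from u)) s))
  }
  where
  open Efficient eff
  open Inverse f using (to; from; strictlyInverseˡ; strictlyInverseʳ)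
  adj← : ∀ {v w} → T (to v ≈ w) → T (v ~ from w)
  adj← {v} {w} a = subst T (sym (trans (pres v (from w)) (cong (to v ≈_) (strictlyInverseˡ w)))) a
  S← : ∀ {w} → T (S′ w) → T (S (from w))
  S← {w} s = subst T (sym (trans (S≡ (from w)) (cong S′ (strictlyInverseˡ w)))) s

-- Total domination and open packings

module _ {A : Set} where

  unique-⊆⇒length≤ : ∀ {xs ys : List A} → Unique xs → (∀ {x} → x ∈ xs → x ∈ ys) → length xs ≤ length ys
  unique-⊆⇒length≤ [] _ = z≤n
  unique-⊆⇒length≤ {x ∷ xs} {ys} (x∉ ∷ u) sub with ∈-∃++ (sub (here refl))
  ... | as , bs , refl = ≤-trans (s≤s (unique-⊆⇒length≤ u sub′)) (≤-reflexive len)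
    where
    sub′ : ∀ {y} → y ∈ xs → y ∈ as List.++ bs
    sub′ y∈ with ∈-++⁻ as (sub (there y∈))
    ... | inj₁ y∈as         = ∈-++⁺ˡ y∈as
    ... | inj₂ (here refl)  = contradiction refl (All.lookup x∉ y∈)
    ... | inj₂ (there y∈bs) = ∈-++⁺ʳ as y∈bs
    len : suc (length (as List.++ bs)) ≡ length (as List.++ x ∷ bs)
    len = trans (cong suc (length-++ as)) (trans (sym (ℕ.+-suc (length as) (length bs))) (sym (length-++ as)))

elements : ∀ {n} → Subset n → List (Fin n)
elements []          = []
elements (true ∷ p)  = zero ∷ map suc (elements p)
elements (false ∷ p) = map suc (elements p)

length-elements : ∀ {n} (p : Subset n) → length (elements p) ≡ ∣ p ∣
length-elements []          = refl
length-elements (true ∷ p)  = cong suc (trans (length-map suc (elements p)) (length-elements p))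
length-elements (false ∷ p) = trans (length-map suc (elements p)) (length-elements p)

elements⁺ : ∀ {n x} {p : Subset n} → x Subset.∈ p → x ∈ elements p
elements⁺ {p = true ∷ p}  Vec.here       = here refl
elements⁺ {p = true ∷ p}  (Vec.there x∈) = there (∈-map⁺ suc (elements⁺ x∈))
elements⁺ {p = false ∷ p} (Vec.there x∈) = ∈-map⁺ suc (elements⁺ x∈)

elements⁻ : ∀ {n x} {p : Subset n} → x ∈ elements p → x Subset.∈ p
elements⁻ {p = true ∷ p}  (here refl) = Vec.here
elements⁻ {p = true ∷ p}  (there x∈) with ∈-map⁻ suc x∈
... | _ , y∈ , refl = Vec.there (elements⁻ y∈)
elements⁻ {p = false ∷ p} x∈ with ∈-map⁻ suc x∈
... | _ , y∈ , refl = Vec.there (elements⁻ y∈)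

elements-unique : ∀ {n} (p : Subset n) → Unique (elements p)
elements-unique [] = []
elements-unique (true ∷ p) =
  All.tabulate (λ y∈ → λ { refl → 0∉ y∈ }) ∷ Unique.map⁺ Fin.suc-injective (elements-unique p)
  where
  0∉ : zero ∉ map suc (elements p)
  0∉ y∈ with ∈-map⁻ suc y∈
  ... | _ , _ , ()
elements-unique (false ∷ p) = Unique.map⁺ Fin.suc-injective (elements-unique p)

-- Lists in place of subsets, over any vertex type. Repetitions do no harm: only an upper bound on
-- the size of a dominating set is wanted.
Dominates : ∀ {V : Set} → Rel V 0ℓ → List V → Set
Dominates _~_ ts = ∀ v → ∃[ u ] u ∈ ts × v ~ u

-- Disjoint open neighbourhoods, so that `Packing` is an open packing, the notion dual to total
-- domination.
Apart : ∀ {V : Set} → Rel V 0ℓ → Rel V 0ℓ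
Apart _~_ x y = ∀ w → x ~ w → y ~ w → ⊥

Packing : ∀ {V : Set} → Rel V 0ℓ → List V → Set
Packing _~_ = AllPairs (Apart _~_)

module _ {n} (G : Graph n) where
  open IsMinimum

  γₜ-≤ : ∀ {k ts} → Isγₜ G k → Dominates (Adj G) ts → k ≤ length ts
  γₜ-≤ {k} {ts} γ dom = ≤-trans
    (minimal γ (S , (λ v → let u , u∈ , vu = dom v in u , ∈S u∈ , vu) , refl))
    (≤-trans (≤-reflexive (sym (length-elements S)))
      (unique-⊆⇒length≤ (elements-unique S) (S⊆ ∘ elements⁻)))
    where
    ∈ts? : Decidable (_∈ ts)
    ∈ts? u = Any.any? (u ≟_) ts
    S : Subset n
    S = tabulate (does ∘ ∈ts?)
    lookup-S : ∀ u → lookup S u ≡ does (∈ts? u)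
    lookup-S = lookup∘tabulate (does ∘ ∈ts?)
    ∈S : ∀ {u} → u ∈ ts → u Subset.∈ S
    ∈S {u} u∈ = lookup⇒[]= u S (trans (lookup-S u) (dec-true (∈ts? u) u∈))
    S⊆ : ∀ {u} → u Subset.∈ S → u ∈ ts
    S⊆ {u} u∈ with ∈ts? u | trans (sym (lookup-S u)) ([]=⇒lookup u∈)
    ... | yes p | _ = p

  -- A vertex dominating two members of the packing would be a common neighbour, so distinct members
  -- have distinct dominators.
  packing-≤-dominating : ∀ {ps ts} → Packing (Adj G) ps → Dominates (Adj G) ts → length ps ≤ length ts
  packing-≤-dominating {ps} {ts} pack dom = ≤-trans
    (≤-reflexive (sym (length-map dominator ps)))
    (unique-⊆⇒length≤ (AllPairs.map⁺ (AllPairs.map distinct pack)) dominators⊆)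
    where
    dominator : Fin n → Fin n
    dominator v = proj₁ (dom v)
    distinct : ∀ {x y} → Apart (Adj G) x y → dominator x ≢ dominator y
    distinct {x} {y} apart eq =
      apart (dominator x) (proj₂ (proj₂ (dom x))) (subst (Adj G y) (sym eq) (proj₂ (proj₂ (dom y))))
    dominators⊆ : ∀ {u} → u ∈ map dominator ps → u ∈ ts
    dominators⊆ u∈ with ∈-map⁻ dominator u∈
    ... | v , _ , refl = proj₁ (proj₂ (dom v))

  ≤-γₜ : ∀ {k ps} → Isγₜ G k → Packing (Adj G) ps → length ps ≤ k
  ≤-γₜ γ pack with attained γ
  ... | S , total , refl = ≤-trans
    (packing-≤-dominating pack λ v → let u , u∈ , vu = total v in u , elements⁺ u∈ , vu)
    (≤-reflexive (length-elements S))

  γₜ-exists : (∀ v → ∃ (Adj G v)) → ∃ (Isγₜ G)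
  γₜ-exists nbr = least
    (λ k → anySubset? λ S → all? (λ v → any? λ u → (u ∈? S) ×-dec adj? G v u) ×-dec (∣ S ∣ ℕ.≟ k))
    (∣ Subset.⊤ {n} ∣ , Subset.⊤ , (λ v → let u , vu = nbr v in u , ∈⊤ , vu) , refl)

-- Edges and subdivision

==⇒≡ : ∀ {n} {u v : Fin n} → T (u == v) → u ≡ v
==⇒≡ {u = u} {v} t with u ≟ v
... | yes e = e

≡⇒== : ∀ {n} {u v : Fin n} → u ≡ v → T (u == v)
≡⇒== {u = u} {v} e = subst T (sym (dec-true (u ≟ v) e)) tt

module _ {n} {G : Graph n} where

  edge-≡ : {e f : Edge G} → src e ≡ src f → tgt e ≡ tgt f → e ≡ f
  edge-≡ {record { ordered = o ; adjacent = a }} {record { ordered = o′ ; adjacent = a′ }} refl refl =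
    cong₂ (λ o a → record { ordered = o ; adjacent = a }) (ℕ.<-irrelevant o o′) (T-irrelevant a a′)

  _≟ᵉ_ : DecidableEquality (Edge G)
  e ≟ᵉ f = map′ (λ (p , q) → edge-≡ p q) (λ { refl → refl , refl }) ((src e ≟ src f) ×-dec (tgt e ≟ tgt f))

  Joins : Fin n → Fin n → Pred (Edge G) 0ℓ
  Joins u v e = SameEnds u v (src e) (tgt e)

  joins-flip : ∀ {u v} e → Joins u v e → Joins v u e
  joins-flip e (inj₁ p) = inj₂ p
  joins-flip e (inj₂ p) = inj₁ p

  endOf-joined : ∀ {u v w} e → Joins u v e → EndOf e w → w ≡ u ⊎ w ≡ v
  endOf-joined e (inj₁ (p , q)) (inj₁ w≡) = inj₁ (trans w≡ p)
  endOf-joined e (inj₁ (p , q)) (inj₂ w≡) = inj₂ (trans w≡ q)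
  endOf-joined e (inj₂ (p , q)) (inj₁ w≡) = inj₂ (trans w≡ p)
  endOf-joined e (inj₂ (p , q)) (inj₂ w≡) = inj₁ (trans w≡ q)

  joined-endˡ : ∀ {u v} e → Joins u v e → EndOf e u
  joined-endˡ e (inj₁ (p , q)) = inj₁ (sym p)
  joined-endˡ e (inj₂ (p , q)) = inj₂ (sym q)

  joined-endʳ : ∀ {u v} e → Joins u v e → EndOf e v
  joined-endʳ e = joined-endˡ e ∘ joins-flip e

  joined-adj : ∀ {u v} e → Joins u v e → Adj G u v
  joined-adj e (inj₁ (refl , refl)) = Edge.adjacent e
  joined-adj e (inj₂ (refl , refl)) = Adj-sym G (Edge.adjacent e)

  ends-joined : ∀ {u v} e → EndOf e u → EndOf e v → u ≢ v → Joins u v e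
  ends-joined e (inj₁ p) (inj₁ q) u≢v = contradiction (trans p (sym q)) u≢v
  ends-joined e (inj₁ p) (inj₂ q) u≢v = inj₁ (sym p , sym q)
  ends-joined e (inj₂ p) (inj₁ q) u≢v = inj₂ (sym q , sym p)
  ends-joined e (inj₂ p) (inj₂ q) u≢v = contradiction (trans p (sym q)) u≢v

  joins-unique : ∀ {u v} e f → Joins u v e → Joins u v f → e ≡ f
  joins-unique e f je jf = go je jf
    where
    swapped : ∀ {u v} → src e ≡ u × tgt e ≡ v → src f ≡ v × tgt f ≡ u → e ≡ f
    swapped (refl , refl) (refl , refl) = contradiction (Edge.ordered f) (ℕ.<-asym (Edge.ordered e))
    go : ∀ {u v} → Joins u v e → Joins u v f → e ≡ f
    go (inj₁ (refl , refl)) (inj₁ (p , q)) = edge-≡ (sym p) (sym q)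
    go (inj₂ (refl , refl)) (inj₂ (p , q)) = edge-≡ (sym p) (sym q)
    go (inj₁ p) (inj₂ q) = swapped p q
    go (inj₂ p) (inj₁ q) = swapped p q

module _ {n} (G : Graph n) where

  edge : ∀ {u v} → Adj G u v → Edge G
  edge {u} {v} uv with Fin.<-cmp u v
  ... | tri< lt _ _ = record { ordered = lt ; adjacent = uv }
  ... | tri≈ _ e _  = contradiction e (Adj⇒≢ G uv)
  ... | tri> _ _ gt = record { ordered = gt ; adjacent = Adj-sym G uv }

  edge-joins : ∀ {u v} (uv : Adj G u v) → Joins u v (edge uv)
  edge-joins {u} {v} uv with Fin.<-cmp u v
  ... | tri< lt _ _ = inj₁ (refl , refl)
  ... | tri≈ _ e _  = contradiction e (Adj⇒≢ G uv)
  ... | tri> _ _ gt = inj₂ (refl , refl)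

  edge-ends : ∀ {u v w} (uv : Adj G u v) → EndOf (edge uv) w → w ≡ u ⊎ w ≡ v
  edge-ends uv = endOf-joined (edge uv) (edge-joins uv)

  edge-endˡ : ∀ {u v} (uv : Adj G u v) → EndOf (edge uv) u
  edge-endˡ uv = joined-endˡ (edge uv) (edge-joins uv)

  edge-endʳ : ∀ {u v} (uv : Adj G u v) → EndOf (edge uv) v
  edge-endʳ uv = joined-endʳ (edge uv) (edge-joins uv)

  edge≢ : ∀ {x y w} e (xy : Adj G x y) → EndOf e w → w ≢ x → w ≢ y → e ≢ edge xy
  edge≢ e xy w∈ w≢x w≢y eq with edge-ends xy (subst (λ e → EndOf e _) eq w∈)
  ... | inj₁ w≡x = w≢x w≡x
  ... | inj₂ w≡y = w≢y w≡y

module _ {n} (G : Graph n) (D : List (Edge G)) where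

  Subdivided : Set
  Subdivided = Fin n ⊎ Fin (length D)

  Sub : Rel Subdivided 0ℓ
  Sub a b = T (subdivideAdj G D a b)

module _ {n} (G : Graph n) (D : List (Edge G)) where

  private
    joins⇒ : ∀ {u v} e → T (joins G D u v e) → Joins u v e
    joins⇒ e t = Sum.map both both (Equivalence.to T-∨ t)
      where
      both : ∀ {a b c d : Fin n} → T ((a == b) ∧ (c == d)) → a ≡ b × c ≡ d
      both t with Equivalence.to T-∧ t
      ... | p , q = ==⇒≡ p , ==⇒≡ q

    ⇒joins : ∀ {u v} e → Joins u v e → T (joins G D u v e)
    ⇒joins e = Equivalence.from T-∨ ∘ Sum.map both both
      where
      both : ∀ {a b c d : Fin n} → a ≡ b × c ≡ d → T ((a == b) ∧ (c == d))
      both (p , q) = Equivalence.from T-∧ (≡⇒== p , ≡⇒== q)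

  Sub-symmetric : ∀ a b → Sub G D a b → Sub G D b a
  Sub-symmetric a b = subst T (subdivideAdj-sym G D a b)

  old-old⁻ : ∀ u v → Sub G D (inj₁ u) (inj₁ v) → Adj G u v × (∀ i → ¬ Joins u v (List.lookup D i))
  old-old⁻ u v t with Equivalence.to T-∧ t
  ... | uv , unjoined = uv , λ i j → subst T (Equivalence.to T-not-≡ unjoined)
    (any⁺ (joins G D u v) (Any.map (λ { refl → ⇒joins (List.lookup D i) j }) (∈-lookup {xs = D} i)))

  old-old⁺ : ∀ {u v} → Adj G u v → (∀ i → ¬ Joins u v (List.lookup D i)) → Sub G D (inj₁ u) (inj₁ v)
  old-old⁺ {u} {v} uv unjoined = Equivalence.from T-∧ (uv , Equivalence.from T-not-≡ (¬T⇒≡false none))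
    where
    ¬T⇒≡false : ∀ {b} → ¬ T b → b ≡ false
    ¬T⇒≡false {false} _ = refl
    ¬T⇒≡false {true}  f = ⊥-elim (f tt)
    none : ¬ T (any (joins G D u v) D)
    none t with any⁻ (joins G D u v) D t
    ... | e∈ = unjoined (Any.index e∈) (joins⇒ (List.lookup D (Any.index e∈)) (lookup-index e∈))

  old-new⁻ : ∀ u i → Sub G D (inj₁ u) (inj₂ i) → EndOf (List.lookup D i) u
  old-new⁻ u i t = Sum.map (sym ∘ ==⇒≡) (sym ∘ ==⇒≡) (Equivalence.to T-∨ t)

  old-new⁺ : ∀ {u} i → EndOf (List.lookup D i) u → Sub G D (inj₁ u) (inj₂ i)
  old-new⁺ i e = Equivalence.from T-∨ (Sum.map (≡⇒== ∘ sym) (≡⇒== ∘ sym) e)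

module _ {n} (G : Graph n) (D : List (Edge G)) (nbr : ∀ v → ∃ (Adj G v)) where
  private
    l = length D

    joined : Subdivided G D → Fin (n + l)
    joined = join n l

    split-joined : ∀ a → splitAt n (joined a) ≡ a
    split-joined = splitAt-join n l

  joined? : ∀ u v → Dec (∃[ i ] Joins u v (List.lookup D i))
  joined? u v = any? λ i → let e = List.lookup D i in
    ((src e ≟ u) ×-dec (tgt e ≟ v)) ⊎-dec ((src e ≟ v) ×-dec (tgt e ≟ u))

  Sub-neighbour : ∀ a → ∃ (Sub G D a)
  Sub-neighbour (inj₂ i) = inj₁ (src (List.lookup D i)) ,
    Sub-symmetric G D (inj₁ _) (inj₂ i) (old-new⁺ G D i (inj₁ refl))
  Sub-neighbour (inj₁ u) with nbr u
  ... | v , uv with joined? u v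
  ...   | yes (i , j) = inj₂ i , old-new⁺ G D i (joined-endˡ (List.lookup D i) j)
  ...   | no ¬j = inj₁ v , old-old⁺ G D uv λ i j → ¬j (i , j)

  private
    neighbour′ : ∀ i → ∃ (Adj (subdivide G D) i)
    neighbour′ i with Sub-neighbour (splitAt n i)
    ... | b , ab = joined b , subst (λ c → T (subdivideAdj G D (splitAt n i) c)) (sym (split-joined b)) ab

  -- Weak duality on both sides: `γₜ` of `G` is at most `length ts`, and after subdivision it is at
  -- least `length ps`.
  increases : ∀ {ts ps} → Dominates (Adj G) ts → Packing (Sub G D) ps → length ts < length ps → Increasesγₜ G D
  increases {ts} {ps} dom pack lt with γₜ-exists G nbr | γₜ-exists (subdivide G D) neighbour′
  ... | a , γ | b , γ′ = a , b , γ , γ′ , ≤-<-trans (γₜ-≤ G γ dom)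
    (<-≤-trans lt (≤-trans (≤-reflexive (sym (length-map joined ps)))
      (≤-γₜ (subdivide G D) γ′ (AllPairs.map⁺ (AllPairs.map (λ {x} {y} → apart {x} {y}) pack)))))
    where
    apart : ∀ {x y} → Apart (Sub G D) x y → Apart (Adj (subdivide G D)) (joined x) (joined y)
    apart {x} {y} ap w xw yw = ap (splitAt n w)
      (subst (λ c → T (subdivideAdj G D c (splitAt n w))) (split-joined x) xw)
      (subst (λ c → T (subdivideAdj G D c (splitAt n w))) (split-joined y) yw)

  -- The same duality with the roles exchanged: the packing lives in `G`, the dominating set in the
  -- subdivided graph.
  ¬increases : ∀ {ps ts} → Packing (Adj G) ps → Dominates (Sub G D) ts → length ts ≤ length ps → ¬ Increasesγₜ G D
  ¬increases {ps} {ts} pack dom le (a , b , γ , γ′ , a<b) = ℕ.<⇒≱ a<b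
    (≤-trans (γₜ-≤ (subdivide G D) γ′ dom′) (≤-trans (≤-reflexive (length-map joined ts)) (≤-trans le (≤-γₜ G γ pack))))
    where
    dom′ : Dominates (Adj (subdivide G D)) (map joined ts)
    dom′ v with dom (splitAt n v)
    ... | u , u∈ , vu = joined u , ∈-map⁺ joined u∈ ,
      subst (λ c → T (subdivideAdj G D (splitAt n v) c)) (sym (split-joined u)) vu

-- Efficient sets force class 3

unique⇒allPairs : ∀ {A : Set} {R : Rel A 0ℓ} {xs} → Unique xs →
                  (∀ {x y} → x ∈ xs → y ∈ xs → x ≢ y → R x y) → AllPairs R xs
unique⇒allPairs []       f = []
unique⇒allPairs (x∉ ∷ u) f =
  All.tabulate (λ y∈ → f (here refl) (there y∈) (All.lookup x∉ y∈)) ∷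
  unique⇒allPairs u λ x∈ y∈ → f (there x∈) (there y∈)

third-element : ∀ {n} → 3 ≤ n → (x y : Fin n) → ∃[ z ] z ≢ x × z ≢ y
third-element {suc (suc (suc n))} (s≤s (s≤s (s≤s _))) x y
  with any? (λ z → ¬? (z ≟ x) ×-dec ¬? (z ≟ y))
... | yes z = z
... | no none = ⊥-elim (pigeons (λ ()) (λ ()) (λ ()) (in? 0F) (in? 1F) (in? 2F))
  where
  in? : ∀ z → z ≡ x ⊎ z ≡ y
  in? z with z ≟ x | z ≟ y
  ... | yes e | _     = inj₁ e
  ... | no _  | yes e = inj₂ e
  ... | no p  | no q  = contradiction (z , p , q) none
  pigeons : ∀ {a b c} → a ≢ b → a ≢ c → b ≢ c → a ≡ x ⊎ a ≡ y → b ≡ x ⊎ b ≡ y → c ≡ x ⊎ c ≡ y → ⊥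
  pigeons a≢b a≢c b≢c (inj₁ p) (inj₁ q) _        = a≢b (trans p (sym q))
  pigeons a≢b a≢c b≢c (inj₂ p) (inj₂ q) _        = a≢b (trans p (sym q))
  pigeons a≢b a≢c b≢c (inj₁ p) _        (inj₁ r) = a≢c (trans p (sym r))
  pigeons a≢b a≢c b≢c (inj₂ p) _        (inj₂ r) = a≢c (trans p (sym r))
  pigeons a≢b a≢c b≢c _        (inj₁ q) (inj₁ r) = b≢c (trans q (sym r))
  pigeons a≢b a≢c b≢c _        (inj₂ q) (inj₂ r) = b≢c (trans q (sym r))

module _ {n} {G : Graph n} (tree : IsTree G) {S : Fin n → Bool} (eff : Efficient (adj G) S) where
  open Efficient eff

  -- If all vertices were in `S`, the mate of a vertex would be its only neighbour, and a pair of
  -- mates would be a whole component.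
  outside-exists : 3 ≤ n → ∃[ a ] ¬ T (S a)
  outside-exists 3≤n with any? (λ a → ¬? (T? (S a)))
  ... | yes a = a
  ... | no all-in with IsTree.nonempty tree
  ...   | s≤s _ with third-element 3≤n 0F (mate 0F)
  ...     | z , z≢0 , z≢m
    with crossing {P = λ v → v ≡ 0F ⊎ v ≡ mate 0F} (λ v → (v ≟ 0F) ⊎-dec (v ≟ mate 0F))
           (linked-star tree 0F z) (inj₁ refl) [ z≢0 , z≢m ]
  ...       | _ , v , uv , inj₁ refl , v∉ =
    contradiction (inj₂ (mate-unique uv (decidable-stable (T? (S v)) λ ¬Sv → all-in (v , ¬Sv)))) v∉
  ...       | _ , v , uv , inj₂ refl , v∉ = contradiction
    (inj₁ (mate-shared G eff uv (Adj-sym G (mate-adj 0F)) (inside v) (inside 0F))) v∉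
    where
    inside : ∀ v → T (S v)
    inside v = decidable-stable (T? (S v)) λ ¬Sv → all-in (v , ¬Sv)

  members : List (Fin n)
  members = filter (λ v → T? (S v)) (allFin n)

  ∈members : ∀ {v} → T (S v) → v ∈ members
  ∈members {v} = ∈-filter⁺ (λ v → T? (S v)) (∈-allFin v)

  members⁻ : ∀ {v} → v ∈ members → T (S v)
  members⁻ v∈ = proj₂ (∈-filter⁻ (λ v → T? (S v)) {xs = allFin n} v∈)

  members-unique : Unique members
  members-unique = filter⁺ (λ v → T? (S v)) (allFin⁺ n)

  members-dominate : Dominates (Adj G) members
  members-dominate v = mate v , ∈members (mate∈ v) , mate-adj v

  members-packing : Packing (Adj G) members
  members-packing = unique⇒allPairs members-unique λ x∈ y∈ x≢y w xw yw →
    x≢y (mate-shared G eff (Adj-sym G xw) (Adj-sym G yw) (members⁻ x∈) (members⁻ y∈))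

  -- A leaf of the forest induced by the vertices outside S.
  EndVertex : Set
  EndVertex = ∃[ a ] ∃[ a′ ] ¬ T (S a) × ¬ T (S a′) × Adj G a a′ ×
    (∀ {w} → Adj G a w → w ≡ mate a ⊎ w ≡ a′)

  -- Descend from a root outside `S` through vertices outside `S` as long as possible. At the end
  -- all children are in `S`, and only the mate can be such a child.
  degree-two : 3 ≤ n → EndVertex
  degree-two 3≤n with outside-exists 3≤n
  ... | r , ¬Sr with outside ¬Sr
  ...   | a , ra , ¬Sa = go a (child-wf a) ¬Sr ¬Sa (root-child ra)
    where
    open Rooted (rooted tree r)
    root-child : ∀ {a} → Adj G r a → Child r a
    root-child ra with neighbour ra
    ... | inj₁ c = c
    ... | inj₂ c = contradiction c ¬child-root
    go : ∀ v → Acc (λ x y → Child y x) v → ∀ {p} → ¬ T (S p) → ¬ T (S v) → Child p v → EndVertex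
    go v (acc rs) {p} ¬Sp ¬Sv pv with any? (λ c → child? v c ×-dec ¬? (T? (S c)))
    ... | yes (c , vc , ¬Sc) = go c (rs vc) ¬Sv ¬Sc vc
    ... | no none = v , p , ¬Sv , ¬Sp , Adj-sym G (proj₁ pv) , only
      where
      only : ∀ {w} → Adj G v w → w ≡ mate v ⊎ w ≡ p
      only {w} vw with neighbour vw
      ... | inj₁ c = inj₁ (mate-unique vw (decidable-stable (T? (S w)) λ ¬Sw → none (w , c , ¬Sw)))
      ... | inj₂ c = inj₂ (parent-unique c pv)

  -- All edges of the path `c b a a′` are subdivided. Since `a` has degree two, its neighbours are
  -- now both new vertices, so `a` can join the packing. Its former neighbour `b` gives way to the
  -- new vertex on `ba`, which sees only `a` and `b`; the only neighbour of `b` in `S`, namely `c`,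
  -- has been cut off.
  three-edges : 3 ≤ n → ∃[ D ] Unique D × length D ≡ 3 × Increasesγₜ G D
  three-edges 3≤n with degree-two 3≤n
  ... | a , a′ , ¬Sa , ¬Sa′ , aa′ , only =
    D , ((bc≢ba ∷ bc≢aa′ ∷ []) ∷ (ba≢aa′ ∷ []) ∷ [] ∷ []) , refl ,
    increases G D (λ v → mate v , mate-adj v) members-dominate packing
      (≤-reflexive (cong suc (sym (length-map move members))))
    where
    b = mate a
    c = mate b
    ab : Adj G a b
    ab = mate-adj a
    bc : Adj G b c
    bc = mate-adj b
    ba : Adj G b a
    ba = Adj-sym G ab
    D : List (Edge G)
    D = edge G bc ∷ edge G ba ∷ edge G aa′ ∷ []

    b≢a : b ≢ a
    b≢a e = ¬Sa (subst (T ∘ S) e (mate∈ a))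
    c≢a : c ≢ a
    c≢a e = ¬Sa (subst (T ∘ S) e (mate∈ b))
    b≢a′ : b ≢ a′
    b≢a′ e = ¬Sa′ (subst (T ∘ S) e (mate∈ a))
    c≢b : c ≢ b
    c≢b = Adj⇒≢ G bc ∘ sym
    bc≢ba : edge G bc ≢ edge G ba
    bc≢ba = edge≢ G (edge G bc) ba (edge-endʳ G bc) c≢b c≢a
    bc≢aa′ : edge G bc ≢ edge G aa′
    bc≢aa′ = edge≢ G (edge G bc) aa′ (edge-endˡ G bc) b≢a b≢a′
    ba≢aa′ : edge G ba ≢ edge G aa′
    ba≢aa′ = edge≢ G (edge G ba) aa′ (edge-endˡ G ba) b≢a b≢a′

    -- Position `1F` of `D` is the edge `ba`.
    move : Fin n → Subdivided G D
    move x with x ≟ b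
    ... | yes _ = inj₂ 1F
    ... | no  _ = inj₁ x

    member-new : ∀ {x} i → T (S x) → x ≢ b → Sub G D (inj₁ x) (inj₂ i) → i ≡ 0F × x ≡ c
    member-new {x} 0F Sx x≢b t with edge-ends G bc (old-new⁻ G D x 0F t)
    ... | inj₁ x≡b = contradiction x≡b x≢b
    ... | inj₂ x≡c = refl , x≡c
    member-new {x} 1F Sx x≢b t with edge-ends G ba (old-new⁻ G D x 1F t)
    ... | inj₁ x≡b  = contradiction x≡b x≢b
    ... | inj₂ refl = contradiction Sx ¬Sa
    member-new {x} 2F Sx x≢b t with edge-ends G aa′ (old-new⁻ G D x 2F t)
    ... | inj₁ refl = contradiction Sx ¬Sa
    ... | inj₂ refl = contradiction Sx ¬Sa′

    apart-b : ∀ {x} → T (S x) → x ≢ b → Apart (Sub G D) (inj₁ x) (inj₂ 1F)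
    apart-b {x} Sx x≢b (inj₁ w) xw bw
      with old-old⁻ G D x w xw | edge-ends G ba (old-new⁻ G D w 1F bw)
    ... | xw′ , unjoined | inj₂ refl = x≢b (mate-unique (Adj-sym G xw′) Sx)
    ... | xw′ , unjoined | inj₁ refl = unjoined 0F
      (subst (λ x → Joins x b (edge G bc)) (sym (mate-unique (Adj-sym G xw′) Sx)) (joins-flip (edge G bc) (edge-joins G bc)))

    apart-a : ∀ {x} → T (S x) → Apart (Sub G D) (inj₁ a) (move x)
    apart-a {x} Sx (inj₁ w) aw _ with old-old⁻ G D a w aw
    ... | aw′ , unjoined with only aw′
    ...   | inj₁ refl = unjoined 1F (joins-flip (edge G ba) (edge-joins G ba))
    ...   | inj₂ refl = unjoined 2F (edge-joins G aa′)
    apart-a {x} Sx (inj₂ i) ai xi with x ≟ b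
    ... | no x≢b with member-new i Sx x≢b xi
    ...   | refl , _ = [ b≢a ∘ sym , c≢a ∘ sym ] (edge-ends G bc (old-new⁻ G D a 0F ai))

    apart-members : ∀ {x y} → T (S x) → T (S y) → x ≢ y → Apart (Sub G D) (move x) (move y)
    apart-members {x} {y} Sx Sy x≢y w xw yw with x ≟ b | y ≟ b
    ... | yes refl | yes refl = x≢y refl
    ... | yes _    | no y≢b   = apart-b Sy y≢b w yw xw
    ... | no x≢b   | yes _    = apart-b Sx x≢b w xw yw
    apart-members {x} {y} Sx Sy x≢y (inj₁ w) xw yw | no x≢b | no y≢b =
      x≢y (mate-shared G eff (Adj-sym G (proj₁ (old-old⁻ G D x w xw))) (Adj-sym G (proj₁ (old-old⁻ G D y w yw))) Sx Sy)
    apart-members {x} {y} Sx Sy x≢y (inj₂ i) xw yw | no x≢b | no y≢b =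
      x≢y (trans (proj₂ (member-new i Sx x≢b xw)) (sym (proj₂ (member-new i Sy y≢b yw))))

    packing : Packing (Sub G D) (inj₁ a ∷ map move members)
    packing = All.tabulate (λ x∈ → apart′ (∈-map⁻ move x∈)) ∷
      AllPairs.map⁺ (unique⇒allPairs members-unique λ x∈ y∈ → apart-members (members⁻ x∈) (members⁻ y∈))
      where
      apart′ : ∀ {y} → ∃[ x ] x ∈ members × y ≡ move x → Apart (Sub G D) (inj₁ a) y
      apart′ (x , x∈ , refl) = apart-a (members⁻ x∈)

-- Total domination after subdividing at most two edges

module _ {n} {G : Graph n} {r} (R : Rooted G r) where
  open Rooted R

  record Downward (e : Edge G) : Set where
    field
      up low : Fin n
      down   : Child up low
      joined : Joins up low e

  abstract
    downward : ∀ e → Downward e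
    downward e with neighbour (Edge.adjacent e)
    ... | inj₁ c = record { down = c ; joined = inj₁ (refl , refl) }
    ... | inj₂ c = record { down = c ; joined = inj₂ (refl , refl) }

-- If no edge of D lies below another one, move S away from the root in everything below D: wherever bc,
-- with c the child of b, is a pair of mates below D, replace c by the vertex above b, or by the new vertex on
-- bc or on the edge above b if there is one.
module Shift {n} {G : Graph n} (tree : IsTree G) {S : Fin n → Bool} (eff : Efficient (adj G) S)
             {r} (R : Rooted G r) (D : List (Edge G)) where
  open Efficient eff
  open Rooted R

  up low : Fin (length D) → Fin n
  up i  = Downward.up (downward R (List.lookup D i))
  low i = Downward.low (downward R (List.lookup D i))

  down : ∀ i → Child (up i) (low i)
  down i = Downward.down (downward R (List.lookup D i))

  joins-down : ∀ i → Joins (up i) (low i) (List.lookup D i)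
  joins-down i = Downward.joined (downward R (List.lookup D i))

  Shifted : Pred (Fin n) 0ℓ
  Shifted w = ∃[ i ] Below (low i) w

  shifted? : Decidable Shifted
  shifted? w = any? λ i → below? (low i) w

  -- When `s` is moved it is the lower vertex of its pair, and `mate s` the upper one. Upper
  -- vertices always stay.
  data Target (s : Fin n) : Subdivided G D → Set where
    stay    : ¬ (Child (mate s) s × Shifted s) → Target s (inj₁ s)
    at-low  : ∀ {i} → Child (mate s) s → Shifted s → low i ≡ s → Target s (inj₂ i)
    at-mate : ∀ {i} → Child (mate s) s → Shifted s → low i ≡ mate s → Target s (inj₂ i)
    lift    : ∀ {a} → Child (mate s) s → Shifted s → (∀ i → low i ≢ s) → (∀ i → low i ≢ mate s) →
              Child a (mate s) → Target s (inj₁ a)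

  target : ∀ s → ∃ (Target s)
  target s with child? (mate s) s ×-dec shifted? s
  ... | no ¬moved = _ , stay ¬moved
  ... | yes (c , sh) with any? (λ i → low i ≟ s)
  ...   | yes (i , e) = _ , at-low c sh e
  ...   | no ¬s with any? (λ i → low i ≟ mate s)
  ...     | yes (i , e) = _ , at-mate c sh e
  ...     | no ¬m with parent (mate s)
  ...       | inj₂ (a , am) = _ , lift c sh (λ i e → ¬s (i , e)) (λ i e → ¬m (i , e)) am
  -- There is always room to lift: were `mate s` the root, then the shifted vertex `s` would lie
  -- below an edge ending at `s` or at the root, and both ends have been excluded.
  ...       | inj₁ m≡r with below-parent c (proj₂ sh)
  ...         | inj₁ e = contradiction (proj₁ sh , e) ¬s
  ...         | inj₂ b = contradiction (proj₁ sh , below-root m≡r b) ¬m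
    where
    below-root : ∀ {a v} → v ≡ r → Below a v → a ≡ v
    below-root _    self       = refl
    below-root refl (step c _) = contradiction c ¬child-root

  shift : Fin n → Subdivided G D
  shift s = proj₁ (target s)

  shifted-members : List (Subdivided G D)
  shifted-members = map shift (members tree eff)

  module _ (unnested : ∀ i j → ¬ Below (low j) (up i)) where

    data Dominated (v : Subdivided G D) : Set where
      by : ∀ u → u ∈ shifted-members → Sub G D v u → Dominated v

    via : ∀ {s v} → T (S s) → (∀ {t} → Target s t → Sub G D v t) → Dominated v
    via {s} Ss f = by (shift s) (∈-map⁺ shift (∈members tree eff Ss)) (f (proj₂ (target s)))

    ¬shifted-up : ∀ i → ¬ Shifted (up i)
    ¬shifted-up i (j , b) = unnested i j b

    low⇒up : ∀ {i u w} → low i ≡ w → Child u w → up i ≡ u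
    low⇒up {i} refl uw = parent-unique (down i) uw

    -- Inside the shifted region no edge is subdivided, so adjacency is there as in `G`. This is
    -- what `unnested` provides.
    ¬low-below : ∀ {i u w} → Child u w → Shifted u → low i ≢ w
    ¬low-below {i} uw sh e = ¬shifted-up i (subst Shifted (sym (low⇒up e uw)) sh)

    shifted-child : ∀ {u w} → Child u w → Shifted u → Shifted w
    shifted-child uw (i , b) = i , step uw b

    shifted-low : ∀ {i w} → low i ≡ w → Shifted w
    shifted-low {i} refl = i , self

    shifted-parent : ∀ {u w} → Child u w → Shifted w → (∀ i → low i ≢ w) → Shifted u
    shifted-parent uw (i , b) ≢w with below-parent uw b
    ... | inj₁ e = contradiction e (≢w i)
    ... | inj₂ b = i , b

    joined-ends : ∀ {u w} i → Joins u w (List.lookup D i) → (u ≡ up i × w ≡ low i) ⊎ (u ≡ low i × w ≡ up i)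
    joined-ends {u} {w} i j
      with endOf-joined e (joins-down i) (joined-endˡ e j) | endOf-joined e (joins-down i) (joined-endʳ e j)
      where e = List.lookup D i
    ... | inj₁ p | inj₂ q = inj₁ (p , q)
    ... | inj₂ p | inj₁ q = inj₂ (p , q)
    ... | inj₁ p | inj₁ q = contradiction (trans p (sym q)) (Adj⇒≢ G (joined-adj (List.lookup D i) j))
    ... | inj₂ p | inj₂ q = contradiction (trans p (sym q)) (Adj⇒≢ G (joined-adj (List.lookup D i) j))

    unjoined : ∀ {u w} → Child u w → (∀ i → low i ≢ w) → ∀ i → ¬ Joins u w (List.lookup D i)
    unjoined uw ≢w i j with joined-ends i j
    ... | inj₁ (_ , e)       = ≢w i (sym e)
    ... | inj₂ (refl , refl) = ¬child-sym (down i) uw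

    sub-down : ∀ {u w} → Child u w → (∀ i → low i ≢ w) → Sub G D (inj₁ u) (inj₁ w)
    sub-down uw ≢w = old-old⁺ G D (proj₁ uw) (unjoined uw ≢w)

    sub-up : ∀ {u w} → Child u w → (∀ i → low i ≢ w) → Sub G D (inj₁ w) (inj₁ u)
    sub-up {u} {w} uw ≢w = Sub-symmetric G D (inj₁ u) (inj₁ w) (sub-down uw ≢w)

    sub-low : ∀ {i w} → low i ≡ w → Sub G D (inj₁ w) (inj₂ i)
    sub-low {i} refl = old-new⁺ G D i (joined-endʳ (List.lookup D i) (joins-down i))

    sub-over : ∀ {i u w} → low i ≡ w → Child u w → Sub G D (inj₁ u) (inj₂ i)
    sub-over {i} refl uw = subst (λ u → Sub G D (inj₁ u) (inj₂ i)) (low⇒up {i} refl uw)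
      (old-new⁺ G D i (joined-endˡ (List.lookup D i) (joins-down i)))

    mate-below : ∀ {u w} → Child u w → ¬ T (S u) → Child w (mate w)
    mate-below {w = w} uw ¬Su with neighbour (mate-adj w)
    ... | inj₁ c = c
    ... | inj₂ c = contradiction (subst (T ∘ S) (parent-unique c uw) (mate∈ w)) ¬Su

    -- Where the mate c of a shifted vertex b goes if c is below b.
    data LowerTarget (b : Fin n) : Subdivided G D → Set where
      new   : ∀ {i} → low i ≡ b → LowerTarget b (inj₂ i)
      above : ∀ {a} → Child a b → (∀ i → low i ≢ b) → LowerTarget b (inj₁ a)

    lowerTarget : ∀ {b t} → T (S b) → Child b (mate b) → Shifted b → Target (mate b) t → LowerTarget b t
    lowerTarget {b} Sb bc sh tgt = go (mate-mate G eff Sb) tgt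
      where
      go : ∀ {t} → mate (mate b) ≡ b → Target (mate b) t → LowerTarget b t
      go mm (stay ¬moved)       = contradiction (subst (λ x → Child x (mate b)) (sym mm) bc , shifted-child bc sh) ¬moved
      go mm (at-low _ _ e)      = contradiction e (¬low-below bc sh)
      go mm (at-mate _ _ e)     = new (trans e mm)
      go mm (lift _ _ _ ≢b am) = above (subst (Child _) mm am) (λ i → ≢b i ∘ (λ e → trans e (sym mm)))

    unmoved : ∀ {s t} → ¬ (Child (mate s) s × Shifted s) → Target s t → t ≡ inj₁ s
    unmoved ¬moved (stay _)          = refl
    unmoved ¬moved (at-low c sh _)   = contradiction (c , sh) ¬moved
    unmoved ¬moved (at-mate c sh _)  = contradiction (c , sh) ¬moved
    unmoved ¬moved (lift c sh _ _ _) = contradiction (c , sh) ¬moved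

    via-mate-of : ∀ {b v} → T (S b) → Child b (mate b) → Shifted b →
                  (∀ {t} → LowerTarget b t → Sub G D v t) → Dominated v
    via-mate-of {b} Sb bc sh f = via (mate∈ b) (f ∘ lowerTarget Sb bc sh)

    via-unmoved : ∀ {s v} → T (S s) → ¬ (Child (mate s) s × Shifted s) → Sub G D v (inj₁ s) → Dominated v
    via-unmoved {s} {v} Ss ¬moved vs = via Ss λ t → subst (Sub G D v) (sym (unmoved ¬moved t)) vs

    -- the mate above w may have moved, and the vertex outside S below w replaces it
    dominated-from-below : ∀ {w} → ¬ T (S w) → Shifted w → Child (mate w) w → Dominated (inj₁ w)
    dominated-from-below {w} ¬Sw sh mw with outside ¬Sw
    ... | a , wa , ¬Sa with neighbour wa
    ...   | inj₂ c = contradiction (subst (T ∘ S) (parent-unique mw c) (mate∈ w)) ¬Sa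
    ...   | inj₁ c = via-mate-of (mate∈ a) ab-c (shifted-child ab sha) λ where
              (new e)      → contradiction e (¬low-below ab sha)
              (above a′ _) → subst (λ x → Sub G D (inj₁ w) (inj₁ x)) (parent-unique ab a′)
                               (sub-down c (λ i → ¬low-below c sh))
      where
      ab : Child a (mate a)
      ab = mate-below c ¬Sw
      ab-c : Child (mate a) (mate (mate a))
      ab-c = mate-below ab ¬Sa
      sha : Shifted a
      sha = shifted-child c sh

    -- A mate above `w` stays, and so does a mate below across an unsubdivided edge. Across a
    -- subdivided edge the new vertex helps: it has replaced the lower vertex of the pair, which is
    -- `mate w` if `w` is in `S`, and the mate of `mate w` otherwise.
    dominated-unshifted : ∀ {w} → ¬ Shifted w → Dominated (inj₁ w)
    dominated-unshifted {w} ¬sh with neighbour (mate-adj w)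
    ... | inj₂ mw = via-unmoved (mate∈ w) (λ (_ , sh) → ¬sh (shifted-child mw sh))
                      (sub-up mw (λ i e → ¬sh (shifted-low e)))
    ... | inj₁ wm with any? (λ i → low i ≟ mate w)
    ...   | no ¬low = via-unmoved (mate∈ w) (λ (_ , sh) → ¬sh (shifted-parent wm sh λ i e → ¬low (i , e)))
                        (sub-down wm (λ i e → ¬low (i , e)))
    ...   | yes (i , e) with T? (S w)
    ...     | no ¬Sw = via-mate-of (mate∈ w) (mate-below wm ¬Sw) (shifted-low e) λ where
                (new e′)    → sub-over e′ wm
                (above _ ≢) → contradiction e (≢ i)
    ...     | yes Sw = via (mate∈ w) λ where
                (stay ¬moved)     → contradiction (subst (λ x → Child x (mate w)) (sym mm) wm , shifted-low e) ¬moved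
                (at-low _ _ e′)   → sub-over e′ wm
                (at-mate _ _ e′)  → contradiction (shifted-low (trans e′ mm)) ¬sh
                (lift _ _ ≢ _ _)  → contradiction e (≢ i)
      where
      mm : mate (mate w) ≡ w
      mm = mate-mate G eff Sw

    -- The edge above `w` is subdivided. If `w` is in `S`, the lower vertex of its pair has moved to
    -- the new vertex on that edge. Otherwise a child of `w` has been chosen: its mate, or, if its
    -- mate is the upper end, a child outside `S` to which a lower vertex was lifted.
    dominated-low : ∀ {w i} → low i ≡ w → Dominated (inj₁ w)
    dominated-low {w} {i} refl with T? (S (up i)) | T? (S w)
    ... | yes Su | no ¬Sw = dominated-from-below ¬Sw (i , self)
          (subst (λ x → Child x w) (mate-unique (Adj-sym G (proj₁ (down i))) Su) (down i))
    ... | yes Su | yes Sw = via Sw λ where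
            (stay ¬moved)    → contradiction (subst (λ x → Child x w) mw (down i) , (i , self)) ¬moved
            (at-low _ _ e)   → sub-low e
            (at-mate _ _ e)  → contradiction (subst Shifted (sym mw) (shifted-low e)) (¬shifted-up i)
            (lift _ _ ≢ _ _) → contradiction refl (≢ i)
      where
      mw : up i ≡ mate w
      mw = mate-unique (Adj-sym G (proj₁ (down i))) Su
    ... | no ¬Su | yes Sw = via-mate-of Sw (mate-below (down i) ¬Su) (i , self) λ where
            (new e)     → sub-low e
            (above _ ≢) → contradiction refl (≢ i)
    ... | no ¬Su | no ¬Sw = via-unmoved (mate∈ w)
            (λ (c , _) → ¬Sw (subst (T ∘ S) (parent-unique c wm) (mate∈ (mate w))))
            (sub-down wm (λ j → ¬low-below wm (i , self)))
      where
      wm : Child w (mate w)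
      wm = mate-below (down i) ¬Su

    -- No edge at `w` is subdivided, so the mate can be lost only by moving, that is, when it is the
    -- lower vertex of a pair. If it is below `w`, it was lifted to `p`; if it is above, the set is
    -- entered from below `w`.
    dominated-deep : ∀ {p w} → Child p w → Shifted p → (∀ i → low i ≢ w) → Dominated (inj₁ w)
    dominated-deep {p} {w} pw sh ≢w with neighbour (mate-adj w) | T? (S w)
    ... | inj₁ wm | yes Sw = via-mate-of Sw wm (shifted-child pw sh) λ where
            (new {i} e)  → contradiction e (≢w i)
            (above aw _) → sub-up aw ≢w
    ... | inj₁ wm | no ¬Sw = via-unmoved (mate∈ w)
            (λ (c , _) → ¬Sw (subst (T ∘ S) (parent-unique c wm) (mate∈ (mate w))))
            (sub-down wm (λ j → ¬low-below wm (shifted-child pw sh)))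
    ... | inj₂ mw | yes Sw = via-unmoved (mate∈ w)
            (λ (c , _) → ¬child-sym mw (subst (λ x → Child x (mate w)) (mate-mate G eff Sw) c))
            (sub-up mw ≢w)
    ... | inj₂ mw | no ¬Sw = dominated-from-below ¬Sw (shifted-child pw sh) mw

    -- If `up i` is in `S`, it has stayed. If only `low i` is, its mate is below it and it has
    -- stayed as well. If neither is, the mate of `low i` is a child, and the lower vertex of that
    -- pair has been lifted to `low i`.
    dominated-new : ∀ i → Dominated (inj₂ i)
    dominated-new i with T? (S (up i)) | T? (S (low i))
    ... | yes Su | _      = via-unmoved Su (λ (_ , sh) → ¬shifted-up i sh)
            (Sub-symmetric G D (inj₁ _) (inj₂ i) (sub-over refl (down i)))
    ... | no ¬Su | yes Sw = via-unmoved Sw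
            (λ (c , _) → ¬Su (subst (T ∘ S) (parent-unique c (down i)) (mate∈ (low i))))
            (Sub-symmetric G D (inj₁ _) (inj₂ i) (sub-low refl))
    ... | no ¬Su | no ¬Sw = via-mate-of (mate∈ (low i)) (mate-below wm ¬Sw) (shifted-child wm (i , self)) λ where
            (new e)     → contradiction e (¬low-below wm (i , self))
            (above a _) → Sub-symmetric G D (inj₁ _) (inj₂ i) (sub-low (parent-unique wm a))
      where
      wm : Child (low i) (mate (low i))
      wm = mate-below (down i) ¬Su

    dominated : ∀ v → Dominated v
    dominated (inj₂ i) = dominated-new i
    dominated (inj₁ w) with shifted? w
    ... | no ¬sh = dominated-unshifted ¬sh
    ... | yes (j , b) with any? (λ i → low i ≟ w)
    ...   | yes (i , e) = dominated-low e
    dominated (inj₁ w) | yes (j , self)      | no ¬low = contradiction (j , refl) ¬low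
    dominated (inj₁ w) | yes (j , step pw b) | no ¬low = dominated-deep pw (j , b) λ i e → ¬low (i , e)

    shifted-dominate : Dominates (Sub G D) shifted-members
    shifted-dominate v with dominated v
    ... | by u u∈ vu = u , u∈ , vu

    ¬increases-unnested : ¬ Increasesγₜ G D
    ¬increases-unnested = ¬increases G D (λ v → mate v , mate-adj v) (members-packing tree eff) shifted-dominate
      (≤-reflexive (length-map shift (members tree eff)))

module _ {n} {G : Graph n} (tree : IsTree G) {S : Fin n → Bool} (eff : Efficient (adj G) S) where

  ¬increases₀ : ¬ Increasesγₜ G []
  ¬increases₀ inc with IsTree.nonempty tree
  ... | s≤s _ = Shift.¬increases-unnested tree eff (rooted tree 0F) [] (λ ()) inc

  ¬increases₁ : ∀ e → ¬ Increasesγₜ G (e ∷ [])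
  ¬increases₁ e = Shift.¬increases-unnested tree eff R (e ∷ []) unnested
    where
    R = rooted tree (src e)
    open Shift tree eff R (e ∷ [])
    unnested : ∀ i j → ¬ Rooted.Below R (low j) (up i)
    unnested 0F 0F = Rooted.¬below-parent R (down 0F)

  -- Rooted at its end `x`, the edge `e` hangs from the root, so the only possible nesting is `f`
  -- below `e`.
  module AtEnd (e f : Edge G) {x y} (xy : Joins x y e) where
    R = rooted tree x
    open Rooted R public
    open Shift tree eff R (e ∷ f ∷ []) public

    ends : up 0F ≡ x × low 0F ≡ y
    ends with endOf-joined e (joins-down 0F) (joined-endˡ e xy) | endOf-joined e (joins-down 0F) (joined-endʳ e xy)
    ... | inj₂ p | _      = contradiction (subst (Child _) (sym p) (down 0F)) ¬child-root
    ... | inj₁ p | inj₂ q = sym p , sym q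
    ... | inj₁ p | inj₁ q = contradiction (trans p (sym q)) (Adj⇒≢ G (joined-adj e xy))

    ¬increases-two : ¬ Below (low 0F) (up 1F) → ¬ Increasesγₜ G (e ∷ f ∷ [])
    ¬increases-two ¬b = ¬increases-unnested λ where
      0F 0F → ¬below-parent (down 0F)
      1F 0F → ¬b
      1F 1F → ¬below-parent (down 1F)
      0F 1F b → contradiction (≤-trans (≤-reflexive (sym (proj₂ (down 1F)))) (≤-trans (below-depth b)
                  (≤-reflexive (trans (cong depth (proj₁ ends)) depth-root)))) λ ()

    -- In the nested case the way from `f` to the root `x` leads through `y`. This cannot happen for
    -- both ends of `e`, as each would be nearer to `f` than the other.
    closer : Below (low 0F) (up 1F) → ∀ {z} → EndOf f z → proj₁ (distance tree z y) < depth z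
    closer b {z} z∈ with below-reach (subst (λ y → Below y z) (proj₂ ends) (below z∈))
      where
      below : ∀ {z} → EndOf f z → Below (low 0F) z
      below z∈ with endOf-joined f (joins-down 1F) z∈
      ... | inj₁ refl = b
      ... | inj₂ refl = step (down 1F) b
    ... | k , reach , e≡ = ≤-trans (s≤s (IsMinimum.minimal (proj₂ (distance tree z y)) reach))
      (≤-reflexive (sym (trans e≡ (trans (cong (k +_) depth-y) (ℕ.+-comm k 1)))))
      where
      depth-y : depth y ≡ 1
      depth-y = trans (cong depth (sym (proj₂ ends)))
        (trans (proj₂ (down 0F)) (cong suc (trans (cong depth (proj₁ ends)) depth-root)))

  -- Rooted at one of the two ends of e, the tree does not have f below e.
  ¬increases₂ : ∀ e f → ¬ Increasesγₜ G (e ∷ f ∷ [])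
  ¬increases₂ e f with X.below? (X.low 0F) (X.up 1F) | Y.below? (Y.low 0F) (Y.up 1F)
    where
    module X = AtEnd e f (inj₁ (refl , refl))
    module Y = AtEnd e f (inj₂ (refl , refl))
  ... | no ¬b  | _      = AtEnd.¬increases-two e f (inj₁ (refl , refl)) ¬b
  ... | yes _  | no ¬b  = AtEnd.¬increases-two e f (inj₂ (refl , refl)) ¬b
  ... | yes b  | yes b′ = contradiction (AtEnd.closer e f (inj₁ (refl , refl)) b {src f} (inj₁ refl))
                            (ℕ.<-asym (AtEnd.closer e f (inj₂ (refl , refl)) b′ {src f} (inj₁ refl)))

  efficient⇒class3 : 3 ≤ n → InClass 3 G
  efficient⇒class3 3≤n = record
    { attained = three-edges tree eff 3≤n
    ; minimal  = λ where
        ([] , _ , refl , inc)             → contradiction inc ¬increases₀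
        (e ∷ [] , _ , refl , inc)         → contradiction inc (¬increases₁ e)
        (e ∷ f ∷ [] , _ , refl , inc)     → contradiction inc (¬increases₂ e f)
        (_ ∷ _ ∷ _ ∷ D , _ , refl , inc)  → s≤s (s≤s (s≤s z≤n))
    }

-- Class 3 forces an efficient set

neighbour-exists : ∀ {n} {G : Graph n} → IsTree G → 3 ≤ n → ∀ v → ∃ (Adj G v)
neighbour-exists tree 3≤n v with third-element 3≤n v v
... | z , z≢v , _ with crossing (_≟ v) (linked-star tree v z) refl z≢v
...   | _ , w , vw , refl , _ = w , vw

leaf-exists : ∀ {n} {G : Graph n} → IsTree G → 3 ≤ n → ∃[ r ] ∃[ c ] Adj G r c × (∀ {w} → Adj G r w → w ≡ c)
leaf-exists {G = G} tree 3≤n with IsTree.nonempty tree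
... | s≤s _ with Rooted.childless-below (rooted tree 0F) 0F
...   | r , _ , none with parent r
  where open Rooted (rooted tree 0F)
...     | inj₂ (p , pr) = r , p , Adj-sym G (proj₁ pr) , λ rw → only (neighbour rw)
  where
  open Rooted (rooted tree 0F)
  only : ∀ {w} → Child r w ⊎ Child w r → w ≡ p
  only (inj₁ c) = contradiction c (none _)
  only (inj₂ c) = parent-unique c pr
...     | inj₁ refl with neighbour-exists tree 3≤n 0F
...       | w , rw with Rooted.neighbour (rooted tree 0F) rw
...         | inj₁ c = contradiction c (none w)
...         | inj₂ c = contradiction c (Rooted.¬child-root (rooted tree 0F))

-- The greedy open packing

module _ {n} {G : Graph n} {r} (R : Rooted G r) where
  open Rooted R

  -- The greedy open packing from the leaves upwards: v is In iff no grandchild of v is In.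
  mutual
    data In (v : Fin n) : Set where
      in! : (∀ {c x} → Child v c → Child c x → Out x) → In v

    -- The complement of `In`, given separately because `In` would otherwise refer to itself
    -- negatively.
    data Out (v : Fin n) : Set where
      out! : ∀ {c x} → Child v c → Child c x → In x → Out v

  ¬in-out : ∀ {v} → In v → ¬ Out v
  ¬in-out (in! f) (out! vc cx i) = ¬in-out i (f vc cx)

  in⊎out : ∀ v → In v ⊎ Out v
  in⊎out v = go v (child-wf v)
    where
    go : ∀ v → Acc (λ x y → Child y x) v → In v ⊎ Out v
    go v (acc rs) with any? (λ c → any? λ x → grandchild? c x)
      where
      grandchild? : ∀ c x → Dec (Σ (Child v c × Child c x) λ _ → In x)
      grandchild? c x with child? v c | child? c x
      ... | no ¬vc | _      = no λ ((vc , _) , _) → ¬vc vc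
      ... | yes _  | no ¬cx = no λ ((_ , cx) , _) → ¬cx cx
      ... | yes vc | yes cx with rs vc
      ...   | acc rs′ with go x (rs′ cx)
      ...     | inj₁ i = yes ((vc , cx) , i)
      ...     | inj₂ o = no λ (_ , i) → ¬in-out i o
    ... | yes (c , x , (vc , cx) , i) = inj₂ (out! vc cx i)
    ... | no none = inj₁ (in! λ {c} {x} vc cx → outside! c x vc cx)
      where
      outside! : ∀ c x → Child v c → Child c x → Out x
      outside! c x vc cx with rs vc
      ... | acc rs′ with go x (rs′ cx)
      ...   | inj₁ i = contradiction (c , x , (vc , cx) , i) none
      ...   | inj₂ o = o

  in? : ∀ v → Dec (In v)
  in? v with in⊎out v
  ... | inj₁ i = yes i
  ... | inj₂ o = no λ i → ¬in-out i o

  ¬in⇒out : ∀ {v} → ¬ In v → Out v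
  ¬in⇒out {v} ¬i with in⊎out v
  ... | inj₁ i = contradiction i ¬i
  ... | inj₂ o = o

  -- Siblings share their parent as a neighbour, so a packing can take only one `In` child of each
  -- vertex. The choice is left open because later arguments prescribe it at one vertex. The value
  -- of `pick` at a vertex without `In` children is arbitrary.
  record Choice : Set where
    field
      pick  : Fin n → Fin n
      picks : ∀ {u x} → Child u x → In x → Child u (pick u) × In (pick u)

  some-choice : Choice
  some-choice = record
    { pick  = λ u → proj₁ (choose u)
    ; picks = λ {u} {x} ux i → proj₂ (choose u) (x , ux , i)
    }
    where
    choose : ∀ u → ∃[ x ] ((∃[ y ] Child u y × In y) → Child u x × In x)
    choose u with any? (λ x → child? u x ×-dec in? x)
    ... | yes (x , p) = x , λ _ → p
    ... | no none = u , λ p → contradiction p none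

  choice-with : ∀ {c x} → Child c x → In x → Σ Choice λ ch → Choice.pick ch c ≡ x
  choice-with {c} {x} cx ix = record { pick = pick′ ; picks = picks′ } , chosen
    where
    open Choice some-choice
    pick′ : Fin n → Fin n
    pick′ u with u ≟ c
    ... | yes _ = x
    ... | no _  = pick u
    picks′ : ∀ {u y} → Child u y → In y → Child u (pick′ u) × In (pick′ u)
    picks′ {u} uy iy with u ≟ c
    ... | yes refl = cx , ix
    ... | no _     = picks uy iy
    chosen : pick′ c ≡ x
    chosen with c ≟ c
    ... | yes _ = refl
    ... | no c≢ = contradiction refl c≢

-- Maximality of the greedy packing, and ways to enlarge it after subdivision

module LeafRooted {n} {G : Graph n} (tree : IsTree G) (3≤n : 3 ≤ n) {r c₀}
                  (rc₀ : Adj G r c₀) (only-c₀ : ∀ {w} → Adj G r w → w ≡ c₀) where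
  R = rooted tree r
  open Rooted R

  child-c₀ : Child r c₀
  child-c₀ with neighbour rc₀
  ... | inj₁ c = c
  ... | inj₂ c = contradiction c ¬child-root

  module Greedy (choice : Choice R) where
    open Choice choice

    Picked : Pred (Fin n) 0ℓ
    Picked v = In R v × (v ≡ r ⊎ ∃[ u ] Child u v × pick u ≡ v)

    picked? : Decidable Picked
    picked? v = in? R v ×-dec ((v ≟ r) ⊎-dec any? λ u → child? u v ×-dec (pick u ≟ v))

    picked : List (Fin n)
    picked = filter picked? (allFin n)

    ∈picked : ∀ {v} → Picked v → v ∈ picked
    ∈picked {v} = ∈-filter⁺ picked? (∈-allFin v)

    picked⁻ : ∀ {v} → v ∈ picked → Picked v
    picked⁻ v∈ = proj₂ (∈-filter⁻ picked? {xs = allFin n} v∈)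

    picked-child : ∀ {u x} → Picked x → Child u x → x ≡ pick u
    picked-child (_ , inj₁ refl)           ux = contradiction ux ¬child-root
    picked-child (_ , inj₂ (u , u′x , eq)) ux = trans (sym eq) (cong pick (parent-unique u′x ux))

    -- The parent; the root takes its only neighbour `c₀` instead.
    above : Fin n → Fin n
    above v = [ (λ _ → c₀) , proj₁ ]′ (parent v)

    above-child : ∀ {u v} → Child u v → above v ≡ u
    above-child {u} {v} uv with parent v
    ... | inj₁ refl     = contradiction uv ¬child-root
    ... | inj₂ (w , wv) = parent-unique wv uv

    above-root : above r ≡ c₀
    above-root with parent r
    ... | inj₁ _       = refl
    ... | inj₂ (_ , c) = contradiction c ¬child-root

    -- A vertex that is `Out` has a child with an `In` child, and that child lies above a picked
    -- vertex. A vertex that is `In` is dominated by its own parent, which lies above the sibling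
    -- picked there.
    above-dominate : Dominates (Adj G) (map above picked)
    above-dominate v = go (parent v) (in⊎out R v)
      where
      via : ∀ {u x} → Child u x → In R x → Adj G v u → ∃[ t ] t ∈ map above picked × Adj G v t
      via ux i vu with picks ux i
      ... | c , i′ = _ , subst (_∈ map above picked) (above-child c) (∈-map⁺ above (∈picked (i′ , inj₂ (_ , c , refl)))) , vu
      go : v ≡ r ⊎ ∃ (λ u → Child u v) → In R v ⊎ Out R v → ∃[ u ] u ∈ map above picked × Adj G v u
      go _                (inj₂ (out! vc cx i)) = via cx i (proj₁ vc)
      go (inj₂ (u , uv))  (inj₁ i)              = via uv i (Adj-sym G (proj₁ uv))
      go (inj₁ refl)      (inj₁ i)              =
        c₀ , subst (_∈ map above picked) above-root (∈-map⁺ above (∈picked (i , inj₁ refl))) , rc₀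

    -- A common neighbour is the parent of both, against the choice of one child, or lies between a
    -- vertex and its grandchild, which are not both `In`.
    picked-apart : ∀ {x y} → Picked x → Picked y → x ≢ y → Apart (Adj G) x y
    picked-apart px py x≢y w xw yw with neighbour xw | neighbour yw
    ... | inj₁ c | inj₁ d = x≢y (parent-unique c d)
    ... | inj₂ c | inj₂ d = x≢y (trans (picked-child px c) (sym (picked-child py d)))
    ... | inj₁ c | inj₂ d = ¬in-out R (proj₁ px) (out! c d (proj₁ py))
    ... | inj₂ c | inj₁ d = ¬in-out R (proj₁ py) (out! d c (proj₁ px))

    module _ (D : List (Edge G)) where

      -- One more vertex is enough, since `map above picked` dominates `G` and is as long as
      -- `picked`.
      increases-by : (z : Subdivided G D) (move : Fin n → Subdivided G D) →
        (∀ {x y} → Picked x → Picked y → x ≢ y → Apart (Sub G D) (move x) (move y)) →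
        (∀ {x} → Picked x → Apart (Sub G D) z (move x)) → Increasesγₜ G D
      increases-by z move apart apart-z = increases G D (neighbour-exists tree 3≤n) above-dominate packing
        (≤-reflexive (cong suc (trans (length-map above picked) (sym (length-map move picked)))))
        where
        apart-z′ : ∀ {y} → ∃[ x ] x ∈ picked × y ≡ move x → Apart (Sub G D) z y
        apart-z′ (x , x∈ , refl) = apart-z (picked⁻ x∈)
        packing : Packing (Sub G D) (z ∷ map move picked)
        packing = All.tabulate (λ y∈ → apart-z′ (∈-map⁻ move y∈)) ∷
          AllPairs.map⁺ (unique⇒allPairs (filter⁺ picked? (allFin⁺ n))
            λ x∈ y∈ → apart (picked⁻ x∈) (picked⁻ y∈))

      -- A new vertex adjacent to both would lie on the edge joining `x` and `y`, but each
      -- subdivided edge has an end other than these two.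
      old-apart : ∀ {x y} → (∀ i → ∃[ w ] EndOf (List.lookup D i) w × w ≢ x × w ≢ y) →
                  Picked x → Picked y → x ≢ y → Apart (Sub G D) (inj₁ x) (inj₁ y)
      old-apart {x} {y} end px py x≢y (inj₁ w) xw yw =
        picked-apart px py x≢y w (proj₁ (old-old⁻ G D x w xw)) (proj₁ (old-old⁻ G D y w yw))
      old-apart {x} {y} end px py x≢y (inj₂ i) xi yi with end i
      ... | w , w∈ , w≢x , w≢y with endOf-joined (List.lookup D i) (ends-joined (List.lookup D i)
              (old-new⁻ G D x i xi) (old-new⁻ G D y i yi) x≢y) w∈
      ...   | inj₁ e = w≢x e
      ...   | inj₂ e = w≢y e

      out⇒≢ : ∀ {w x} → Out R w → Picked x → w ≢ x
      out⇒≢ o (i , _) refl = ¬in-out R i o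

      increases-adding : (z : Subdivided G D) → (∀ i → ∃[ w ] EndOf (List.lookup D i) w × Out R w) →
        (∀ {x} → Picked x → Apart (Sub G D) z (inj₁ x)) → Increasesγₜ G D
      increases-adding z end = increases-by z inj₁ λ px py → old-apart
        (λ i → let w , w∈ , o = end i in w , w∈ , out⇒≢ o px , out⇒≢ o py) px py

      -- For the case that the common end `c` of the subdivided edges may itself be picked: `t` then
      -- takes its place.
      increases-replacing : ∀ {c} (z t : Subdivided G D) → (∀ i → EndOf (List.lookup D i) c) →
        (∀ {x} → Picked x → x ≢ c → Apart (Sub G D) t (inj₁ x)) →
        (∀ {x} → Picked x → x ≢ c → Apart (Sub G D) z (inj₁ x)) →
        Apart (Sub G D) z t → Increasesγₜ G D
      increases-replacing {c} z t end apart-t apart-z apart-zt = increases-by z move moved apart-z′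
        where
        move : Fin n → Subdivided G D
        move x with x ≟ c
        ... | yes _ = t
        ... | no _  = inj₁ x
        moved : ∀ {x y} → Picked x → Picked y → x ≢ y → Apart (Sub G D) (move x) (move y)
        moved {x} {y} px py x≢y with x ≟ c | y ≟ c
        ... | yes refl | yes refl = contradiction refl x≢y
        ... | yes refl | no y≢c   = apart-t py y≢c
        ... | no x≢c   | yes refl = λ w xw yw → apart-t px x≢c w yw xw
        ... | no x≢c   | no y≢c   = old-apart (λ i → c , end i , x≢c ∘ sym , y≢c ∘ sym) px py x≢y
        apart-z′ : ∀ {x} → Picked x → Apart (Sub G D) z (move x)
        apart-z′ {x} px with x ≟ c
        ... | yes refl = apart-zt
        ... | no x≢c   = apart-z px x≢c

      -- The new vertex on `vc` sees only `v` and `c`. No neighbour of `c` is picked, since `v` and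
      -- the children of `c` are `Out`; by `cut`, the picked neighbours of `v` are no longer
      -- adjacent to it.
      increases-at : ∀ {v c} i → Joins v c (List.lookup D i) → (∀ j → EndOf (List.lookup D j) v) → Child v c →
        Out R v → (∀ {x} → Child c x → Out R x) →
        (∀ {x} → Picked x → Adj G x v → ∃[ j ] Joins x v (List.lookup D j)) → Increasesγₜ G D
      increases-at {v} {c} i vc-joined end vc ov oc cut = increases-adding (inj₂ i) (λ j → v , end j , ov) apart
        where
        apart : ∀ {x} → Picked x → Apart (Sub G D) (inj₂ i) (inj₁ x)
        apart {x} px (inj₁ w) iw xw
          with endOf-joined (List.lookup D i) vc-joined (old-new⁻ G D w i iw) | old-old⁻ G D x w xw
        ... | inj₁ refl | xv , unjoined with cut px xv
        ...   | j , joined = unjoined j joined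
        apart {x} px (inj₁ w) iw xw | inj₂ refl | xc , unjoined with neighbour xc
        ...   | inj₁ d = out⇒≢ ov px (parent-unique vc d)
        ...   | inj₂ d = out⇒≢ (oc d) px refl

-- Every failure of efficiency yields an increase by at most two edges

module Failures {n} {G : Graph n} (tree : IsTree G) (3≤n : 3 ≤ n) {r c₀}
                (rc₀ : Adj G r c₀) (only-c₀ : ∀ {w} → Adj G r w → w ≡ c₀)
                (steady : ∀ D → Unique D → length D ≤ 2 → ¬ Increasesγₜ G D) where
  open LeafRooted tree 3≤n rc₀ only-c₀
  open Rooted R

  steady₁ : ∀ {e} → ¬ Increasesγₜ G (e ∷ [])
  steady₁ = steady _ ([] ∷ []) (s≤s z≤n)

  steady₂ : ∀ {e f} → e ≢ f → ¬ Increasesγₜ G (e ∷ f ∷ [])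
  steady₂ e≢f = steady _ ((e≢f ∷ []) ∷ [] ∷ []) (s≤s (s≤s z≤n))

  siblings-≢ : ∀ {v x y} (vx : Child v x) (vy : Child v y) → x ≢ y → edge G (proj₁ vx) ≢ edge G (proj₁ vy)
  siblings-≢ vx vy x≢y =
    edge≢ G (edge G (proj₁ vx)) (proj₁ vy) (edge-endʳ G (proj₁ vx)) (Adj⇒≢ G (proj₁ vx) ∘ sym) x≢y

  root-child : ∀ {x} → Child r x → x ≡ c₀
  root-child (rx , _) = only-c₀ rx

  -- With `v₁` picked at `c`, subdividing `cv₁` and `cv₂` removes the obstacle between the siblings,
  -- their common neighbour `c`, and `v₂` can be added.
  in-child-unique : ∀ {c v₁ v₂} → Child c v₁ → Child c v₂ → In R v₁ → In R v₂ → v₁ ≡ v₂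
  in-child-unique {c} {v₁} {v₂} cv₁ cv₂ i₁ i₂ = decidable-stable (v₁ ≟ v₂) λ v₁≢v₂ →
    contradiction (increase v₁≢v₂) (steady₂ (siblings-≢ cv₁ cv₂ v₁≢v₂))
    where
    e₁ = edge G (proj₁ cv₁)
    e₂ = edge G (proj₁ cv₂)
    D : List (Edge G)
    D = e₁ ∷ e₂ ∷ []
    choice,chosen = choice-with R cv₁ i₁
    open Greedy (proj₁ choice,chosen)
    open Choice (proj₁ choice,chosen)

    c-end : ∀ i → EndOf (List.lookup D i) c
    c-end 0F = edge-endˡ G (proj₁ cv₁)
    c-end 1F = edge-endˡ G (proj₁ cv₂)

    module _ (v₁≢v₂ : v₁ ≢ v₂) where

      v₂-old : ∀ {w} → Adj G v₂ w → (∀ i → ¬ Joins v₂ w (List.lookup D i)) → Child v₂ w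
      v₂-old v₂w unjoined with neighbour v₂w
      ... | inj₁ d = d
      ... | inj₂ d with parent-unique d cv₂
      ...   | refl = contradiction (joins-flip e₂ (edge-joins G (proj₁ cv₂))) (unjoined 1F)

      ¬picked-v₂ : ∀ {x} → Picked x → x ≢ v₂
      ¬picked-v₂ px refl = v₁≢v₂ (sym (trans (picked-child px cv₂) (proj₂ choice,chosen)))

      v₂-apart : ∀ {x} → Picked x → x ≢ c → Apart (Sub G D) (inj₁ v₂) (inj₁ x)
      v₂-apart {x} px x≢c (inj₁ w) v₂w xw with old-old⁻ G D v₂ w v₂w | old-old⁻ G D x w xw
      ... | a , unjoined | xw′ , _ with v₂-old a unjoined | neighbour xw′
      ...   | d | inj₁ d′ = ¬picked-v₂ px (parent-unique d′ d)
      ...   | d | inj₂ d′ = ¬in-out R i₂ (out! d d′ (proj₁ px))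
      v₂-apart {x} px x≢c (inj₂ 0F) v₂i _ with edge-ends G (proj₁ cv₁) (old-new⁻ G D v₂ 0F v₂i)
      ... | inj₁ e = Adj⇒≢ G (proj₁ cv₂) (sym e)
      ... | inj₂ e = v₁≢v₂ (sym e)
      v₂-apart {x} px x≢c (inj₂ 1F) _ xi with edge-ends G (proj₁ cv₂) (old-new⁻ G D x 1F xi)
      ... | inj₁ e = x≢c e
      ... | inj₂ e = ¬picked-v₂ px e

      increase : Increasesγₜ G D
      increase with in⊎out R c
      ... | inj₂ o = increases-adding D (inj₁ v₂) (λ i → c , c-end i , o)
        λ px → v₂-apart px λ x≡c → ¬in-out R (proj₁ px) (subst (Out R) (sym x≡c) o)
      -- If picked, `c` would share the new vertex on `cv₂` with `v₂`. It moves to the new vertex on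
      -- `cv₁`.
      ... | inj₁ ic = increases-replacing D (inj₁ v₂) (inj₂ 0F) c-end new-apart v₂-apart v₂-new
        where
        new-apart : ∀ {x} → Picked x → x ≢ c → Apart (Sub G D) (inj₂ 0F) (inj₁ x)
        new-apart {x} px x≢c (inj₁ w) iw xw
          with edge-ends G (proj₁ cv₁) (old-new⁻ G D w 0F iw) | old-old⁻ G D x w xw
        ... | inj₁ refl | xc , unjoined with neighbour xc
        ...   | inj₁ d = ¬in-out R (proj₁ px) (out! d cv₁ i₁)
        ...   | inj₂ d with trans (picked-child px d) (proj₂ choice,chosen)
        ...     | refl = unjoined 0F (joins-flip e₁ (edge-joins G (proj₁ cv₁)))
        new-apart {x} px x≢c (inj₁ w) iw xw | inj₂ refl | xv₁ , _ with neighbour xv₁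
        ... | inj₁ d = x≢c (parent-unique d cv₁)
        ... | inj₂ d = ¬in-out R ic (out! cv₁ d (proj₁ px))
        v₂-new : Apart (Sub G D) (inj₁ v₂) (inj₂ 0F)
        v₂-new (inj₁ w) v₂w iw with old-old⁻ G D v₂ w v₂w
        ... | a , unjoined with v₂-old a unjoined | edge-ends G (proj₁ cv₁) (old-new⁻ G D w 0F iw)
        ...   | d | inj₁ refl = ¬child-sym cv₂ d
        ...   | d | inj₂ refl = Adj⇒≢ G (proj₁ cv₂) (parent-unique cv₁ d)

  -- Here `c′` would have no `In` neighbour, as `v` and the children of `c′` are `Out`. The new
  -- vertex on `vc′` can be added once the picked neighbours of `v` are cut off. There is at most
  -- one: a picked child, or the parent if no child is `In`. If `c′` is `In`, it is picked itself
  -- and a single edge does both.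
  in-child-agrees : ∀ {v c c′ x} → Child v c → Child c x → In R x → Child v c′ → (∀ {y} → Child c′ y → Out R y) → ⊥
  in-child-agrees {v} {c} {c′} vc cx ix vc′ oc′ with in⊎out R c′
  ... | inj₁ ic′ = contradiction
    (increases-at D 0F (edge-joins G (proj₁ vc′)) (λ { 0F → edge-endˡ G (proj₁ vc′) }) vc′ ov oc′ cut) steady₁
    where
    ov : Out R v
    ov = out! vc cx ix
    D : List (Edge G)
    D = edge G (proj₁ vc′) ∷ []
    choice,chosen = choice-with R vc′ ic′
    open Greedy (proj₁ choice,chosen)
    cut : ∀ {x} → Picked x → Adj G x v → ∃[ j ] Joins x v (List.lookup D j)
    cut px xv with neighbour xv
    ... | inj₁ d = contradiction (out! d vc′ ic′) (¬in-out R (proj₁ px))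
    ... | inj₂ d with trans (picked-child px d) (proj₂ choice,chosen)
    ...   | refl = 0F , joins-flip (edge G (proj₁ vc′)) (edge-joins G (proj₁ vc′))
  ... | inj₂ oc with any? (λ c″ → child? v c″ ×-dec in? R c″)
  ...   | yes (c″ , vc″ , ic″) = contradiction
    (increases-at D 1F (edge-joins G (proj₁ vc′))
      (λ { 0F → edge-endˡ G (proj₁ vc″) ; 1F → edge-endˡ G (proj₁ vc′) }) vc′ ov oc′ cut)
    (steady₂ (siblings-≢ vc″ vc′ λ { refl → ¬in-out R ic″ oc }))
    where
    ov : Out R v
    ov = out! vc cx ix
    D : List (Edge G)
    D = edge G (proj₁ vc″) ∷ edge G (proj₁ vc′) ∷ []
    choice,chosen = choice-with R vc″ ic″
    open Greedy (proj₁ choice,chosen)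
    cut : ∀ {x} → Picked x → Adj G x v → ∃[ j ] Joins x v (List.lookup D j)
    cut px xv with neighbour xv
    ... | inj₁ d = contradiction (out! d vc″ ic″) (¬in-out R (proj₁ px))
    ... | inj₂ d with trans (picked-child px d) (proj₂ choice,chosen)
    ...   | refl = 0F , joins-flip (edge G (proj₁ vc″)) (edge-joins G (proj₁ vc″))
  -- Only the parent can be a picked neighbour of `v`. If `v` is the root, its only child is both
  -- `c` and `c′`.
  ...   | no none with parent v
  ...     | inj₁ refl = ¬in-out R ix (oc′ (subst (λ c → Child c _) (trans (root-child vc) (sym (root-child vc′))) cx))
  ...     | inj₂ (p , pv) = contradiction
    (increases-at D 0F (edge-joins G (proj₁ vc′))
      (λ { 0F → edge-endˡ G (proj₁ vc′) ; 1F → edge-endʳ G (proj₁ pv) }) vc′ ov oc′ cut)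
    (steady₂ (edge≢ G (edge G (proj₁ vc′)) (proj₁ pv) (edge-endʳ G (proj₁ vc′))
      (λ { refl → ¬child-sym pv vc′ }) (Adj⇒≢ G (proj₁ vc′) ∘ sym)))
    where
    ov : Out R v
    ov = out! vc cx ix
    D : List (Edge G)
    D = edge G (proj₁ vc′) ∷ edge G (proj₁ pv) ∷ []
    open Greedy (some-choice R)
    cut : ∀ {x} → Picked x → Adj G x v → ∃[ j ] Joins x v (List.lookup D j)
    cut {x} px xv with neighbour xv
    ... | inj₁ d with parent-unique d pv
    ...   | refl = 1F , edge-joins G (proj₁ pv)
    cut {x} px xv | inj₂ d = contradiction (x , d , proj₁ px) none

  private
    e₀ = edge G rc₀

  -- Otherwise `r` can be added: subdividing `rc₀` leaves it with one neighbour, which is new. If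
  -- `c₀` is `In`, it would share that neighbour, so it moves onto the new vertex on `rc₀`, and the
  -- edge to its picked child is subdivided to keep that child apart.
  root-in : In R r
  root-in with in⊎out R r | in⊎out R c₀
  ... | inj₁ i | _ = i
  ... | inj₂ o | inj₂ o₀ = contradiction
    (increases-adding D (inj₁ r) (λ { 0F → r , edge-endˡ G rc₀ , o }) apart) steady₁
    where
    D : List (Edge G)
    D = e₀ ∷ []
    open Greedy (some-choice R)
    apart : ∀ {x} → Picked x → Apart (Sub G D) (inj₁ r) (inj₁ x)
    apart px (inj₁ w) rw _ with old-old⁻ G D r w rw
    ... | rw′ , unjoined with only-c₀ rw′
    ...   | refl = unjoined 0F (edge-joins G rc₀)
    apart {x} px (inj₂ 0F) _ xi with edge-ends G rc₀ (old-new⁻ G D x 0F xi)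
    ... | inj₁ refl = ¬in-out R (proj₁ px) o
    ... | inj₂ refl = ¬in-out R (proj₁ px) o₀
  ... | inj₂ o@(out! {x = x₀} rc c₀x i) | inj₁ i₀ with root-child rc
  ...   | refl = contradiction
    (increases-replacing D (inj₁ r) (inj₂ 0F) c₀-end new-apart r-apart r-new)
    (steady₂ (edge≢ G e₀ (proj₁ c₀x) (edge-endˡ G rc₀) (Adj⇒≢ G rc₀) (λ { refl → ¬child-root c₀x })))
    where
    D : List (Edge G)
    D = e₀ ∷ edge G (proj₁ c₀x) ∷ []
    choice,chosen = choice-with R c₀x i
    open Greedy (proj₁ choice,chosen)
    c₀-end : ∀ i → EndOf (List.lookup D i) c₀
    c₀-end 0F = edge-endʳ G rc₀
    c₀-end 1F = edge-endˡ G (proj₁ c₀x)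
    r-old : ∀ {w} → Sub G D (inj₁ r) (inj₁ w) → ⊥
    r-old {w} rw with old-old⁻ G D r w rw
    ... | rw′ , unjoined with only-c₀ rw′
    ...   | refl = unjoined 0F (edge-joins G rc₀)
    new-apart : ∀ {x} → Picked x → x ≢ c₀ → Apart (Sub G D) (inj₂ 0F) (inj₁ x)
    new-apart {x} px x≢c₀ (inj₁ w) iw xw
      with edge-ends G rc₀ (old-new⁻ G D w 0F iw) | old-old⁻ G D x w xw
    ... | inj₁ refl | xr , _ = x≢c₀ (only-c₀ (Adj-sym G xr))
    ... | inj₂ refl | xc₀ , unjoined with neighbour xc₀
    ...   | inj₁ d = ¬in-out R (proj₁ px) (subst (Out R) (parent-unique rc d) o)
    ...   | inj₂ d with trans (picked-child px d) (proj₂ choice,chosen)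
    ...     | refl = unjoined 1F (joins-flip (edge G (proj₁ c₀x)) (edge-joins G (proj₁ c₀x)))
    r-apart : ∀ {x} → Picked x → x ≢ c₀ → Apart (Sub G D) (inj₁ r) (inj₁ x)
    r-apart px x≢c₀ (inj₁ w) rw _ = r-old rw
    r-apart {x} px x≢c₀ (inj₂ 0F) _ xi with edge-ends G rc₀ (old-new⁻ G D x 0F xi)
    ... | inj₁ refl = ¬in-out R (proj₁ px) o
    ... | inj₂ e    = x≢c₀ e
    r-apart {x} px x≢c₀ (inj₂ 1F) ri _ with edge-ends G (proj₁ c₀x) (old-new⁻ G D r 1F ri)
    ... | inj₁ e    = Adj⇒≢ G rc₀ e
    ... | inj₂ refl = ¬child-root c₀x
    r-new : Apart (Sub G D) (inj₁ r) (inj₂ 0F)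
    r-new (inj₁ w) rw _ = r-old rw

  -- Otherwise the new vertex on `rc₀` can be added: it sees `r` and `c₀`, the subdivision separates
  -- `r` from `c₀`, and as `r` is `In` no child of `c₀` is.
  c₀-in : In R c₀
  c₀-in with in⊎out R c₀
  ... | inj₁ i = i
  ... | inj₂ o = contradiction
    (increases-adding D (inj₂ 0F) (λ { 0F → c₀ , edge-endʳ G rc₀ , o }) apart) steady₁
    where
    D : List (Edge G)
    D = e₀ ∷ []
    open Greedy (some-choice R)
    apart : ∀ {x} → Picked x → Apart (Sub G D) (inj₂ 0F) (inj₁ x)
    apart {x} px (inj₁ w) iw xw with edge-ends G rc₀ (old-new⁻ G D w 0F iw) | old-old⁻ G D x w xw
    ... | inj₁ refl | xr , _ with only-c₀ (Adj-sym G xr)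
    ...   | refl = ¬in-out R (proj₁ px) o
    apart {x} px (inj₁ w) iw xw | inj₂ refl | xc₀ , unjoined with neighbour xc₀
    ... | inj₂ d = ¬in-out R root-in (out! child-c₀ d (proj₁ px))
    ... | inj₁ d with parent-unique d child-c₀
    ...   | refl = unjoined 0F (edge-joins G rc₀)

  S : Fin n → Bool
  S v = does (in? R v)

  ∈S⁻ : ∀ {v} → T (S v) → In R v
  ∈S⁻ {v} t with in? R v
  ... | yes i = i

  ∈S⁺ : ∀ {v} → In R v → T (S v)
  ∈S⁺ {v} i = subst T (sym (dec-true (in? R v) i)) tt

  OneInNeighbour : Pred (Fin n) 0ℓ
  OneInNeighbour v = ∃[ u ] Adj G v u × In R u × (∀ {w} → Adj G v w → In R w → w ≡ u)

  -- If the parent is `In`, no child is, being a grandchild of it. If the parent is `Out`, some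
  -- child of it has an `In` child; then `v` has one by `in-child-agrees`, and only one by
  -- `in-child-unique`.
  one-in-neighbour : ∀ v → OneInNeighbour v
  one-in-neighbour v with parent v
  ... | inj₁ refl = c₀ , rc₀ , c₀-in , λ rw _ → only-c₀ rw
  ... | inj₂ (u , uv) with in⊎out R u
  ...   | inj₁ iu = u , Adj-sym G (proj₁ uv) , iu , only
    where
    only : ∀ {w} → Adj G v w → In R w → w ≡ u
    only vw iw with neighbour vw
    ... | inj₁ d = contradiction (out! uv d iw) (¬in-out R iu)
    ... | inj₂ d = parent-unique d uv
  ...   | inj₂ ou@(out! uc cx ix) with any? (λ y → child? v y ×-dec in? R y)
  ...     | no none = ⊥-elim (in-child-agrees uc cx ix uv λ vy → ¬in⇒out R λ iy → none (_ , vy , iy))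
  ...     | yes (y , vy , iy) = y , proj₁ vy , iy , only
    where
    only : ∀ {w} → Adj G v w → In R w → w ≡ y
    only vw iw with neighbour vw
    ... | inj₁ d = in-child-unique d vy iw iy
    ... | inj₂ d with parent-unique d uv
    ...   | refl = contradiction ou (¬in-out R iw)

  greedy-efficient : Efficient (adj G) S
  greedy-efficient = record
    { mate        = λ v → proj₁ (one-in-neighbour v)
    ; mate-adj    = λ v → proj₁ (proj₂ (one-in-neighbour v))
    ; mate∈       = λ v → ∈S⁺ (proj₁ (proj₂ (proj₂ (one-in-neighbour v))))
    ; mate-unique = λ {v} vu Su → proj₂ (proj₂ (proj₂ (one-in-neighbour v))) vu (∈S⁻ Su)
    ; outside     = λ ¬Sv → outside (¬in⇒out R (¬Sv ∘ ∈S⁺))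
    }
    where
    outside : ∀ {v} → Out R v → ∃[ u ] Adj G v u × ¬ T (S u)
    outside {v} ov@(out! {c} vc cx ix) with in⊎out R c
    ... | inj₂ oc = c , proj₁ vc , λ Sc → ¬in-out R (∈S⁻ Sc) oc
    -- The parent then has `c` as an `In` grandchild and is `Out`; it exists because the root is
    -- `In`.
    ... | inj₁ ic with parent v
    ...   | inj₁ refl = contradiction ov (¬in-out R root-in)
    ...   | inj₂ (u , uv) = u , Adj-sym G (proj₁ uv) , λ Su → ¬in-out R (∈S⁻ Su) (out! uv vc ic)

class3⇒efficient : ∀ {n} {G : Graph n} → IsTree G → 3 ≤ n → InClass 3 G → ∃ (Efficient (adj G))
class3⇒efficient {G = G} tree 3≤n class with leaf-exists tree 3≤n
... | r , c₀ , rc₀ , only = _ , Failures.greedy-efficient tree 3≤n rc₀ only λ D uniq len inc →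
  ℕ.<⇒≱ (s≤s len) (IsMinimum.minimal class (D , uniq , refl , inc))

-- Members of the families

module _ {n m} (G : Graph n) (y : Fin n) (H : Graph m) (x : Fin m) where

  private
    _~_ = attachAdj G y H x

  link⁻ : ∀ {u w} → T (inj₂ w ~ inj₁ u) → u ≡ y × w ≡ x
  link⁻ t with Equivalence.to T-∧ t
  ... | p , q = ==⇒≡ p , ==⇒≡ q

  link⁺ : T (inj₂ x ~ inj₁ y)
  link⁺ = Equivalence.from (T-∧ {y == y} {x == x}) (≡⇒== {u = y} refl , ≡⇒== {u = x} refl)

  module _ {S : Fin n → Bool} {Sₖ : Fin m → Bool} (eff : Efficient (adj G) S) (¬Sx : ¬ T (Sₖ x)) where
    open Efficient eff

    private
      S⊎ = [ S , Sₖ ]′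

    -- The attached end `x` is outside the set, so old vertices keep their mates, and only the new
    -- vertices need attention.
    attach-efficient : (mateₖ : Fin m → Fin n ⊎ Fin m) →
      (∀ w → T (inj₂ w ~ mateₖ w)) → (∀ w → T (S⊎ (mateₖ w))) →
      (∀ w b → T (inj₂ w ~ b) → T (S⊎ b) → b ≡ mateₖ w) →
      (∀ w → ¬ T (Sₖ w) → ∃[ b ] T (inj₂ w ~ b) × ¬ T (S⊎ b)) →
      Efficient _~_ S⊎
    attach-efficient mateₖ adjₖ ∈ₖ uniqueₖ outsideₖ = record
      { mate        = [ inj₁ ∘ mate , mateₖ ]′
      ; mate-adj    = λ { (inj₁ v) → mate-adj v ; (inj₂ w) → adjₖ w }
      ; mate∈       = λ { (inj₁ v) → mate∈ v ; (inj₂ w) → ∈ₖ w }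
      ; mate-unique = λ { {a} {b} → unique a b }
      ; outside     = λ { {inj₁ v} ¬S → let u , vu , ¬Su = outside ¬S in inj₁ u , vu , ¬Su
                        ; {inj₂ w} ¬S → outsideₖ w ¬S }
      }
      where
      unique : ∀ a b → T (a ~ b) → T (S⊎ b) → b ≡ [ inj₁ ∘ mate , mateₖ ]′ a
      unique (inj₁ v) (inj₁ u) vu Su = cong inj₁ (mate-unique vu Su)
      unique (inj₁ v) (inj₂ w) vw Sw with link⁻ {v} {w} vw
      ... | _ , refl = contradiction Sw ¬Sx
      unique (inj₂ w) b wb Sb = uniqueₖ w b wb Sb

  attach-efficient-own-mates : ∀ {S : Fin n → Bool} {Sₖ : Fin m → Bool} →
    Efficient (adj G) S → ¬ T (S y) → ¬ T (Sₖ x) → (mateₖ : Fin m → Fin m) →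
    (∀ w → Adj H w (mateₖ w) × T (Sₖ (mateₖ w))) →
    (∀ w z → Adj H w z → T (Sₖ z) → z ≡ mateₖ w) →
    (∀ w → ¬ T (Sₖ w) → w ≡ x) → Efficient _~_ [ S , Sₖ ]′
  attach-efficient-own-mates {S} {Sₖ} eff ¬Sy ¬Sx mateₖ mates uniqueₖ only-x = attach-efficient eff ¬Sx
    (inj₂ ∘ mateₖ) (proj₁ ∘ mates) (proj₂ ∘ mates)
    (λ { w (inj₁ u) wu Su → contradiction (subst (T ∘ S) (proj₁ (link⁻ {u} {w} wu)) Su) ¬Sy
       ; w (inj₂ z) wz Sz → cong inj₂ (uniqueₖ w z wz Sz) })
    λ w ¬Sw → inj₁ y , subst (λ w → T (inj₂ w ~ inj₁ y)) (sym (only-x w ¬Sw)) link⁺ , ¬Sy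

  -- With `y` in the set, `y` becomes the mate of `x`, so no neighbour of `x` in `H` may be in the
  -- set.
  attach-efficient-linked-mates : ∀ {S : Fin n → Bool} {Sₖ : Fin m → Bool} →
    Efficient (adj G) S → T (S y) → ¬ T (Sₖ x) → (mateₖ : Fin m → Fin m) →
    (∀ w → w ≢ x → Adj H w (mateₖ w) × T (Sₖ (mateₖ w))) →
    (∀ w z → Adj H w z → T (Sₖ z) → w ≢ x × z ≡ mateₖ w) →
    (∀ w → ¬ T (Sₖ w) → ∃[ z ] Adj H w z × ¬ T (Sₖ z)) → Efficient _~_ [ S , Sₖ ]′
  attach-efficient-linked-mates {S} {Sₖ} eff Sy ¬Sx mateₖ mates uniqueₖ outsideₖ =
    attach-efficient eff ¬Sx mate′ adj′ ∈′ unique′ λ w ¬Sw → let z , wz , ¬Sz = outsideₖ w ¬Sw in inj₂ z , wz , ¬Sz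
    where
    mate′ : Fin m → Fin n ⊎ Fin m
    mate′ w with w ≟ x
    ... | yes _ = inj₁ y
    ... | no _  = inj₂ (mateₖ w)
    adj′ : ∀ w → T (inj₂ w ~ mate′ w)
    adj′ w with w ≟ x
    ... | yes refl = link⁺
    ... | no w≢x   = proj₁ (mates w w≢x)
    ∈′ : ∀ w → T ([ S , Sₖ ]′ (mate′ w))
    ∈′ w with w ≟ x
    ... | yes refl = Sy
    ... | no w≢x   = proj₂ (mates w w≢x)
    unique′ : ∀ w b → T (inj₂ w ~ b) → T ([ S , Sₖ ]′ b) → b ≡ mate′ w
    unique′ w (inj₁ u) wu Su with link⁻ {u} {w} wu | w ≟ x
    ... | refl , _    | yes _  = refl
    ... | _    , w≡x  | no w≢x = contradiction w≡x w≢x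
    unique′ w (inj₂ z) wz Sz with uniqueₖ w z wz Sz | w ≟ x
    ... | w≢x , _ | yes w≡x = contradiction w≡x w≢x
    ... | _ , e   | no _    = cong inj₂ e

module _ {A : Set} (inS : A → Bool) where

  labelled : ∀ {n} → Vec A n → Fin n → Bool
  labelled ℓ v = inS (lookup ℓ v)

  labelled-++ : ∀ {n m} (ℓ : Vec A n) (ℓ′ : Vec A m) i →
                labelled (ℓ ++ᵛ ℓ′) i ≡ [ labelled ℓ , labelled ℓ′ ]′ (splitAt n i)
  labelled-++ {n} ℓ ℓ′ i = trans (cong inS (lookup-splitAt n ℓ ℓ′ i)) (go (splitAt n i))
    where
    go : ∀ a → inS ([ lookup ℓ , lookup ℓ′ ]′ a) ≡ [ labelled ℓ , labelled ℓ′ ]′ a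
    go (inj₁ _) = refl
    go (inj₂ _) = refl

  attach-labelled : ∀ {n m} {G : Graph n} {y} {H : Graph m} {x} (ℓ : Vec A n) (ℓ′ : Vec A m) →
    Efficient (attachAdj G y H x) [ labelled ℓ , labelled ℓ′ ]′ →
    Efficient (adj (attach G y H x)) (labelled (ℓ ++ᵛ ℓ′))
  attach-labelled {n} {m} ℓ ℓ′ = efficient-transport (+↔⊎ {n} {m}) (λ _ _ → refl) (labelled-++ ℓ ℓ′)

mate₆ : Fin 6 → Fin 6
mate₆ = lookup (1F ∷ 0F ∷ 1F ∷ 4F ∷ 5F ∷ 4F ∷ [])

S₆ : Fin 6 → Bool
S₆ = lookup (true ∷ true ∷ false ∷ false ∷ true ∷ true ∷ [])

path₆-efficient : ∀ {S} → (∀ v → S v ≡ S₆ v) → Efficient (adj (path 6)) S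
path₆-efficient {S} S≗ = record
  { mate        = mate₆
  ; mate-adj    = toWitness {a? = all? λ v → adj? (path 6) v (mate₆ v)} tt
  ; mate∈       = λ v → subst T (sym (S≗ (mate₆ v))) (toWitness {a? = all? λ v → T? (S₆ (mate₆ v))} tt v)
  ; mate-unique = λ {v} {u} vu Su → toWitness
      {a? = all? λ v → all? λ u → adj? (path 6) v u →-dec T? (S₆ u) →-dec (u ≟ mate₆ v)} tt v u vu (subst T (S≗ u) Su)
  ; outside     = λ {v} ¬Sv → let u , vu , ¬Su = outside₆ v (¬Sv ∘ subst T (sym (S≗ v))) in
      u , vu , ¬Su ∘ subst T (S≗ u)
  }
  where
  outside₆ : ∀ v → ¬ T (S₆ v) → ∃[ u ] Adj (path 6) v u × ¬ T (S₆ u)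
  outside₆ = toWitness
    {a? = all? λ v → ¬? (T? (S₆ v)) →-dec any? λ u → adj? (path 6) v u ×-dec ¬? (T? (S₆ u))} tt

in𝓣 : Status → Bool
in𝓣 A = false
in𝓣 B = true
in𝓣 C = true

in𝓞 : Status′ → Bool
in𝓞 A = false
in𝓞 B = true

in𝓣⁻ : ∀ {s} → T (in𝓣 s) → s ≡ B ⊎ s ≡ C
in𝓣⁻ {B} _ = inj₁ refl
in𝓣⁻ {C} _ = inj₂ refl

in𝓣⁺ : ∀ {s} → s ≡ B ⊎ s ≡ C → T (in𝓣 s)
in𝓣⁺ (inj₁ refl) = tt
in𝓣⁺ (inj₂ refl) = tt

in𝓞⁻ : ∀ {s} → T (in𝓞 s) → s ≡ B
in𝓞⁻ {B} _ = refl

¬in𝓣⁻ : ∀ {s} → ¬ T (in𝓣 s) → s ≡ A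
¬in𝓣⁻ {A} _ = refl
¬in𝓣⁻ {B} f = contradiction tt f
¬in𝓣⁻ {C} f = contradiction tt f

¬in𝓞⁻ : ∀ {s} → ¬ T (in𝓞 s) → s ≡ A
¬in𝓞⁻ {A} _ = refl
¬in𝓞⁻ {B} f = contradiction tt f

module _ {n} {G : Graph n} {y : Fin n} {S : Fin n → Bool} (eff : Efficient (adj G) S) where

  attach-path₃ : ¬ T (S y) → ∀ {Sₖ} → Sₖ 0F ≡ false → Sₖ 1F ≡ true → Sₖ 2F ≡ true →
                 Efficient (attachAdj G y (path 3) 0F) [ S , Sₖ ]′
  attach-path₃ ¬Sy {Sₖ} e₀ e₁ e₂ = attach-efficient-own-mates G y (path 3) 0F eff ¬Sy (subst T e₀)
    (λ { 0F → 1F ; 1F → 2F ; 2F → 1F })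
    (λ { 0F → tt , subst T (sym e₁) tt ; 1F → tt , subst T (sym e₂) tt ; 2F → tt , subst T (sym e₁) tt })
    (λ { 0F 1F _ _ → refl ; 1F 0F _ s → ⊥-elim (subst T e₀ s) ; 1F 2F _ _ → refl ; 2F 1F _ _ → refl ; 2F 2F () _ })
    (λ { 0F _ → refl ; 1F ¬s → contradiction (subst T (sym e₁) tt) ¬s ; 2F ¬s → contradiction (subst T (sym e₂) tt) ¬s })

  attach-path₄ : T (S y) → ∀ {Sₖ} → Sₖ 0F ≡ false → Sₖ 1F ≡ false → Sₖ 2F ≡ true → Sₖ 3F ≡ true →
                 Efficient (attachAdj G y (path 4) 0F) [ S , Sₖ ]′
  attach-path₄ Sy {Sₖ} e₀ e₁ e₂ e₃ = attach-efficient-linked-mates G y (path 4) 0F eff Sy (subst T e₀)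
    -- The value at `0F` is a placeholder: the mate there is `y`.
    (λ { 0F → 0F ; 1F → 2F ; 2F → 3F ; 3F → 2F })
    (λ { 0F 0≢0 → contradiction refl 0≢0 ; 1F _ → tt , subst T (sym e₂) tt
       ; 2F _ → tt , subst T (sym e₃) tt ; 3F _ → tt , subst T (sym e₂) tt })
    (λ { 0F 1F _ s → ⊥-elim (subst T e₁ s) ; 1F 0F _ s → ⊥-elim (subst T e₀ s) ; 1F 2F _ _ → (λ ()) , refl
       ; 2F 1F _ s → ⊥-elim (subst T e₁ s) ; 2F 3F _ _ → (λ ()) , refl ; 3F 2F _ _ → (λ ()) , refl ; 3F 3F () _ })
    (λ { 0F _ → 1F , tt , subst T e₁ ; 1F _ → 0F , tt , subst T e₀
       ; 2F ¬s → contradiction (subst T (sym e₂) tt) ¬s ; 3F ¬s → contradiction (subst T (sym e₃) tt) ¬s })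

  attach-path₄ʳ : T (S y) → ∀ {Sₖ} → Sₖ 0F ≡ true → Sₖ 1F ≡ true → Sₖ 2F ≡ false → Sₖ 3F ≡ false →
                  Efficient (attachAdj G y (path 4) 3F) [ S , Sₖ ]′
  attach-path₄ʳ Sy {Sₖ} e₀ e₁ e₂ e₃ = attach-efficient-linked-mates G y (path 4) 3F eff Sy (subst T e₃)
    (λ { 0F → 1F ; 1F → 0F ; 2F → 1F ; 3F → 0F })
    (λ { 0F _ → tt , subst T (sym e₁) tt ; 1F _ → tt , subst T (sym e₀) tt
       ; 2F _ → tt , subst T (sym e₁) tt ; 3F 3≢3 → contradiction refl 3≢3 })
    (λ { 0F 1F _ _ → (λ ()) , refl ; 1F 0F _ _ → (λ ()) , refl ; 1F 2F _ s → ⊥-elim (subst T e₂ s)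
       ; 2F 1F _ _ → (λ ()) , refl ; 2F 3F _ s → ⊥-elim (subst T e₃ s) ; 3F 2F _ s → ⊥-elim (subst T e₂ s) ; 3F 3F () _ })
    (λ { 0F ¬s → contradiction (subst T (sym e₀) tt) ¬s ; 1F ¬s → contradiction (subst T (sym e₁) tt) ¬s
       ; 2F _ → 3F , tt , subst T e₃ ; 3F _ → 2F , tt , subst T e₂ })

labelled𝓣-efficient : ∀ {n} {G : Graph n} {ℓ} → Labelled𝓣 G ℓ → Efficient (adj G) (labelled in𝓣 ℓ)
labelled𝓣-efficient p₆ = path₆-efficient λ { 0F → refl ; 1F → refl ; 2F → refl ; 3F → refl ; 4F → refl ; 5F → refl }
labelled𝓣-efficient (op₁ {G = G} {ℓ} t y y≡A) = attach-labelled in𝓣 {G = G} {H = path 3} ℓ _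
  (attach-path₃ {G = G} (labelled𝓣-efficient t) (subst (T ∘ in𝓣) y≡A) refl refl refl)
labelled𝓣-efficient (op₂ {G = G} {ℓ} t y y≡BC) = attach-labelled in𝓣 {G = G} {H = path 4} ℓ _
  (attach-path₄ {G = G} (labelled𝓣-efficient t) (in𝓣⁺ y≡BC) refl refl refl refl)

labelled𝓞-efficient : ∀ {n} {G : Graph n} {ℓ} → Labelled𝓞 G ℓ → Efficient (adj G) (labelled in𝓞 ℓ)
labelled𝓞-efficient p₆ = path₆-efficient λ { 0F → refl ; 1F → refl ; 2F → refl ; 3F → refl ; 4F → refl ; 5F → refl }
labelled𝓞-efficient (op₁ {G = G} {ℓ} t x y z _ _ _ _ z≡A) = attach-labelled in𝓞 {G = G} {H = path 3} ℓ _
  (attach-path₃ {G = G} (labelled𝓞-efficient t) (subst (T ∘ in𝓞) z≡A) refl refl refl)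
labelled𝓞-efficient (op₂ {G = G} {ℓ} t x y _ x≡B _) = attach-labelled in𝓞 {G = G} {H = path 4} ℓ _
  (attach-path₄ʳ {G = G} (labelled𝓞-efficient t) (subst (T ∘ in𝓞) (sym x≡B) tt) refl refl refl refl)

≅-efficient : ∀ {n m} {G : Graph n} {H : Graph m} {S} → G ≅ H → Efficient (adj H) S → ∃ (Efficient (adj G))
≅-efficient iso eff = _ , efficient-transport (_≅_.bijection iso) (_≅_.preserves iso) (λ _ → refl) eff

-- Efficient trees belong to both families

true≡ : ∀ {b} → T b → b ≡ true
true≡ = Equivalence.to T-≡

false≡ : ∀ {b} → ¬ T b → b ≡ false
false≡ ¬t = T⇔⇒≡ ¬t λ ()

orient : Bool → Fin 4 → Fin 4
orient false i = i
orient true  i = Fin.opposite i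

orient-involutive : ∀ b i → orient b (orient b i) ≡ i
orient-involutive false i = refl
orient-involutive true  i = toWitness {a? = all? λ i → Fin.opposite (Fin.opposite i) ≟ i} tt i

orient-path₄ : ∀ b i j → adj (path 4) (orient b i) (orient b j) ≡ adj (path 4) i j
orient-path₄ false i j = refl
orient-path₄ true  i j = toWitness
  {a? = all? λ i → all? λ j → adj (path 4) (Fin.opposite i) (Fin.opposite j) Bool.≟ adj (path 4) i j} tt i j

S₃ : Fin 3 → Bool
S₃ = lookup (false ∷ true ∷ true ∷ [])

S₄ : Fin 4 → Bool
S₄ = lookup (false ∷ false ∷ true ∷ true ∷ [])

-- The common shape of 𝓣 and 𝓞, where the statuses are forgotten except for membership in the efficient set.
-- The two families attach the path of their second operation in opposite directions.
record Family : Set₁ where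
  field
    Member  : ∀ {m} → Graph m → (Fin m → Bool) → Set
    reverse : Bool
    base    : ∀ {s} → s ≗ S₆ → Member (path 6) s
    -- The set `s′` is tied to `s` and `S₃` pointwise only, in place of function extensionality.
    add₃    : ∀ {m} {H : Graph m} {s} → Member H s → ∀ y → ¬ T (s y) → ∀ {s′} →
              (∀ i → s′ i ≡ [ s , S₃ ]′ (splitAt m i)) → Member (attach H y (path 3) 0F) s′
    add₄    : ∀ {m} {H : Graph m} {s} → Member H s → ∀ y → T (s y) → ∀ {s′} →
              (∀ i → s′ i ≡ [ s , S₄ ∘ orient reverse ]′ (splitAt m i)) →
              Member (attach H y (path 4) (orient reverse 0F)) s′

_⊕_ : ∀ {A : Set} {m k} → (Fin m → A) → (Fin k → A) → Fin (m + k) → A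
_⊕_ {m = m} f g i = [ f , g ]′ (splitAt m i)

-- A root outside `S` serves as one of the two central vertices of the initial `P₆`, which bends at
-- the root as `c b r a′ b′ c′`.
module Growth {n} {G : Graph n} (tree : IsTree G) {S : Fin n → Bool} (eff : Efficient (adj G) S)
              {r} (¬Sr : ¬ T (S r)) where
  open Efficient eff
  R = rooted tree r
  open Rooted R

  Chain : ∀ {k} → Fin n → Vec (Fin n) k → Set
  Chain u []       = ⊤
  Chain u (v ∷ vs) = Child u v × Chain v vs

  chain-depth : ∀ {k u} (vs : Vec (Fin n) k) → Chain u vs → ∀ i → depth (lookup vs i) ≡ suc (Fin.toℕ i) + depth u
  chain-depth (v ∷ vs) (uv , _)  zero    = proj₂ uv
  chain-depth {u = u} (v ∷ vs) (uv , ch) (suc i) =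
    trans (chain-depth vs ch i) (trans (cong (suc (Fin.toℕ i) +_) (proj₂ uv)) (ℕ.+-suc (suc (Fin.toℕ i)) (depth u)))

  chain-parent : ∀ {k u w} (vs : Vec (Fin n) k) → Chain u vs → ∀ i → Child w (lookup vs i) →
                 (w ≡ u × Fin.toℕ i ≡ 0) ⊎ ∃[ j ] lookup vs j ≡ w
  chain-parent (v ∷ vs) (uv , _)  zero    c = inj₁ (parent-unique c uv , refl)
  chain-parent (v ∷ vs) (uv , ch) (suc i) c with chain-parent vs ch i c
  ... | inj₁ (refl , _) = inj₂ (zero , refl)
  ... | inj₂ (j , e)    = inj₂ (suc j , e)

  chain-step : ∀ {k u} (vs : Vec (Fin n) k) → Chain u vs → ∀ i j → suc (Fin.toℕ i) ≡ Fin.toℕ j →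
               Child (lookup vs i) (lookup vs j)
  chain-step (v ∷ w ∷ vs) (_ , vw , _) zero    (suc zero) refl = vw
  chain-step (v ∷ vs)     (_ , ch)     (suc i) (suc j)    e    = chain-step vs ch i j (ℕ.suc-injective e)

  chain-injective : ∀ {k u} (vs : Vec (Fin n) k) → Chain u vs → ∀ {i j} → lookup vs i ≡ lookup vs j → i ≡ j
  chain-injective {u = u} vs ch {i} {j} e = Fin.toℕ-injective (ℕ.suc-injective (ℕ.+-cancelʳ-≡ (depth u) _ _
    (trans (sym (chain-depth vs ch i)) (trans (cong depth e) (chain-depth vs ch j)))))

  -- Neighbours are parent and child, and depths along a chain are consecutive, so a chain is an
  -- induced path.
  chain-path : ∀ {k u} (vs : Vec (Fin n) k) → Chain u vs → ∀ i j → adj G (lookup vs i) (lookup vs j) ≡ adj (path k) i j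
  chain-path {u = u} vs ch i j = T⇔⇒≡
    (Equivalence.from T-∨ ∘ Sum.map (λ c → ℕ.≡⇒≡ᵇ _ _ (consecutive i j c)) (λ c → ℕ.≡⇒≡ᵇ _ _ (consecutive j i c)) ∘ neighbour)
    ([ (λ e → proj₁ (chain-step vs ch i j (ℕ.≡ᵇ⇒≡ _ _ e)))
     , (λ e → Adj-sym G (proj₁ (chain-step vs ch j i (ℕ.≡ᵇ⇒≡ _ _ e)))) ]′ ∘ Equivalence.to T-∨)
    where
    consecutive : ∀ i j → Child (lookup vs i) (lookup vs j) → suc (Fin.toℕ i) ≡ Fin.toℕ j
    consecutive i j (_ , e) = ℕ.suc-injective (ℕ.+-cancelʳ-≡ (depth u) _ _
      (trans (cong suc (sym (chain-depth vs ch i))) (trans (sym e) (chain-depth vs ch j))))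

  -- Closure under parents makes the rest of the tree hang from the image by single edges; closure
  -- under mates makes it hang by vertices outside `S`.
  record Embedding {m} (f : Fin m → Fin n) (H : Graph m) : Set where
    field
      embeds    : ∀ i j → adj G (f i) (f j) ≡ adj H i j
      injective : ∀ {i j} → f i ≡ f j → i ≡ j
      has-root  : ∃[ i ] f i ≡ r
      parents   : ∀ {u i} → Child u (f i) → ∃[ j ] f j ≡ u
      mates     : ∀ i → ∃[ j ] f j ≡ mate (f i)

    below-outside : ∀ {u v} → Child u v → (∀ i → f i ≢ u) → ∀ i → f i ≢ v
    below-outside uv out i refl = let j , e = parents uv in out j e

    chain-outside : ∀ {k u} (vs : Vec (Fin n) k) → Chain u vs → (∀ i → f i ≢ u) → ∀ i j → f i ≢ lookup vs j
    chain-outside (v ∷ vs) (uv , ch) out i zero    = below-outside uv out i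
    chain-outside (v ∷ vs) (uv , ch) out i (suc j) = chain-outside vs ch (below-outside uv out) i j

    -- The involution `π` is the identity or the reversal of the path, so that one argument covers
    -- attachment at either end.
    extend : ∀ {k y v} (vs : Vec (Fin n) k) → Chain (f y) (v ∷ vs) → (∀ i → f i ≢ v) →
      (π : Fin (suc k) → Fin (suc k)) → (∀ i → π (π i) ≡ i) →
      (∀ i j → adj (path (suc k)) (π i) (π j) ≡ adj (path (suc k)) i j) →
      (∀ j → (∃[ i ] f i ≡ mate (lookup (v ∷ vs) j)) ⊎ (∃[ i ] lookup (v ∷ vs) i ≡ mate (lookup (v ∷ vs) j))) →
      Embedding (f ⊕ (lookup (v ∷ vs) ∘ π)) (attach H y (path (suc k)) (π zero))
    extend {k} {y} {v} vs ch@(yv , ch′) ∉v π π-inv π-path matesₖ = record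
      { embeds    = λ i j → embeds⊎ (splitAt m i) (splitAt m j)
      ; injective = λ {i} {j} e → trans (sym (join-splitAt m (suc k) i))
                      (trans (cong (join m (suc k)) (injective⊎ (splitAt m i) (splitAt m j) e)) (join-splitAt m (suc k) j))
      ; has-root  = let i , e = has-root in found (inj₁ i) e
      ; parents   = λ {u} {i} → parents⊎ (splitAt m i)
      ; mates     = λ i → mates⊎ (splitAt m i)
      }
      where
      g : Fin (suc k) → Fin n
      g = lookup (v ∷ vs) ∘ π
      f∪g : Fin m ⊎ Fin (suc k) → Fin n
      f∪g = [ f , g ]′

      found : ∀ {w} a → f∪g a ≡ w → ∃[ i ] (f ⊕ g) i ≡ w
      found a e = join m (suc k) a , trans (cong f∪g (splitAt-join m (suc k) a)) e

      found-g : ∀ {w} j → lookup (v ∷ vs) j ≡ w → ∃[ i ] (f ⊕ g) i ≡ w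
      found-g j e = found (inj₂ (π j)) (trans (cong (lookup (v ∷ vs)) (π-inv j)) e)

      outside-g : ∀ i j → f i ≢ g j
      outside-g i j with π j
      ... | zero  = ∉v i
      ... | suc l = chain-outside vs ch′ ∉v i l

      parent-g : ∀ {w} j → Child w (g j) → (w ≡ f y × j ≡ π zero) ⊎ ∃[ i ] g i ≡ w
      parent-g j c with chain-parent (v ∷ vs) ch (π j) c
      ... | inj₁ (e , z) = inj₁ (e , trans (sym (π-inv j)) (cong π (Fin.toℕ-injective z)))
      ... | inj₂ (i , e) = inj₂ (π i , trans (cong (lookup (v ∷ vs)) (π-inv i)) e)

      -- An edge between the image and the chain joins parent and child. The parent is in the image,
      -- by closure under parents, and the only chain vertex with a parent there is the first.
      cross : ∀ i j → adj G (f i) (g j) ≡ (i == y) ∧ (j == π zero)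
      cross i j = T⇔⇒≡ to from
        where
        to : Adj G (f i) (g j) → T ((i == y) ∧ (j == π zero))
        to a with neighbour a
        ... | inj₂ c = let l , e = parents c in contradiction e (outside-g l j)
        ... | inj₁ c with parent-g j c
        ...   | inj₂ (l , e)   = contradiction (sym e) (outside-g i l)
        ...   | inj₁ (e , refl) = Equivalence.from T-∧ (≡⇒== (injective e) , ≡⇒== {u = π zero} refl)
        from : T ((i == y) ∧ (j == π zero)) → Adj G (f i) (g j)
        from t with Equivalence.to T-∧ t
        ... | p , q with ==⇒≡ {u = i} p | ==⇒≡ {u = j} q
        ...   | refl | refl = subst (λ l → Adj G (f i) (lookup (v ∷ vs) l)) (sym (π-inv zero)) (proj₁ yv)

      embeds⊎ : ∀ a b → adj G (f∪g a) (f∪g b) ≡ attachAdj H y (path (suc k)) (π zero) a b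
      embeds⊎ (inj₁ i) (inj₁ j) = embeds i j
      embeds⊎ (inj₁ i) (inj₂ j) = cross i j
      embeds⊎ (inj₂ i) (inj₁ j) = trans (Graph.sym G _ _) (cross j i)
      embeds⊎ (inj₂ i) (inj₂ j) = trans (chain-path (v ∷ vs) ch (π i) (π j)) (π-path i j)

      injective⊎ : ∀ a b → f∪g a ≡ f∪g b → a ≡ b
      injective⊎ (inj₁ i) (inj₁ j) e = cong inj₁ (injective e)
      injective⊎ (inj₁ i) (inj₂ j) e = contradiction e (outside-g i j)
      injective⊎ (inj₂ i) (inj₁ j) e = contradiction (sym e) (outside-g j i)
      injective⊎ (inj₂ i) (inj₂ j) e = cong inj₂
        (trans (sym (π-inv i)) (trans (cong π (chain-injective (v ∷ vs) ch e)) (π-inv j)))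

      parents⊎ : ∀ {u} a → Child u (f∪g a) → ∃[ j ] (f ⊕ g) j ≡ u
      parents⊎ (inj₁ i) c = let j , e = parents c in found (inj₁ j) e
      parents⊎ (inj₂ i) c with parent-g i c
      ... | inj₁ (e , _) = found (inj₁ y) (sym e)
      ... | inj₂ (j , e) = found (inj₂ j) e

      mates⊎ : ∀ a → ∃[ j ] (f ⊕ g) j ≡ mate (f∪g a)
      mates⊎ (inj₁ i) = let j , e = mates i in found (inj₁ j) e
      mates⊎ (inj₂ i) with matesₖ (π i)
      ... | inj₁ (j , e) = found (inj₁ j) e
      ... | inj₂ (j , e) = found-g j e

  open Embedding

  mate-child : ∀ {u w} → Child u w → ¬ T (S u) → Child w (mate w)
  mate-child {w = w} uw ¬Su with neighbour (mate-adj w)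
  ... | inj₁ c = c
  ... | inj₂ c = contradiction (subst (T ∘ S) (parent-unique c uw) (mate∈ w)) ¬Su

  a′ = proj₁ (outside ¬Sr)
  ¬Sa′ : ¬ T (S a′)
  ¬Sa′ = proj₂ (proj₂ (outside ¬Sr))
  root-down : ∀ {w} → Adj G r w → Child r w
  root-down rw with neighbour rw
  ... | inj₁ c = c
  ... | inj₂ c = contradiction c ¬child-root
  ra′ : Child r a′
  ra′ = root-down (proj₁ (proj₂ (outside ¬Sr)))
  b = mate r
  c = mate b
  rb : Child r b
  rb = root-down (mate-adj r)
  bc : Child b c
  bc = mate-child rb ¬Sr
  b′ = mate a′
  c′ = mate b′
  a′b′ : Child a′ b′
  a′b′ = mate-child ra′ ¬Sr
  b′c′ : Child b′ c′
  b′c′ = mate-child a′b′ ¬Sa′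
  b≢a′ : b ≢ a′
  b≢a′ e = ¬Sa′ (subst (T ∘ S) e (mate∈ r))

  -- Listed upwards, so that appending `a′ b′ c′` gives the numbering of `path 6`.
  f₃ : Fin 3 → Fin n
  f₃ = lookup (c ∷ b ∷ r ∷ [])

  c≢r : c ≢ r
  c≢r e = ¬Sr (subst (T ∘ S) e (mate∈ b))

  ¬cr : ¬ Adj G c r
  ¬cr a with neighbour a
  ... | inj₁ d = ¬child-root d
  ... | inj₂ d = Adj⇒≢ G (proj₁ rb) (parent-unique d bc)

  embedding₃ : Embedding f₃ (path 3)
  embedding₃ = record
    { embeds    = embeds₃
    ; injective = λ {i} {j} → injective₃ i j
    ; has-root  = 2F , refl
    ; parents   = λ {u} {i} → parents₃ i
    ; mates     = λ { 0F → 1F , sym (mate-mate G eff (mate∈ r)) ; 1F → 0F , refl ; 2F → 1F , refl }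
    }
    where
    embeds₃ : ∀ i j → adj G (f₃ i) (f₃ j) ≡ adj (path 3) i j
    embeds₃ 0F 0F = Graph.irrefl G c
    embeds₃ 0F 1F = true≡ (Adj-sym G (proj₁ bc))
    embeds₃ 0F 2F = false≡ ¬cr
    embeds₃ 1F 0F = true≡ (proj₁ bc)
    embeds₃ 1F 1F = Graph.irrefl G b
    embeds₃ 1F 2F = true≡ (Adj-sym G (proj₁ rb))
    embeds₃ 2F 0F = false≡ (¬cr ∘ Adj-sym G)
    embeds₃ 2F 1F = true≡ (proj₁ rb)
    embeds₃ 2F 2F = Graph.irrefl G r
    injective₃ : ∀ i j → f₃ i ≡ f₃ j → i ≡ j
    injective₃ 0F 0F e = refl
    injective₃ 0F 1F e = contradiction (sym e) (Adj⇒≢ G (proj₁ bc))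
    injective₃ 0F 2F e = contradiction e c≢r
    injective₃ 1F 0F e = contradiction e (Adj⇒≢ G (proj₁ bc))
    injective₃ 1F 1F e = refl
    injective₃ 1F 2F e = contradiction (sym e) (Adj⇒≢ G (proj₁ rb))
    injective₃ 2F 0F e = contradiction (sym e) c≢r
    injective₃ 2F 1F e = contradiction e (Adj⇒≢ G (proj₁ rb))
    injective₃ 2F 2F e = refl
    parents₃ : ∀ {u} i → Child u (f₃ i) → ∃[ j ] f₃ j ≡ u
    parents₃ 0F d = 1F , parent-unique bc d
    parents₃ 1F d = 2F , parent-unique rb d
    parents₃ 2F d = contradiction d ¬child-root

  f₆ : Fin 6 → Fin n
  f₆ = f₃ ⊕ lookup (a′ ∷ b′ ∷ c′ ∷ [])

  embedding₆ : Embedding f₆ (path 6)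
  embedding₆ = record
    { embeds    = λ i j → trans (embeds e i j) (toWitness
        {a? = all? λ i → all? λ j → adj (attach (path 3) 2F (path 3) 0F) i j Bool.≟ adj (path 6) i j} tt i j)
    ; injective = λ {i} {j} → injective e {i} {j}
    ; has-root  = has-root e
    ; parents   = λ {u} {i} → parents e {u} {i}
    ; mates     = mates e
    }
    where
    outside₃ : ∀ i → f₃ i ≢ a′
    outside₃ 0F e = ¬Sa′ (subst (T ∘ S) e (mate∈ b))
    outside₃ 1F e = b≢a′ e
    outside₃ 2F e = Adj⇒≢ G (proj₁ ra′) e
    e = extend embedding₃ {y = 2F} (b′ ∷ c′ ∷ []) (ra′ , a′b′ , b′c′ , tt) outside₃ id (λ _ → refl) (λ _ _ → refl) λ where
      0F → inj₂ (1F , refl)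
      1F → inj₂ (2F , refl)
      2F → inj₂ (1F , sym (mate-mate G eff (mate∈ a′)))

  S-f₆ : ∀ i → S (f₆ i) ≡ S₆ i
  S-f₆ 0F = true≡ (mate∈ b)
  S-f₆ 1F = true≡ (mate∈ r)
  S-f₆ 2F = false≡ ¬Sr
  S-f₆ 3F = false≡ ¬Sa′
  S-f₆ 4F = true≡ (mate∈ a′)
  S-f₆ 5F = true≡ (mate∈ b′)

  module _ (family : Family) where
    open Family family

    record Partial (m : ℕ) : Set where
      field
        {f}       : Fin m → Fin n
        {H}       : Graph m
        embedding : Embedding f H
        member    : Member H (S ∘ f)

    hit? : ∀ {m} (f : Fin m → Fin n) w → Dec (∃[ i ] f i ≡ w)
    hit? f w = any? λ i → f i ≟ w

    module _ {m} (p : Partial m) where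
      open Partial p

      frontier : ∀ {w} → (∀ i → f i ≢ w) → ∃[ y ] ∃[ v ] Child (f y) v × (∀ i → f i ≢ v)
      frontier {w} = go w (parent-wf w)
        where
        go : ∀ w → Acc Child w → (∀ i → f i ≢ w) → ∃[ y ] ∃[ v ] Child (f y) v × (∀ i → f i ≢ v)
        go w (acc rs) ∉w with parent w
        ... | inj₁ refl = let i , e = has-root embedding in contradiction e (∉w i)
        ... | inj₂ (u , uw) with hit? f u
        ...   | yes (y , refl) = y , w , uw , ∉w
        ...   | no ∉u = go u (rs uw) λ i e → ∉u (i , e)

      -- The image already contains the mate of `f y`, its only neighbour in `S`.
      frontier∉S : ∀ {y v} → Child (f y) v → (∀ i → f i ≢ v) → ¬ T (S v)
      frontier∉S {y} (yv , _) ∉v Sv = let j , e = mates embedding y in ∉v j (trans e (sym (mate-unique yv Sv)))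

      -- If `f y` is outside `S`, the mate of `v` and the mate of that are successive children, a
      -- path for the first operation. If `f y` is in `S`, it is the mate of `v`; then a neighbour
      -- of `v` outside `S` is a child, and such a triple starts there.
      grow : ∀ {w} → (∀ i → f i ≢ w) → ∃[ k ] Partial (m + suc k)
      grow ∉w with frontier ∉w
      ... | y , v , yv , ∉v with T? (S (f y))
      ...   | no ¬Sy = 2 , record
        { embedding = extend embedding {y = y} (b₁ ∷ c₁ ∷ []) (yv , vb , bc₁ , tt) ∉v id (λ _ → refl) (λ _ _ → refl) λ where
            0F → inj₂ (1F , refl)
            1F → inj₂ (2F , refl)
            2F → inj₂ (1F , sym (mate-mate G eff (mate∈ v)))
        ; member = add₃ member y ¬Sy λ i → labels (splitAt m i)
        }
        where
        ¬Sv : ¬ T (S v)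
        ¬Sv = frontier∉S yv ∉v
        b₁ = mate v
        c₁ = mate b₁
        vb : Child v b₁
        vb = mate-child yv ¬Sy
        bc₁ : Child b₁ c₁
        bc₁ = mate-child vb ¬Sv
        labels₃ : ∀ j → S (lookup (v ∷ b₁ ∷ c₁ ∷ []) j) ≡ S₃ j
        labels₃ 0F = false≡ ¬Sv
        labels₃ 1F = true≡ (mate∈ v)
        labels₃ 2F = true≡ (mate∈ b₁)
        labels : ∀ a → S ([ f , lookup (v ∷ b₁ ∷ c₁ ∷ []) ]′ a) ≡ [ S ∘ f , S₃ ]′ a
        labels (inj₁ i) = refl
        labels (inj₂ j) = labels₃ j
      ...   | yes Sy with outside (frontier∉S yv ∉v)
      ...     | a₁ , va , ¬Sa = 3 , record
        { embedding = extend embedding {y = y} (a₁ ∷ b₁ ∷ c₁ ∷ []) (yv , va₁ , ab , bc₁ , tt) ∉v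
            (orient reverse) (orient-involutive reverse) (orient-path₄ reverse) λ where
              0F → inj₁ (y , mate-unique (Adj-sym G (proj₁ yv)) Sy)
              1F → inj₂ (2F , refl)
              2F → inj₂ (3F , refl)
              3F → inj₂ (2F , sym (mate-mate G eff (mate∈ a₁)))
        ; member = add₄ member y Sy λ i → labels (splitAt m i)
        }
        where
        ¬Sv : ¬ T (S v)
        ¬Sv = frontier∉S yv ∉v
        b₁ = mate a₁
        c₁ = mate b₁
        va₁ : Child v a₁
        va₁ with neighbour va
        ... | inj₁ d = d
        ... | inj₂ d = contradiction (subst (T ∘ S) (parent-unique yv d) Sy) ¬Sa
        ab : Child a₁ b₁
        ab = mate-child va₁ ¬Sv
        bc₁ : Child b₁ c₁
        bc₁ = mate-child ab ¬Sa
        g = lookup (v ∷ a₁ ∷ b₁ ∷ c₁ ∷ [])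
        labels₄ : ∀ j → S (g j) ≡ S₄ j
        labels₄ 0F = false≡ ¬Sv
        labels₄ 1F = false≡ ¬Sa
        labels₄ 2F = true≡ (mate∈ a₁)
        labels₄ 3F = true≡ (mate∈ b₁)
        labels : ∀ a → S ([ f , g ∘ orient reverse ]′ a) ≡ [ S ∘ f , S₄ ∘ orient reverse ]′ a
        labels (inj₁ i) = refl
        labels (inj₂ j) = labels₄ (orient reverse j)

    InFamily : Set
    InFamily = ∃[ m ] ∃[ H ] ∃[ s ] Member {m} H s × G ≅ H

    -- The fuel `k` bounds the number of vertices still missing. Each step adds at least one, and
    -- injectivity keeps the size at most `n`.
    complete : ∀ k {m} → n ≤ k + m → Partial m → InFamily
    complete k {m} n≤ p with any? (λ w → ¬? (hit? (Partial.f p) w))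
    ... | no onto = m , H , S ∘ f , member , record
      { bijection = mk↔ₛ′ (proj₁ ∘ preimage) f (λ i → injective embedding (proj₂ (preimage (f i)))) (proj₂ ∘ preimage)
      ; preserves = λ u v → trans (cong₂ (adj G) (sym (proj₂ (preimage u))) (sym (proj₂ (preimage v)))) (embeds embedding _ _)
      }
      where
      open Partial p
      preimage : ∀ w → ∃[ i ] f i ≡ w
      preimage w = decidable-stable (hit? f w) λ miss → onto (w , miss)
    complete k {m} n≤ p | yes (w , ∉w) with grow p (λ i e → ∉w (i , e))
    complete zero {m} n≤ p | yes _ | k , q = contradiction
      (≤-trans (injective⇒≤ (injective (Partial.embedding q))) n≤) (ℕ.<⇒≱ (ℕ.m<m+n m (s≤s z≤n)))
    complete (suc l) {m} n≤ p | yes _ | k , q = complete l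
      (≤-trans n≤ (≤-trans (≤-reflexive (sym (ℕ.+-suc l m))) (ℕ.+-monoʳ-≤ l (ℕ.m<m+n m (s≤s z≤n))))) q

    in-family : InFamily
    in-family = complete n (ℕ.m≤m+n n 6) record { embedding = embedding₆ ; member = base S-f₆ }

labels-++ : ∀ {A : Set} (inS : A → Bool) {m k} (ℓ : Vec A m) (ℓ′ : Vec A k) {s : Fin m → Bool} {t : Fin k → Bool} {s′} →
            labelled inS ℓ ≗ s → labelled inS ℓ′ ≗ t → (∀ i → s′ i ≡ [ s , t ]′ (splitAt m i)) →
            labelled inS (ℓ ++ᵛ ℓ′) ≗ s′
labels-++ inS {m} ℓ ℓ′ {s} {t} p q s′≗ i = trans (labelled-++ inS ℓ ℓ′ i) (trans (merge (splitAt m i)) (sym (s′≗ i)))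
  where
  merge : [ labelled inS ℓ , labelled inS ℓ′ ]′ ≗ [ s , t ]′
  merge (inj₁ i) = p i
  merge (inj₂ j) = q j

family𝓣 : Family
family𝓣 = record
  { Member  = λ H s → ∃[ ℓ ] Labelled𝓣 H ℓ × labelled in𝓣 ℓ ≗ s
  ; reverse = false
  ; base    = λ s≗ → _ , p₆ , λ { 0F → sym (s≗ 0F) ; 1F → sym (s≗ 1F) ; 2F → sym (s≗ 2F)
                                ; 3F → sym (s≗ 3F) ; 4F → sym (s≗ 4F) ; 5F → sym (s≗ 5F) }
  ; add₃    = λ (ℓ , t , ℓ≗) y ¬Sy s′≗ → _ , op₁ t y (¬in𝓣⁻ (¬Sy ∘ subst T (ℓ≗ y))) ,
      labels-++ in𝓣 ℓ (A ∷ B ∷ C ∷ []) ℓ≗ (λ { 0F → refl ; 1F → refl ; 2F → refl }) s′≗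
  ; add₄    = λ (ℓ , t , ℓ≗) y Sy s′≗ → _ , op₂ t y (in𝓣⁻ (subst T (sym (ℓ≗ y)) Sy)) ,
      labels-++ in𝓣 ℓ (A ∷ A ∷ B ∷ C ∷ []) ℓ≗ (λ { 0F → refl ; 1F → refl ; 2F → refl ; 3F → refl }) s′≗
  }

family𝓞 : Family
family𝓞 = record
  { Member  = λ H s → ∃[ ℓ ] Labelled𝓞 H ℓ × labelled in𝓞 ℓ ≗ s
  ; reverse = true
  ; base    = λ s≗ → _ , p₆ , λ { 0F → sym (s≗ 0F) ; 1F → sym (s≗ 1F) ; 2F → sym (s≗ 2F)
                                ; 3F → sym (s≗ 3F) ; 4F → sym (s≗ 4F) ; 5F → sym (s≗ 5F) }
  ; add₃    = λ {_} {H} (ℓ , t , ℓ≗) z ¬Sz s′≗ →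
      -- The labelled tree is efficient itself, so the B-B-A path demanded at `z` consists of `z`,
      -- its mate and the mate of that.
      let open Efficient (labelled𝓞-efficient t) in
      _ , op₁ t (mate (mate z)) (mate z) z (Adj-sym H (mate-adj (mate z))) (Adj-sym H (mate-adj z))
            (in𝓞⁻ (mate∈ (mate z))) (in𝓞⁻ (mate∈ z)) (¬in𝓞⁻ (¬Sz ∘ subst T (ℓ≗ z))) ,
      labels-++ in𝓞 ℓ (A ∷ B ∷ B ∷ []) ℓ≗ (λ { 0F → refl ; 1F → refl ; 2F → refl }) s′≗
  ; add₄    = λ (ℓ , t , ℓ≗) x Sx s′≗ →
      let open Efficient (labelled𝓞-efficient t) in
      _ , op₂ t x (mate x) (mate-adj x) (in𝓞⁻ (subst T (sym (ℓ≗ x)) Sx)) (in𝓞⁻ (mate∈ x)) ,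
      labels-++ in𝓞 ℓ (B ∷ B ∷ A ∷ A ∷ []) ℓ≗ (λ { 0F → refl ; 1F → refl ; 2F → refl ; 3F → refl }) s′≗
  }

module _ {n} {G : Graph n} (tree : IsTree G) (3≤n : 3 ≤ n) {S : Fin n → Bool} (eff : Efficient (adj G) S) where

  efficient⇒In𝓣 : In𝓣 G
  efficient⇒In𝓣 with Growth.in-family tree eff (proj₂ (outside-exists tree eff 3≤n)) family𝓣
  ... | m , H , s , (ℓ , t , _) , iso = m , H , ℓ , t , iso

  efficient⇒In𝓞 : In𝓞 G
  efficient⇒In𝓞 with Growth.in-family tree eff (proj₂ (outside-exists tree eff 3≤n)) family𝓞
  ... | m , H , s , (ℓ , t , _) , iso = m , H , ℓ , t , iso

In𝓣⇒efficient : ∀ {n} {G : Graph n} → In𝓣 G → ∃ (Efficient (adj G))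
In𝓣⇒efficient (_ , _ , _ , t , iso) = ≅-efficient iso (labelled𝓣-efficient t)

In𝓞⇒efficient : ∀ {n} {G : Graph n} → In𝓞 G → ∃ (Efficient (adj G))
In𝓞⇒efficient (_ , _ , _ , t , iso) = ≅-efficient iso (labelled𝓞-efficient t)

-- Linking sets

singleton-card : ∀ {n} {f : Fin n → Bool} {i} → T (f i) → (∀ j → T (f j) → j ≡ i) → ∣ tabulate f ∣ ≡ 1
singleton-card {suc n} {f} {i} fi only with f zero in eq
singleton-card {suc n} {f} {zero} fi only | true = cong suc (empty-card λ j fj → 0≢suc (only (suc j) fj))
  where
  0≢suc : ∀ {j : Fin n} → suc j ≢ zero
  0≢suc ()
  empty-card : ∀ {n} {f : Fin n → Bool} → (∀ j → ¬ T (f j)) → ∣ tabulate f ∣ ≡ 0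
  empty-card {zero}  _ = refl
  empty-card {suc n} {f} none with f zero in eq
  ... | true  = contradiction (subst T (sym eq) tt) (none zero)
  ... | false = empty-card (none ∘ suc)
singleton-card {suc n} {f} {suc i} fi only | true with only zero (subst T (sym eq) tt)
... | ()
singleton-card {suc n} {f} {zero} fi only | false = ⊥-elim (subst T eq fi)
singleton-card {suc n} {f} {suc i} fi only | false =
  singleton-card {f = f ∘ suc} fi λ j fj → Fin.suc-injective (only (suc j) fj)

card-1-unique : ∀ {n} {f : Fin n → Bool} → ∣ tabulate f ∣ ≡ 1 → ∀ {i j} → T (f i) → T (f j) → i ≡ j
card-1-unique {f = f} one {i} {j} fi fj = lone (elements (tabulate f)) (trans (length-elements (tabulate f)) one)
  (elements⁺ (∈tabulate fi)) (elements⁺ (∈tabulate fj))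
  where
  ∈tabulate : ∀ {i} → T (f i) → i Subset.∈ tabulate f
  ∈tabulate {i} fi = lookup⇒[]= i (tabulate f) (trans (lookup∘tabulate f i) (true≡ fi))
  lone : ∀ {A : Set} (xs : List A) → length xs ≡ 1 → ∀ {i j} → i ∈ xs → j ∈ xs → i ≡ j
  lone (x ∷ []) _ (here refl) (here refl) = refl

IsDist⇒reach : ∀ {n} (G : Graph n) {u v k} → IsDist G u v k → Reach G k u v
IsDist⇒reach G d with IsMinimum.attained d
... | _ , w , len = path⇒reach G (walk⇒path w) len

reach-minimum⇒IsDist : ∀ {n} (G : Graph n) {u v k} → IsMinimum (λ k → Reach G k u v) k → IsDist G u v k
reach-minimum⇒IsDist G {k = k} d = record
  { attained = let xs , p , len = reach⇒path G k (IsMinimum.attained d) in xs , path⇒walk p , len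
  ; minimal  = λ (_ , w , len) → IsMinimum.minimal d (path⇒reach G (walk⇒path w) len)
  }

module _ {n} (G : Graph n) (e : Edge G) where

  endOf? : ∀ v → Dec (EndOf e v)
  endOf? v = (v ≟ src e) ⊎-dec (v ≟ tgt e)

module _ {n} {G : Graph n} (tree : IsTree G) where

  -- `distance3` speaks only of exact edge distances. A walk between two ends therefore has to be
  -- traded for the minimum, found by search over the ends.
  edge-distance-≤ : ∀ (e f : Edge G) {x y k} → EndOf e x → EndOf f y → Reach G k x y → ∃[ j ] IsEdgeDist G e f j × j ≤ k
  edge-distance-≤ e f {x} {y} {k} x∈ y∈ reach = j , dist ,
    ≤-trans (minimal least-d (x , y , x∈ , y∈ , refl)) (minimal (proj₂ (distance tree x y)) reach)
    where
    open IsMinimum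
    d : Fin n → Fin n → ℕ
    d x y = proj₁ (distance tree x y)
    Q : Pred ℕ 0ℓ
    Q k = ∃[ x ] ∃[ y ] EndOf e x × EndOf f y × d x y ≡ k
    found : ∃ (IsMinimum Q)
    found = least (λ k → any? λ x → any? λ y → endOf? G e x ×-dec endOf? G f y ×-dec (d x y ℕ.≟ k))
      (d x y , x , y , x∈ , y∈ , refl)
    j = proj₁ found
    least-d : IsMinimum Q j
    least-d = proj₂ found
    dist : IsEdgeDist G e f j
    dist = record
      { attained = let x , y , x∈ , y∈ , eq = attained least-d in
          x , y , x∈ , y∈ , subst (IsDist G x y) eq (reach-minimum⇒IsDist G (proj₂ (distance tree x y)))
      ; minimal  = λ { {i} (x , y , x∈ , y∈ , xy) → minimal least-d (x , y , x∈ , y∈ ,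
          ≤-antisym (minimal (proj₂ (distance tree x y)) (IsDist⇒reach G xy))
                    (minimal xy (let xs , p , len = reach⇒path G _ (attained (proj₂ (distance tree x y))) in
                      xs , path⇒walk p , len))) }
      }

-- From an efficient set to a linking set

module EfficientLinking {n} {G : Graph n} (tree : IsTree G) (3≤n : 3 ≤ n)
                        {S : Fin n → Bool} (eff : Efficient (adj G) S) where
  open Efficient eff

  -- The edge of mates nearest to v; these cells partition the vertices.
  cell : Fin n → Edge G
  cell v = edge G (mate-adj (mate v))

  cell-joins : ∀ v → Joins (mate v) (mate (mate v)) (cell v)
  cell-joins v = edge-joins G (mate-adj (mate v))

  F : EdgeSet G
  F e = S (src e) ∧ S (tgt e)

  F-end : ∀ {e x} → T (F e) → EndOf e x → T (S x)
  F-end Fe (inj₁ refl) = proj₁ (Equivalence.to T-∧ Fe)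
  F-end Fe (inj₂ refl) = proj₂ (Equivalence.to T-∧ Fe)

  F-intro : ∀ {x y} e → Joins x y e → T (S x) → T (S y) → T (F e)
  F-intro e (inj₁ (refl , refl)) Sx Sy = Equivalence.from T-∧ (Sx , Sy)
  F-intro e (inj₂ (refl , refl)) Sx Sy = Equivalence.from T-∧ (Sy , Sx)

  F-joins : ∀ {e x} → T (F e) → EndOf e x → Joins x (mate x) e
  F-joins {e} Fe (inj₁ refl) = inj₁ (refl , mate-unique (Edge.adjacent e) (F-end {e} Fe (inj₂ refl)))
  F-joins {e} Fe (inj₂ refl) = inj₂ (mate-unique (Adj-sym G (Edge.adjacent e)) (F-end {e} Fe (inj₁ refl)) , refl)

  cell∈F : ∀ v → T (F (cell v))
  cell∈F v = F-intro (cell v) (cell-joins v) (mate∈ v) (mate∈ (mate v))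

  cell-near : ∀ {e x v} → T (F e) → EndOf e x → Adj G v x → cell v ≡ e
  cell-near {e} {x} {v} Fe x∈ vx = joins-unique (cell v) e (cell-joins v)
    (subst (λ x → Joins x (mate x) e) (mate-unique vx (F-end {e} Fe x∈)) (F-joins {e} Fe x∈))

  cell-end : ∀ {e x} → T (F e) → EndOf e x → cell x ≡ e
  cell-end {e} {x} Fe x∈ = cell-near Fe (joined-endʳ e (F-joins {e} Fe x∈)) (mate-adj x)

  cell-mate : ∀ v → cell (mate v) ≡ cell v
  cell-mate v = cell-end (cell∈F v) (joined-endˡ (cell v) (cell-joins v))

  -- The last component keeps track that no edge between two vertices outside `S` is used, as
  -- `outside-cells` requires.
  Inner : Rel (Fin n) 0ℓ
  Inner u w = Adj G u w × cell u ≡ cell w × (T (S u) ⊎ T (S w))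

  cell-connected : ∀ {u w} → cell u ≡ cell w → Star Inner u w
  cell-connected {u} {w} eq = (mate-adj u , sym (cell-mate u) , inj₂ (mate∈ u)) ◅ across mate-end ◅◅
    ((Adj-sym G (mate-adj w) , cell-mate w , inj₁ (mate∈ w)) ◅ ε)
    where
    mate-end : mate w ≡ mate u ⊎ mate w ≡ mate (mate u)
    mate-end = endOf-joined (cell u) (cell-joins u)
      (subst (λ e → EndOf e (mate w)) (sym eq) (joined-endˡ (cell w) (cell-joins w)))
    across : mate w ≡ mate u ⊎ mate w ≡ mate (mate u) → Star Inner (mate u) (mate w)
    across (inj₁ e) = subst (Star Inner (mate u)) (sym e) ε
    across (inj₂ e) = subst (Star Inner (mate u)) (sym e)
      ((mate-adj (mate u) , sym (cell-mate (mate u)) , inj₁ (mate∈ u)) ◅ ε)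

  -- Within one cell, `u` and `w` are also connected through vertices of `S`, which would close a
  -- cycle with the edge `uw`.
  outside-cells : ∀ {u w} → Adj G u w → ¬ T (S u) → ¬ T (S w) → cell u ≢ cell w
  outside-cells {u} {w} uw ¬Su ¬Sw eq = Adj-acyclic tree (Adj⇒≢ G uw) uw (Star.map inner (cell-connected (sym eq)))
    where
    inner : ∀ {x y} → Inner x y → Without (Adj G) u w x y
    inner (xy , _ , Sxy) = xy , λ where
      (inj₁ (refl , refl)) → [ ¬Su , ¬Sw ]′ Sxy
      (inj₂ (refl , refl)) → [ ¬Sw , ¬Su ]′ Sxy

  -- Adjacency after contracting each cell to its edge of mates. On `F` it is the same as edge
  -- distance 3.
  Link : Rel (Edge G) 0ℓ
  Link e f = e ≢ f × ∃[ p ] ∃[ q ] Adj G p q × cell p ≡ e × cell q ≡ f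

  link-sym : Symmetric Link
  link-sym (e≢f , p , q , pq , pe , qf) = e≢f ∘ sym , q , p , Adj-sym G pq , qf , pe

  -- A walk between cells lifts to `G` through the connected cells. It avoids `pq`: steps inside a
  -- cell cannot use an edge between two cells, and steps between cells avoid this pair.
  link-acyclic : Acyclic Link
  link-acyclic {x} {y} x≢y (_ , p , q , pq , refl , refl) s = Adj-acyclic tree (Adj⇒≢ G pq) pq (lift s refl refl)
    where
    inner : ∀ {u w} → Inner u w → Without (Adj G) p q u w
    inner (uw , eq , _) = uw , λ where
      (inj₁ (refl , refl)) → x≢y eq
      (inj₂ (refl , refl)) → x≢y (sym eq)
    lift : ∀ {e f u w} → Star (Without Link (cell p) (cell q)) e f →
           cell u ≡ e → cell w ≡ f → Star (Without (Adj G) p q) u w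
    lift ε refl eq = Star.map inner (cell-connected (sym eq))
    lift (((e≢f , p′ , q′ , p′q′ , refl , refl) , ≢) ◅ s) ue wf =
      Star.map inner (cell-connected ue) ◅◅ (p′q′ , λ where
        (inj₁ (refl , refl)) → ≢ (inj₁ (refl , refl))
        (inj₂ (refl , refl)) → ≢ (inj₂ (refl , refl))) ◅ lift s refl wf

  -- Vertices of `S` at distance 1 are mates, and vertices of `S` at distance 2 coincide by their
  -- common neighbour, so in either case the cells agree.
  far-apart : ∀ k {x y} → T (S x) → T (S y) → cell x ≢ cell y → Reach G k x y → 3 ≤ k
  far-apart 0 Sx Sy ≢ refl = contradiction refl ≢
  far-apart 1 {x} Sx Sy ≢ (y , xy , refl) with mate-unique xy Sy
  ... | refl = contradiction (sym (cell-mate x)) ≢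
  far-apart 2 Sx Sy ≢ (_ , xm , _ , my , refl) = contradiction (cong cell (mate-shared G eff (Adj-sym G xm) my Sx Sy)) ≢
  far-apart (suc (suc (suc k))) _ _ _ _ = s≤s (s≤s (s≤s z≤n))

  edge-distance≥3 : ∀ {e f j} → T (F e) → T (F f) → e ≢ f → IsEdgeDist G e f j → 3 ≤ j
  edge-distance≥3 {e} {f} Fe Ff e≢f d with IsMinimum.attained d
  ... | x , y , x∈ , y∈ , xy = far-apart _ (F-end {e} Fe x∈) (F-end {f} Ff y∈)
    (λ eq → e≢f (trans (sym (cell-end Fe x∈)) (trans eq (cell-end Ff y∈)))) (IsDist⇒reach G xy)

  link⇒distance3 : ∀ {e f} → Link e f → IsEdgeDist G e f 3
  link⇒distance3 (e≢f , p , q , pq , refl , refl) = record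
    { attained = mate p , mate q , joined-endˡ (cell p) (cell-joins p) , joined-endˡ (cell q) (cell-joins q) , record
      { attained = _ , path⇒walk (Adj-sym G (mate-adj p) ∷ pq ∷ mate-adj q ∷ [-]) , refl
      ; minimal  = λ (_ , w , len) → far-apart _ (mate∈ p) (mate∈ q)
          (λ eq → e≢f (trans (sym (cell-mate p)) (trans eq (cell-mate q)))) (path⇒reach G (walk⇒path w) len)
      }
    ; minimal  = λ (x , y , x∈ , y∈ , xy) → far-apart _ (F-end {cell p} (cell∈F p) x∈) (F-end {cell q} (cell∈F q) y∈)
          (λ eq → e≢f (trans (sym (cell-end (cell∈F p) x∈)) (trans eq (cell-end (cell∈F q) y∈)))) (IsDist⇒reach G xy)
    }

  -- The two inner vertices of a walk of length three are adjacent to ends of `e` and of `f`, hence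
  -- lie in the two cells.
  distance3⇒link : ∀ {e f} → T (F e) → T (F f) → e ≢ f → IsEdgeDist G e f 3 → Link e f
  distance3⇒link Fe Ff e≢f d with IsMinimum.attained d
  ... | x , y , x∈ , y∈ , xy with IsDist⇒reach G xy
  ...   | p , xp , q , pq , _ , qy , refl = e≢f , p , q , pq , cell-near Fe x∈ (Adj-sym G xp) , cell-near Ff y∈ qy

  another-cell : ∀ e → ∃[ v ] cell v ≢ e
  another-cell e with outside-exists tree eff 3≤n
  ... | a , ¬Sa with outside ¬Sa
  ...   | a′ , aa′ , ¬Sa′ with cell a ≟ᵉ e
  ...     | no a≢e  = a , a≢e
  ...     | yes a≡e = a′ , λ a′≡e → outside-cells aa′ ¬Sa ¬Sa′ (trans a≡e (sym a′≡e))

  linked : ∀ {e} → T (F e) → ∃[ f ] T (F f) × Link e f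
  linked {e} Fe with another-cell e
  ... | v , v≢e with crossing {P = λ u → cell u ≡ e} (λ u → cell u ≟ᵉ e)
                       (linked-star tree (src e) v) (cell-end Fe (inj₁ refl)) v≢e
  ...   | u , w , uw , u≡e , w≢e = cell w , cell∈F w , w≢e ∘ sym , u , w , uw , u≡e , refl

  -- A vertex outside `S` has two neighbours, so a leaf is in `S`, and its only neighbour is its
  -- mate.
  pendant∈F : ∀ e → Pendant G e → T (F e)
  pendant∈F e = [ leaf∈F (Edge.adjacent e) (inj₁ (refl , refl)) ∘ proj₁
                , leaf∈F (Adj-sym G (Edge.adjacent e)) (inj₂ (refl , refl)) ∘ proj₁ ]′
    where
    leaf∈F : ∀ {u v} → Adj G u v → Joins u v e → Leaf G u → T (F e)
    leaf∈F {u} {v} uv joined leaf = F-intro e joined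
      (decidable-stable (T? (S u)) λ ¬Su → let x , y , ux , uy , x≢y = two-neighbours G eff ¬Su in
        x≢y (card-1-unique leaf ux uy))
      (subst (T ∘ S) (card-1-unique leaf (mate-adj u) uv) (mate∈ u))

  Step : Rel (Edge G) 0ℓ
  Step e f = IsEdgeDist G e f 3 × T (F f)

  cells-star : ∀ {u w} → Star (Adj G) u w → Star Step (cell u) (cell w)
  cells-star ε = ε
  cells-star (_◅_ {u} {v} uv s) with cell u ≟ᵉ cell v
  ... | yes eq = subst (λ e → Star Step e _) (sym eq) (cells-star s)
  ... | no ≢   = (link⇒distance3 (≢ , u , v , uv , refl , refl) , cell∈F v) ◅ cells-star s

  link-path : ∀ {e f es} → Path (λ e f → IsEdgeDist G e f 3) e f es → All (T ∘ F) es → Unique es → Path Link e f es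
  link-path [-] _ _ = [-]
  link-path (d ∷ p) (Fe ∷ Fs) (e∉ ∷ u) =
    distance3⇒link Fe (All.lookup Fs (path-head∈ p)) (All.lookup e∉ (path-head∈ p)) d ∷ link-path p Fs u

  F-linking : IsLinkingSet G F
  F-linking = record
    { pendant⊆F = pendant∈F
    ; distance3 = λ e Fe → let f , Ff , link = linked Fe in record
      { attained = f , (Ff , proj₁ link) , link⇒distance3 link
      ; minimal  = λ (f , (Ff , e≢f) , d) → edge-distance≥3 Fe Ff e≢f d
      }
    ; sequence  = sequence
    }
    where
    sequence : ∀ e f → T (F e) → T (F f) → e ≢ f → ∃! _≡_ λ es →
               IsWalk (λ e₁ e₂ → IsEdgeDist G e₁ e₂ 3) e f es × All (T ∘ F) es × Unique es
    sequence e f Fe Ff e≢f with eraseLoops _≟ᵉ_ (subst₂ (Star Step) (cell-end Fe (inj₁ refl)) (cell-end Ff (inj₁ refl))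
                                                  (cells-star (linked-star tree (src e) (src f))))
    ... | es , p , u = es , (path⇒walk p′ , all , u) , λ (w , all′ , u′) →
      unique-path _≟ᵉ_ link-sym link-acyclic (link-path p′ all u) u (link-path (walk⇒path w) all′ u′) u′
      where
      p′ = path-map proj₁ p
      all : All (T ∘ F) es
      all = path-All proj₂ Fe p

-- From a linking set to an efficient set, the vertices covered by it

module LinkingEfficient {n} {G : Graph n} (tree : IsTree G) (3≤n : 3 ≤ n)
                        {F : EdgeSet G} (linking : IsLinkingSet G F) where
  open IsLinkingSet linking

  Covered : Pred (Fin n) 0ℓ
  Covered v = ∃[ u ] Σ (Adj G v u) λ vu → T (F (edge G vu))

  covered? : Decidable Covered
  covered? v = any? λ u → covered-by? u
    where
    covered-by? : ∀ u → Dec (Σ (Adj G v u) λ vu → T (F (edge G vu)))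
    covered-by? u with adj? G v u
    ... | no ¬vu = no (¬vu ∘ proj₁)
    ... | yes vu with T? (F (edge G vu))
    ...   | yes t = yes (vu , t)
    ...   | no ¬t = no λ (vu′ , t) → ¬t (subst (T ∘ F ∘ edge G) (T-irrelevant vu′ vu) t)

  end-covered : ∀ {e v} → T (F e) → EndOf e v → Covered v
  end-covered {e} Fe (inj₁ refl) = tgt e , Edge.adjacent e ,
    subst (T ∘ F) (joins-unique e _ (inj₁ (refl , refl)) (edge-joins G (Edge.adjacent e))) Fe
  end-covered {e} Fe (inj₂ refl) = src e , Adj-sym G (Edge.adjacent e) ,
    subst (T ∘ F) (joins-unique e _ (inj₂ (refl , refl)) (edge-joins G (Adj-sym G (Edge.adjacent e)))) Fe

  far : ∀ {e f x y k} → T (F e) → T (F f) → e ≢ f → EndOf e x → EndOf f y → Reach G k x y → 3 ≤ k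
  far {e} {f} Fe Ff e≢f x∈ y∈ reach with edge-distance-≤ tree e f x∈ y∈ reach
  ... | j , d , j≤k = ≤-trans (IsMinimum.minimal (distance3 e Fe) (f , (Ff , e≢f) , d)) j≤k

  no-triangle : ∀ {u v w} → Adj G u v → Adj G v w → ¬ Adj G w u
  no-triangle uv vw wu = Adj-acyclic tree (Adj⇒≢ G uv) uv
    ((vw , λ { (inj₁ (refl , _)) → Adj-irrefl G uv ; (inj₂ (_ , refl)) → Adj-irrefl G wu }) ◅
     (wu , λ { (inj₁ (refl , _)) → Adj-irrefl G wu ; (inj₂ (refl , _)) → Adj-irrefl G vw }) ◅ ε)

  -- Covered by two edges of `F`, the neighbours would bring these within distance 2; covered by a
  -- common edge, they would form a triangle with `v`.
  covered-neighbour-unique : ∀ {v x y} → Adj G v x → Adj G v y → Covered x → Covered y → x ≡ y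
  covered-neighbour-unique {v} {x} {y} vx vy (_ , a , Fe) (_ , b , Ff) =
    decidable-stable (x ≟ y) impossible
    where
    e = edge G a
    f = edge G b
    impossible : ¬ (x ≢ y)
    impossible x≢y with e ≟ᵉ f
    ... | no e≢f = contradiction
      (far Fe Ff e≢f (edge-endˡ G a) (edge-endˡ G b) (v , Adj-sym G vx , y , vy , refl)) λ { (s≤s (s≤s ())) }
    ... | yes e≡f = no-triangle vx
      (joined-adj e (ends-joined e (edge-endˡ G a) (subst (λ e → EndOf e y) (sym e≡f) (edge-endˡ G b)) x≢y)) (Adj-sym G vy)

  pendant-edge∈F : ∀ {v u} (vu : Adj G v u) → (∀ {w} → Adj G v w → w ≡ u) → T (F (edge G vu))
  pendant-edge∈F {v} {u} vu only = pendant⊆F e (pendant (edge-joins G vu))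
    where
    e = edge G vu
    leaf : Leaf G v
    leaf = singleton-card vu λ _ vw → only vw
    pendant : Joins v u e → Pendant G e
    pendant (inj₁ (p , q)) = inj₁ (subst (Leaf G) (sym p) leaf , v , leaf , subst (λ u → Adj G u v) (sym q) (Adj-sym G vu))
    pendant (inj₂ (p , q)) = inj₂ (subst (Leaf G) (sym q) leaf , v , leaf , subst (λ u → Adj G u v) (sym p) (Adj-sym G vu))

  -- An uncovered vertex is not a leaf, because pendant edges belong to `F`.
  second-neighbour : ∀ {v u} → ¬ Covered v → Adj G v u → ∃[ w ] Adj G v w × w ≢ u
  second-neighbour {v} {u} ¬cv vu with any? (λ w → adj? G v w ×-dec ¬? (w ≟ u))
  ... | yes w = w
  ... | no none = contradiction
    (u , vu , pendant-edge∈F vu λ {w} vw → decidable-stable (w ≟ u) λ w≢u → none (w , vw , w≢u)) ¬cv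

  -- Otherwise, consecutive edges of a linking sequence on different sides of v would be at distance ≥ 4.
  module _ {v} (¬cv : ¬ Covered v) (none : ∀ {u} → Adj G v u → ¬ Covered u) where
    R = rooted tree v
    open Rooted R

    root-child : ∀ {u} → Adj G v u → Child v u
    root-child vu with neighbour vu
    ... | inj₁ c = c
    ... | inj₂ c = contradiction c ¬child-root

    below-disjoint : ∀ {a b w} → depth a ≡ depth b → Below a w → Below b w → a ≡ b
    below-disjoint eq self self = refl
    below-disjoint eq self (step c b) = contradiction
      (≤-trans (≤-reflexive (trans (sym (proj₂ c)) eq)) (below-depth b)) ℕ.1+n≰n
    below-disjoint eq (step c a) self = contradiction
      (≤-trans (≤-reflexive (trans (sym (proj₂ c)) (sym eq))) (below-depth a)) ℕ.1+n≰n
    below-disjoint eq (step c a) (step d b) = below-disjoint eq a (subst (Below _) (parent-unique d c) b)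

    module Side {u} (vu : Child v u) where

      -- The only edge leaving the side of `u` is `uv`, and it is not in `F`, as `u` is uncovered.
      ends-together : ∀ {e x y} → T (F e) → EndOf e x → EndOf e y → Below u x → Below u y
      ends-together {e} {x} {y} Fe x∈ y∈ b with x ≟ y
      ... | yes refl = b
      ... | no x≢y with neighbour (joined-adj e (ends-joined e x∈ y∈ x≢y))
      ...   | inj₁ c = step c b
      ...   | inj₂ c with below-parent c b
      ...     | inj₂ b′   = b′
      ...     | inj₁ refl = contradiction (end-covered Fe x∈) (none (proj₁ vu))

      -- A childless vertex below `u` is a leaf, and its pendant edge belongs to `F`.
      leaf-edge : ∃[ e ] T (F e) × Below u (src e)
      leaf-edge with childless-below u
      ... | l , b , no-child with parent l
      ...   | inj₁ refl = contradiction b (¬below-parent vu)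
      ...   | inj₂ (p , pl) = e , Fe , ends-together Fe (edge-endˡ G lp) (inj₁ refl) b
        where
        lp : Adj G l p
        lp = Adj-sym G (proj₁ pl)
        e = edge G lp
        only-parent : ∀ {w} → Child l w ⊎ Child w l → w ≡ p
        only-parent (inj₁ c) = contradiction c (no-child _)
        only-parent (inj₂ c) = parent-unique c pl
        Fe : T (F e)
        Fe = pendant-edge∈F lp λ lw → only-parent (neighbour lw)

      exit : ∀ {x y} → Adj G x y → Below u x → ¬ Below u y → x ≡ u × y ≡ v
      exit xy b ¬b with neighbour xy
      ... | inj₁ c = contradiction (step c b) ¬b
      ... | inj₂ c with below-parent c b
      ...   | inj₁ refl = refl , parent-unique c vu
      ...   | inj₂ b′   = contradiction b′ ¬b

      -- A walk `x p q y` leaving the side traverses `uv`. As its first edge, this makes `u`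
      -- covered; as its second, `y` is a covered neighbour of `v`; as its third, `v` itself is
      -- covered.
      ¬leave : ∀ {e f} → T (F e) → T (F f) → IsEdgeDist G e f 3 → Below u (src e) → ¬ ¬ Below u (src f)
      ¬leave Fe Ff d be ¬bf with IsMinimum.attained d
      ... | x , y , x∈ , y∈ , xy with IsDist⇒reach G xy
      ...   | p , xp , q , pq , _ , qy , refl = leave (below? u p) (below? u q)
        where
        bx : Below u x
        bx = ends-together Fe (inj₁ refl) x∈ be
        ¬by : ¬ Below u y
        ¬by b = ¬bf (ends-together Ff y∈ (inj₁ refl) b)
        leave : Dec (Below u p) → Dec (Below u q) → ⊥
        leave (no ¬bp) _ with exit xp bx ¬bp
        ... | refl , _ = none (proj₁ vu) (end-covered Fe x∈)
        leave (yes bp) (no ¬bq) with exit pq bp ¬bq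
        ... | _ , refl = none qy (end-covered Ff y∈)
        leave (yes bp) (yes bq) with exit qy bq ¬by
        ... | _ , refl = ¬cv (end-covered Ff y∈)

    Step : Rel (Edge G) 0ℓ
    Step e f = IsEdgeDist G e f 3 × T (F e) × T (F f)

    steps : ∀ {e f es} → Path (λ e f → IsEdgeDist G e f 3) e f es → All (T ∘ F) es → Star Step e f
    steps [-] _ = ε
    steps (d ∷ p) (Fe ∷ Fs) = (d , Fe , All.lookup Fs (path-head∈ p)) ◅ steps p Fs

    no-covered-neighbour-impossible : ⊥
    no-covered-neighbour-impossible with neighbour-exists tree 3≤n v
    ... | u , vu with second-neighbour ¬cv vu
    ...   | w , vw , w≢u with Side.leaf-edge (root-child vu) | Side.leaf-edge (root-child vw)
    ...     | e , Fe , be | f , Ff , bf = go (sequence e f Fe Ff e≢f)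
      where
      ¬below : ¬ Below u (src f)
      ¬below b = w≢u (below-disjoint (trans (proj₂ (root-child vw)) (sym (proj₂ (root-child vu)))) bf b)
      e≢f : e ≢ f
      e≢f refl = ¬below be
      go : ∃! _≡_ (λ es → IsWalk (λ e₁ e₂ → IsEdgeDist G e₁ e₂ 3) e f es × All (T ∘ F) es × Unique es) → ⊥
      go (es , (walk , all , _) , _)
        with crossing {P = λ g → Below u (src g)} (λ g → below? u (src g)) (steps (walk⇒path walk) all) be ¬below
      ... | _ , _ , (d , Fg , Fh) , bg , ¬bh = Side.¬leave (root-child vu) Fg Fh d bg ¬bh

  covered-neighbour : ∀ v → ∃[ u ] Adj G v u × Covered u
  covered-neighbour v with covered? v
  ... | yes (u , vu , Fe) = u , vu , end-covered Fe (edge-endʳ G vu)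
  ... | no ¬cv with any? (λ u → adj? G v u ×-dec covered? u)
  ...   | yes u = u
  ...   | no none = ⊥-elim (no-covered-neighbour-impossible ¬cv λ vu cu → none (_ , vu , cu))

  S : Fin n → Bool
  S v = does (covered? v)

  ∈S⁻ : ∀ {v} → T (S v) → Covered v
  ∈S⁻ {v} t with covered? v
  ... | yes c = c

  ∈S⁺ : ∀ {v} → Covered v → T (S v)
  ∈S⁺ {v} c = subst T (sym (dec-true (covered? v) c)) tt

  covered-efficient : Efficient (adj G) S
  covered-efficient = record
    { mate        = λ v → proj₁ (covered-neighbour v)
    ; mate-adj    = λ v → proj₁ (proj₂ (covered-neighbour v))
    ; mate∈       = λ v → ∈S⁺ (proj₂ (proj₂ (covered-neighbour v)))
    ; mate-unique = λ {v} vu Su →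
        covered-neighbour-unique vu (proj₁ (proj₂ (covered-neighbour v))) (∈S⁻ Su) (proj₂ (proj₂ (covered-neighbour v)))
    ; outside     = λ ¬Sv → outside (¬Sv ∘ ∈S⁺)
    }
    where
    outside : ∀ {v} → ¬ Covered v → ∃[ w ] Adj G v w × ¬ T (S w)
    outside {v} ¬cv with covered-neighbour v
    ... | u , vu , cu with second-neighbour ¬cv vu
    ...   | w , vw , w≢u = w , vw , λ Sw → w≢u (covered-neighbour-unique vw vu (∈S⁻ Sw) cu)

  -- If both ends of `e` are covered, the edge of `F` covering one of them leads to its only covered
  -- neighbour, the other end. Thus `F` is determined by its covered vertices, and uniqueness of
  -- linking sets reduces to `efficient-unique`.
  F≡ : ∀ e → F e ≡ S (src e) ∧ S (tgt e)
  F≡ e = T⇔⇒≡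
    (λ Fe → Equivalence.from T-∧ (∈S⁺ (end-covered Fe (inj₁ refl)) , ∈S⁺ (end-covered Fe (inj₂ refl))))
    λ t → let Ss , St = Equivalence.to T-∧ t in from (∈S⁻ Ss) (∈S⁻ St)
    where
    from : Covered (src e) → Covered (tgt e) → T (F e)
    from (u , su , Fe) ct with covered-neighbour-unique su (Edge.adjacent e) (end-covered Fe (edge-endʳ G su)) ct
    ... | refl = subst (T ∘ F) (joins-unique (edge G su) e (edge-joins G su) (inj₁ (refl , refl))) Fe

module _ {n} {G : Graph n} (tree : IsTree G) (3≤n : 3 ≤ n) where

  efficient⇒unique-linking : ∀ {S} → Efficient (adj G) S → HasUniqueLinkingSet G
  efficient⇒unique-linking eff = EfficientLinking.F tree 3≤n eff , EfficientLinking.F-linking tree 3≤n eff ,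
    λ linking e → let open LinkingEfficient tree 3≤n linking
                      S≗ = efficient-unique tree eff covered-efficient
                  in trans (cong₂ _∧_ (S≗ (src e)) (S≗ (tgt e))) (sym (F≡ e))

  unique-linking⇒efficient : HasUniqueLinkingSet G → ∃ (Efficient (adj G))
  unique-linking⇒efficient (_ , linking , _) = _ , LinkingEfficient.covered-efficient tree 3≤n linking

theorem2 : ∀ {n : ℕ} (G : Graph n) → IsTree G → 6 ≤ n →
    (InClass 3 G ⇔ In𝓣 G) × (In𝓣 G ⇔ In𝓞 G) × (In𝓞 G ⇔ HasUniqueLinkingSet G)
theorem2 G tree 6≤n =
    mk⇔ (λ class → efficient⇒In𝓣 tree 3≤n (proj₂ (class3⇒efficient tree 3≤n class)))
        (λ t → efficient⇒class3 tree (proj₂ (In𝓣⇒efficient t)) 3≤n)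
  , mk⇔ (λ t → efficient⇒In𝓞 tree 3≤n (proj₂ (In𝓣⇒efficient t)))
        (λ o → efficient⇒In𝓣 tree 3≤n (proj₂ (In𝓞⇒efficient o)))
  , mk⇔ (λ o → efficient⇒unique-linking tree 3≤n (proj₂ (In𝓞⇒efficient o)))
        (λ u → efficient⇒In𝓞 tree 3≤n (proj₂ (unique-linking⇒efficient tree 3≤n u)))
  where
  3≤n = ≤-trans (s≤s (s≤s (s≤s z≤n))) 6≤n
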